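{- Let $\mathfrak s$ be a Turing degree. Suppose that $\mathbb K$ is an $\mathfrak s$-computable age, that the Turing degree of the embedding information $\mathscr{EI}(\mathbb K)$ is $\leq_{\mathrm T}\mathfrak s$, and that $\mathbb K$ has the $\mathfrak s$-computable hereditary property $\mathfrak s$-(cHP), the $\mathfrak s$-computable joint embedding property $\mathfrak s$-(cJEP), and the $\mathfrak s$-computable cofinal amalgamation property $\mathfrak s$-(cCAP). Then there is an $\mathfrak s$-computable cofinal Fraïssé limit of $\mathbb K$.
   Context: Languages and structures. $\mathcal{L}$ is a countable language (relation symbols of positive arity; function symbols of any arity, 0-ary ones being constants) with a computable representation: relation symbols $R_n$ and function symbols $F_m$ are indexed bijectively by disjoint computable subsets of $\omega$, with arity computable from the index. An $\mathcal{L}$-structure $\mathcal{M}$ is c.e. if its underlying set $M$ is a c.e. subset of $\omega$ and the sets $\{(n,\mathbf a): \mathcal M\models R_n(\mathbf a)\}$, $\{(n,\mathbf a): \mathcal M\models \neg R_n(\mathbf a)\}$, $\{(m,\mathbf a,b): \mathcal M\models F_m(\mathbf a)=b\}$ are c.e.; it is computable if moreover $M$ is computable. "$\mathfrak s$-computable" versions of notions are obtained by relativizing to $\mathfrak s$. Tuples are finite; $\mathrm{cl}_{\mathcal M}(\mathbf a)$ is the smallest substructure of $\mathcal M$ containing $\mathbf a$. For tuples of the same length, $\mathbf a\sim\mathbf b$ means that coordinates of $\mathbf a$ are equal exactly when the corresponding coordinates of $\mathbf b$ are; for $\mathbf a\in\mathcal A$, $\mathbf b\in\mathcal B$ of the same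 length, $\mathbf a\simeq\mathbf b$ means that for every atomic $\mathcal L$-formula $\varphi$, $\mathcal A\models\varphi(\mathbf a)$ iff $\mathcal B\models\varphi(\mathbf b)$; equivalently $\mathbf a\mapsto\mathbf b$ extends to an isomorphism $\mathfrak t(\mathbf a,\mathbf b):\mathrm{cl}(\mathbf a)\to\mathrm{cl}(\mathbf b)$. Ages. An age is a collection of finitely generated $\mathcal L$-structures closed under isomorphism. A computable age (computable representation of an age $\mathcal K$) is a c.e. set $\mathbb K$ of triples $(\mathbf a,\mathcal A,i)$ (computable structures being given by indices), with exactly one triple for each $i\in\omega$, written $\mathbb I(i)=(\mathbf a_i,\mathcal A_i,i)$, such that each $\mathcal A_i$ is a computable $\mathcal L$-structure in $\mathcal K$ with $\mathcal A_i=\mathrm{cl}_{\mathcal A_i}(\mathbf a_i)$, and every $\mathcal B\in\mathcal K$ is isomorphic to some $\mathcal A_i$. The embedding information $\mathscr{EI}(\mathbb K)$ is the set of tuples $(\mathbb I(k_0),\mathbf b_0,\mathbb I(k_1),\mathbf b_1)$ with $\mathbf b_0\in\mathcal A_{k_0}$, $\mathbf b_1\in\mathcal A_{k_1}$ and $\mathbf b_0\simeq\mathbf b_1$. Embeddings and amalgamation diagrams. A potential embedding in $\mathbb K$ is a triple $F=(\mathbb I(i),\mathbb I(j),\mathbf c)$ with $\mathbf c\in\mathcal A_j$; $\mathrm{dom}(F)=\mathbb I(i)$, $\mathrm{codom}(F)=\mathbb I(j)$, $\mathrm{range}(F)=\mathbf c$. It is an embedding if $\mathbf a_i\simeq\mathbf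 c$ (it then encodes the embedding $\mathcal A_i\to\mathcal A_j$ sending $\mathbf a_i$ to $\mathbf c$); composition of embeddings is composition of the encoded maps, and an isomorphism is an embedding whose encoded map is onto. A potential span is a pair $(F_0,F_1)$ of potential embeddings with $\mathrm{dom}(F_0)=\mathrm{dom}(F_1)$; it is a span if both are embeddings. An amalgamation diagram over a potential span $(F_0,F_1)$ is a pair $(G_0,G_1)$ with $G_0$ an embedding, $G_1$ a potential embedding, $\mathrm{dom}(G_i)=\mathrm{codom}(F_i)$ for $i\in\{0,1\}$, $\mathrm{codom}(G_0)=\mathrm{codom}(G_1)$, and such that if $(F_0,F_1)$ is a span then $G_1$ is an embedding and $G_0\circ F_0=G_1\circ F_1$. Effective properties. $\mathfrak s$-(cHP): there is an $\mathfrak s$-computable function taking $(\mathbb I(i),\mathbf b)$ with $\mathbf b\in\mathcal A_i$ to some $\mathbb I(j)$ with $\mathbf a_j\simeq\mathbf b$. $\mathfrak s$-(cJEP): there is an $\mathfrak s$-computable function taking each pair $(\mathbb I(\ell_0),\mathbb I(\ell_1))$ to a pair $(F_0,F_1)$ of embeddings with $\mathrm{dom}(F_0)=\mathbb I(\ell_0)$, $\mathrm{dom}(F_1)=\mathbb I(\ell_1)$, $\mathrm{codom}(F_0)=\mathrm{codom}(F_1)$. An amalgamation base is an $\mathcal A'\in\mathcal K$ such that whenever $\mathcal B,\mathcal C\in\mathcal K$ and $f_{\mathcal B}:\mathcal A'\to\mathcal B$, $f_{\mathcal C}:\mathcal A'\to\mathcal C$ are embeddings, there are $\mathcal D\in\mathcal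 K$ and embeddings $\alpha_{\mathcal B}:\mathcal B\to\mathcal D$, $\alpha_{\mathcal C}:\mathcal C\to\mathcal D$ with $\alpha_{\mathcal B}\circ f_{\mathcal B}=\alpha_{\mathcal C}\circ f_{\mathcal C}$. A collection of distinguished extensions is a collection of embeddings in $\mathbb K$ closed under pre- and post-composition with isomorphisms between elements of $\mathbb K$ and such that every $\mathbb I(i)$ is the domain of some member. A witness to (CAP) is a pair $(\mathrm{AB},f)$ where $\mathrm{AB}$ is a collection of distinguished extensions each of whose members has an amalgamation base as codomain, and $f$ takes each tuple $(F,G_0,G_1)$ with $F\in\mathrm{AB}$, $(G_0,G_1)$ a potential span and $\mathrm{dom}(G_0)=\mathrm{dom}(G_1)=\mathrm{codom}(F)$ to an amalgamation diagram over $(G_0,G_1)$. It is $\mathfrak s$-computable if $\mathrm{AB}$ is $\mathfrak s$-c.e. and $f$ is an $\mathfrak s$-computable partial function. $\mathbb K$ has $\mathfrak s$-(cCAP) if it has an $\mathfrak s$-computable witness to (CAP). Cofinal Fraïssé limits. The age of a structure $\mathcal M$ is the collection of $\mathcal L$-structures isomorphic to a finitely generated substructure of $\mathcal M$. A cofinal collection in $\mathcal M$ is a collection $E$ of finite tuples in $\mathcal M$ such that: for every finite tuple $\mathbf a$ in $\mathcal M$ there is $\mathbf b\in E$ with $\mathbf a\subseteq\mathrm{cl}_{\mathcal M}(\mathbf b)$; if $\mathbf b\in E$ and $\mathbf a\subseteq\mathrm{cl}_{\mathcal M}(\mathbf b)$ is a finite tuple then $\mathbf a\mathbf b\in E$;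 and if $\mathbf a\in E$ and $\mathbf a\simeq\mathbf b$ then $\mathbf b\in E$. An $\mathfrak s$-computable structure $\mathcal M$ is $\mathfrak s$-computably cofinally ultrahomogeneous if, for some $\mathfrak s$-computable cofinal collection $E$ in $\mathcal M$, there is an $\mathfrak s$-computable $g$ whose domain is the set of pairs $(\mathbf a,\mathbf b)$ of tuples in $\mathcal M$ with $\mathbf a\in E$ and $\mathbf a\sim\mathbf b$, such that $g(\mathbf a,\mathbf b)$ is the index of an $\mathfrak s$-computable bijection $g_{\mathbf a,\mathbf b}:\mathcal M\to\mathcal M$ with $g_{\mathbf a,\mathbf b}(\mathbf a)=\mathbf b$, and if $\mathbf a\simeq\mathbf b$ then $g_{\mathbf a,\mathbf b}$ is an automorphism of $\mathcal M$. An $\mathfrak s$-computable structure $\mathcal M$ is an $\mathfrak s$-computable cofinal Fraïssé limit of $\mathbb K$ if $\mathcal M$ is $\mathfrak s$-computably cofinally ultrahomogeneous and $\mathbb K$ is an $\mathfrak s$-computable representation of the age of $\mathcal M$.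
   Formalization: The cofinal collection E in the definition of 𝔰-computable cofinal ultrahomogeneity is only required to be 𝔰-c.e., not 𝔰-computable; with a decidable E the claim is false, since some computable ages meeting every hypothesis have no limit with decidable E. -}

module Defs where

open import Level using (0ℓ)
open import Data.Bool.Base using (Bool; T)
open import Data.Empty using (⊥)
open import Data.Fin.Base as Fin using (Fin)
open import Data.List.Base as List using (List; []; _∷_; _++_; length; lookup)
open import Data.List.Relation.Unary.All as ListAll using ()
open import Data.Nat.Base using (ℕ; zero; suc; _+_; _≤_; _<_)
open import Data.Product.Base using (Σ; ∃; ∃-syntax; Σ-syntax; _×_; _,_; proj₁; proj₂)
open import Data.Sum.Base using (_⊎_)
open import Data.Vec.Base as Vec using (Vec; []; _∷_; toList)
open import Data.Vec.Relation.Binary.Pointwise.Inductive using (Pointwise; []; _∷_)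
open import Data.Vec.Relation.Unary.All as VecAll using ([]; _∷_)
open import Function.Base using (_∘_)
open import Function.Bundles using (_⇔_; mk⇔; Equivalence; Injection; Bijection)
open import Function.Definitions using (Surjective)
open import Relation.Binary.Bundles using (Setoid)
import Relation.Binary.Construct.On as On
open import Relation.Binary.PropositionalEquality as ≡ using (_≡_)
open import Relation.Nullary.Negation using (¬_)
open import Relation.Unary using (Pred)

triangle : ℕ → ℕ
triangle zero    = zero
triangle (suc n) = suc n + triangle n

-- Cantor's bijection ℕ × ℕ → ℕ.
infixr 5 ⟨_,_⟩
⟨_,_⟩ : ℕ → ℕ → ℕ
⟨ x , y ⟩ = x + triangle (x + y)

codeList : List ℕ → ℕ
codeList []       = 0
codeList (x ∷ xs) = suc ⟨ x , codeList xs ⟩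

-- Partial recursive functions of one argument on ℕ, relative to an oracle.
-- The scheme univ is Kleene's enumeration scheme S9 (see Eval); since the
-- partial functions computable from an oracle have a universal member, it
-- adds no new functions.
data Code : Set where
  zero succ fst snd oracle univ : Code
  pair comp prec                : Code → Code → Code
  rfind                         : Code → Code

encode : Code → ℕ
encode zero       = ⟨ 0 , 0 ⟩
encode succ       = ⟨ 1 , 0 ⟩
encode fst        = ⟨ 2 , 0 ⟩
encode snd        = ⟨ 3 , 0 ⟩
encode oracle     = ⟨ 4 , 0 ⟩
encode univ       = ⟨ 5 , 0 ⟩
encode (pair f g) = ⟨ 6 , ⟨ encode f , encode g ⟩ ⟩
encode (comp f g) = ⟨ 7 , ⟨ encode f , encode g ⟩ ⟩
encode (prec f g) = ⟨ 8 , ⟨ encode f , encode g ⟩ ⟩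
encode (rfind f)  = ⟨ 9 , encode f ⟩

-- An oracle is given by the graph of a partial function.
Oracle : Set₁
Oracle = ℕ → ℕ → Set

-- Unrelativized computability is computability from the nowhere defined
-- oracle function.
none : Oracle
none _ _ = ⊥

χ : Pred ℕ 0ℓ → Oracle
χ X n y = (X n × y ≡ 1) ⊎ (¬ X n × y ≡ 0)

-- Eval O c x y : the program c with oracle O halts on input x with output y.
-- The pairing ⟨_,_⟩ being a bijection, every input of fst, snd, univ, prec
-- is a pair.
data Eval (O : Oracle) : Code → ℕ → ℕ → Set where
  zero   : ∀ {x} → Eval O zero x 0
  succ   : ∀ {x} → Eval O succ x (suc x)
  fst    : ∀ {x y} → Eval O fst ⟨ x , y ⟩ x
  snd    : ∀ {x y} → Eval O snd ⟨ x , y ⟩ y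
  oracle : ∀ {x y} → O x y → Eval O oracle x y
  univ   : ∀ {c x y} → Eval O c x y → Eval O univ ⟨ encode c , x ⟩ y
  pair   : ∀ {f g x y z} → Eval O f x y → Eval O g x z →
           Eval O (pair f g) x ⟨ y , z ⟩
  comp   : ∀ {f g x y z} → Eval O g x y → Eval O f y z →
           Eval O (comp f g) x z
  prec-0 : ∀ {f g x y} → Eval O f x y → Eval O (prec f g) ⟨ x , 0 ⟩ y
  prec-s : ∀ {f g x n y z} → Eval O (prec f g) ⟨ x , n ⟩ y →
           Eval O g ⟨ x , ⟨ n , y ⟩ ⟩ z →
           Eval O (prec f g) ⟨ x , suc n ⟩ z
  rfind  : ∀ {f x n} → Eval O f ⟨ x , n ⟩ 0 →
           (∀ m → m < n → ∃[ k ] Eval O f ⟨ x , m ⟩ (suc k)) →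
           Eval O (rfind f) x n

-- φ O e x y : the e-th partial function computable from O maps x to y.
φ : Oracle → ℕ → ℕ → ℕ → Set
φ O e x y = ∃[ c ] encode c ≡ e × Eval O c x y

Decides : Oracle → ℕ → Pred ℕ 0ℓ → Set
Decides O e A = ∀ n → (A n × φ O e n 1) ⊎ (¬ A n × φ O e n 0)

-- The e-th function is total and lists A: its value at a stage is suc n when
-- n is listed at that stage, and 0 when nothing is listed.
Enumerates : Oracle → ℕ → Pred ℕ 0ℓ → Set
Enumerates O e A =
  (∀ s → ∃[ y ] φ O e s y) × (∀ n → A n ⇔ (∃[ s ] φ O e s (suc n)))

Decidable : Oracle → Pred ℕ 0ℓ → Set
Decidable O A = ∃[ e ] Decides O e A

CE : Oracle → Pred ℕ 0ℓ → Set
CE O A = ∃[ e ] Enumerates O e A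

-- A Turing degree is given by a representative X ⊆ ω; "𝔰-computable" is
-- computability from the oracle χ X.
infix 4 _≤ᵀ_
_≤ᵀ_ : Pred ℕ 0ℓ → Pred ℕ 0ℓ → Set
A ≤ᵀ X = Decidable (χ X) A

record Language : Set where
  field
    isRel isFun      : ℕ → Bool
    disjoint         : ∀ n → T (isRel n) → ¬ T (isFun n)
    arity            : ℕ → ℕ
    positive         : ∀ n → T (isRel n) → 1 ≤ arity n
    isRel-computable : Decidable none (T ∘ isRel)
    isFun-computable : Decidable none (T ∘ isFun)
    arity-computable : ∃[ e ] (∀ n → T (isRel n) ⊎ T (isFun n) → φ none e n (arity n))

  RelSym FunSym : Set
  RelSym = ∃[ n ] T (isRel n)
  FunSym = ∃[ n ] T (isFun n)

  arityᴿ : RelSym → ℕ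
  arityᴿ = arity ∘ proj₁

  arityᶠ : FunSym → ℕ
  arityᶠ = arity ∘ proj₁

module _ (L : Language) where
  open Language L

  data Term (n : ℕ) : Set where
    var : Fin n → Term n
    app : (f : FunSym) → Vec (Term n) (arityᶠ f) → Term n

  data Atomic (n : ℕ) : Set where
    _≐_ : Term n → Term n → Atomic n
    rel : (r : RelSym) → Vec (Term n) (arityᴿ r) → Atomic n

  record StructureOn (S : Setoid 0ℓ 0ℓ) : Set₁ where
    open Setoid S
    field
      Rel      : (r : RelSym) → Vec Carrier (arityᴿ r) → Set
      fun      : (f : FunSym) → Vec Carrier (arityᶠ f) → Carrier
      Rel-resp : ∀ r {v w} → Pointwise _≈_ v w → Rel r v → Rel r w
      fun-cong : ∀ f {v w} → Pointwise _≈_ v w → fun f v ≈ fun f w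

  record Structure : Set₁ where
    field
      setoid      : Setoid 0ℓ 0ℓ
      structureOn : StructureOn setoid
    open Setoid setoid public
    open StructureOn structureOn public

  -- Structures whose underlying set is a subset of ω.
  record ωStructure : Set₁ where
    field
      Dom : Pred ℕ 0ℓ
    domSetoid : Setoid 0ℓ 0ℓ
    domSetoid = On.setoid (≡.setoid ℕ) (proj₁ {B = Dom})
    field
      onDom : StructureOn domSetoid
    structure : Structure
    structure = record { structureOn = onDom }
    open Structure structure public

module _ {L : Language} where
  open Language L

  module _ (A : Structure L) where
    open Structure A

    -- Finite tuples are lists.
    Tuple : Set
    Tuple = List Carrier

    -- Membership in cl(a), the least substructure containing the tuple a.
    data Cl (a : Tuple) : Carrier → Set where
      gen : ∀ i {x} → x ≈ lookup a i → Cl a x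
      app : ∀ f {v x} → VecAll.All (Cl a) v → x ≈ fun f v → Cl a x

    infix 4 _⊆Cl_
    _⊆Cl_ : Tuple → Tuple → Set
    a ⊆Cl b = ListAll.All (Cl b) a

    Generates : Tuple → Set
    Generates a = ∀ x → Cl a x

    FinitelyGenerated : Set
    FinitelyGenerated = ∃ Generates

    module _ {n} (ρ : Fin n → Carrier) where
      mutual
        ⟦_⟧ : Term L n → Carrier
        ⟦ var i ⟧    = ρ i
        ⟦ app f ts ⟧ = fun f ⟦ ts ⟧*

        ⟦_⟧* : ∀ {k} → Vec (Term L n) k → Vec Carrier k
        ⟦ [] ⟧*     = []
        ⟦ t ∷ ts ⟧* = ⟦ t ⟧ ∷ ⟦ ts ⟧*

    infix 4 _⊨_
    _⊨_ : ∀ {n} → (Fin n → Carrier) → Atomic L n → Set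
    ρ ⊨ (s ≐ t)  = ⟦ ρ ⟧ s ≈ ⟦ ρ ⟧ t
    ρ ⊨ rel r ts = Rel r (⟦ ρ ⟧* ts)

    values : ∀ {a k} → Vec (∃ (Cl a)) k → Vec Carrier k
    values = Vec.map proj₁

    values-all : ∀ {a k} (v : Vec (∃ (Cl a)) k) → VecAll.All (Cl a) (values v)
    values-all []            = []
    values-all ((_ , p) ∷ v) = p ∷ values-all v

    values-cong : ∀ {a k l} {v : Vec (∃ (Cl a)) k} {w : Vec (∃ (Cl a)) l} →
                  Pointwise (λ x y → proj₁ x ≈ proj₁ y) v w →
                  Pointwise _≈_ (values v) (values w)
    values-cong []       = []
    values-cong (e ∷ es) = e ∷ values-cong es

    clStructure : Tuple → Structure L
    clStructure a = record
      { setoid      = On.setoid setoid (proj₁ {B = Cl a})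
      ; structureOn = record
        { Rel      = λ r v → Rel r (values v)
        ; fun      = λ f v → fun f (values v) , app f (values-all v) refl
        ; Rel-resp = λ r es → Rel-resp r (values-cong es)
        ; fun-cong = λ f es → fun-cong f (values-cong es)
        }
      }

  record PreservesStructure (A B : Structure L)
         (h : Structure.Carrier A → Structure.Carrier B) : Set where
    private
      module A = Structure A
      module B = Structure B
    field
      preservesRel : ∀ r v → A.Rel r v ⇔ B.Rel r (Vec.map h v)
      preservesFun : ∀ f v → h (A.fun f v) B.≈ B.fun f (Vec.map h v)

  record Embedding (A B : Structure L) : Set where
    field
      injection : Injection (Structure.setoid A) (Structure.setoid B)
    open Injection injection public using (to; cong; injective)
    field
      preserves : PreservesStructure A B to
    open PreservesStructure preserves public

  Onto : ∀ {A B} → Embedding A B → Set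
  Onto {A} {B} h = Surjective (Structure._≈_ A) (Structure._≈_ B) (Embedding.to h)

  infix 4 _≅_
  _≅_ : Structure L → Structure L → Set
  A ≅ B = Σ[ h ∈ Embedding A B ] Onto h

  module _ (A B : Structure L) where
    private
      module A = Structure A
      module B = Structure B

    -- [ A , B ] a ∼ b and [ A , B ] a ≃ b: the tuples a of A and b of B have
    -- the same length and the same equalities between coordinates,
    -- respectively satisfy the same atomic formulas.
    infix 4 [_,_]_∼_ [_,_]_≃_
    [_,_]_∼_ : Tuple A → Tuple B → Set
    [_,_]_∼_ a b = Σ[ eq ∈ length a ≡ length b ] (∀ i j →
      (lookup a i A.≈ lookup a j) ⇔
      (lookup b (Fin.cast eq i) B.≈ lookup b (Fin.cast eq j)))

    [_,_]_≃_ : Tuple A → Tuple B → Set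
    [_,_]_≃_ a b = Σ[ eq ∈ length a ≡ length b ] (∀ (ψ : Atomic L (length a)) →
      (_⊨_ A (lookup a) ψ) ⇔ (_⊨_ B (lookup b ∘ Fin.cast eq) ψ))

  -- When a generates A and a ≃ b, the embedding A → B sending a to b.
  module Extend (A B : Structure L) {a : Tuple A} {b : Tuple B}
                (gen-a : Generates A a) (a≃b : [ A , B ] a ≃ b) where
    private
      module A = Structure A
      module B = Structure B

    ρ : Fin (length a) → A.Carrier
    ρ = lookup a

    σ : Fin (length a) → B.Carrier
    σ = lookup b ∘ Fin.cast (proj₁ a≃b)

    same : ∀ ψ → (_⊨_ A ρ ψ) ⇔ (_⊨_ B σ ψ)
    same = proj₂ a≃b

    mutual
      term : ∀ {x} → Cl A a x → Σ[ t ∈ Term L (length a) ] x A.≈ ⟦_⟧ A ρ t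
      term (gen i e)    = var i , e
      term (app f ps e) =
        let ts , es = terms ps in app f ts , A.trans e (A.fun-cong f es)

      terms : ∀ {k} {v : Vec A.Carrier k} → VecAll.All (Cl A a) v →
              Σ[ ts ∈ Vec (Term L (length a)) k ] Pointwise A._≈_ v (⟦_⟧* A ρ ts)
      terms []       = [] , []
      terms (p ∷ ps) =
        let t , e = term p ; ts , es = terms ps in t ∷ ts , e ∷ es

    name : A.Carrier → Term L (length a)
    name x = proj₁ (term (gen-a x))

    name-≈ : ∀ x → x A.≈ ⟦_⟧ A ρ (name x)
    name-≈ x = proj₂ (term (gen-a x))

    to : A.Carrier → B.Carrier
    to x = ⟦_⟧ B σ (name x)

    names-≈ : ∀ {k} (v : Vec A.Carrier k) →
              Pointwise A._≈_ v (⟦_⟧* A ρ (Vec.map name v))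
    names-≈ []      = []
    names-≈ (x ∷ v) = name-≈ x ∷ names-≈ v

    names-≈′ : ∀ {k} (v : Vec A.Carrier k) →
               Pointwise A._≈_ (⟦_⟧* A ρ (Vec.map name v)) v
    names-≈′ []      = []
    names-≈′ (x ∷ v) = A.sym (name-≈ x) ∷ names-≈′ v

    map-to : ∀ {k} (v : Vec A.Carrier k) →
             ⟦_⟧* B σ (Vec.map name v) ≡ Vec.map to v
    map-to []      = ≡.refl
    map-to (x ∷ v) = ≡.cong (to x ∷_) (map-to v)

    to-Rel : ∀ r v → A.Rel r v ⇔ B.Rel r (Vec.map to v)
    to-Rel r v = ≡.subst (λ w → A.Rel r v ⇔ B.Rel r w) (map-to v)
      (mk⇔ (Equivalence.to   (same ψ) ∘ A.Rel-resp r (names-≈ v))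
           (A.Rel-resp r (names-≈′ v) ∘ Equivalence.from (same ψ)))
      where ψ = rel r (Vec.map name v)

    to-fun : ∀ f v → to (A.fun f v) B.≈ B.fun f (Vec.map to v)
    to-fun f v = ≡.subst (λ w → to (A.fun f v) B.≈ B.fun f w) (map-to v)
      (Equivalence.to (same (name (A.fun f v) ≐ app f (Vec.map name v)))
        (A.trans (A.sym (name-≈ (A.fun f v))) (A.fun-cong f (names-≈ v))))

    extend : Embedding A B
    extend = record
      { injection = record
        { to        = to
        ; cong      = λ {x} {y} e → Equivalence.to (same (name x ≐ name y))
                        (A.trans (A.sym (name-≈ x)) (A.trans e (name-≈ y)))
        ; injective = λ {x} {y} e → A.trans (name-≈ x) (A.trans
                        (Equivalence.from (same (name x ≐ name y)) e)
                        (A.sym (name-≈ y)))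
        }
      ; preserves = record { preservesRel = to-Rel ; preservesFun = to-fun }
      }

    extend-sends : ∀ i → to (lookup a i) B.≈ σ i
    extend-sends i = Equivalence.to (same (name (lookup a i) ≐ var i))
      (A.sym (name-≈ (lookup a i)))

  module _ (M : ωStructure L) where
    open ωStructure M

    ⌜_⌝ : List Carrier → ℕ
    ⌜ a ⌝ = codeList (List.map proj₁ a)

    TrueAt FalseAt Graph : Pred ℕ 0ℓ
    TrueAt k  = ∃[ r ] ∃[ v ] k ≡ ⟨ proj₁ r , ⌜ toList v ⌝ ⟩ × Rel r v
    FalseAt k = ∃[ r ] ∃[ v ] k ≡ ⟨ proj₁ r , ⌜ toList v ⌝ ⟩ × ¬ Rel r v
    Graph k   = ∃[ f ] ∃[ v ] k ≡ ⟨ proj₁ f , ⟨ ⌜ toList v ⌝ , proj₁ (fun f v) ⟩ ⟩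

    record IsIndexOf (O : Oracle) (e : ℕ) : Set where
      field
        {dom pos neg graph} : ℕ
        components          : e ≡ ⟨ dom , ⟨ pos , ⟨ neg , graph ⟩ ⟩ ⟩
        decidesDom          : Decides O dom Dom
        enumeratesTrue      : Enumerates O pos TrueAt
        enumeratesFalse     : Enumerates O neg FalseAt
        enumeratesGraph     : Enumerates O graph Graph

    ComputableStructure : Oracle → Set
    ComputableStructure O = ∃[ e ] IsIndexOf O e

module _ {L : Language} where

  record IsAge (𝒦 : Pred (Structure L) 0ℓ) : Set₁ where
    field
      finitelyGenerated : ∀ A → 𝒦 A → FinitelyGenerated A
      isoClosed         : ∀ A B → A ≅ B → 𝒦 A → 𝒦 B

  AgeOf : Structure L → Pred (Structure L) 0ℓ
  AgeOf M A = ∃[ a ] A ≅ clStructure M a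

  AmalgamationBase : Pred (Structure L) 0ℓ → Structure L → Set₁
  AmalgamationBase 𝒦 A = 𝒦 A ×
    (∀ B C → 𝒦 B → 𝒦 C → (f : Embedding A B) (g : Embedding A C) →
      Σ[ D ∈ Structure L ] 𝒦 D ×
      (Σ[ α ∈ Embedding B D ] Σ[ β ∈ Embedding C D ]
        (∀ x → Structure._≈_ D (Embedding.to α (Embedding.to f x))
                               (Embedding.to β (Embedding.to g x)))))

-- The set of triples (aᵢ, 𝒜ᵢ, i) underlying a representation of an age; the
-- structure 𝒜ᵢ enters the triple through an index.
record Presentation (L : Language) : Set₁ where
  field
    𝒜ω        : ℕ → ωStructure L
    index     : ℕ → ℕ

  𝒜 : ℕ → Structure L
  𝒜 i = ωStructure.structure (𝒜ω i)

  field
    gens      : ∀ i → Tuple (𝒜 i)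
    generates : ∀ i → Generates (𝒜 i) (gens i)

  ⟪_,_⟫ : ∀ i → Tuple (𝒜 i) → ℕ
  ⟪ i , a ⟫ = ⌜_⌝ (𝒜ω i) a

  -- Code of the triple 𝕀(i).
  𝕀 : ℕ → ℕ
  𝕀 i = ⟨ ⟪ i , gens i ⟫ , ⟨ index i , i ⟩ ⟩

  Triples : Pred ℕ 0ℓ
  Triples k = ∃[ i ] k ≡ 𝕀 i

  EI : Pred ℕ 0ℓ
  EI k = ∃[ i ] ∃[ b ] ∃[ j ] ∃[ c ]
    k ≡ ⟨ 𝕀 i , ⟨ ⟪ i , b ⟫ , ⟨ 𝕀 j , ⟪ j , c ⟫ ⟩ ⟩ ⟩ × [ 𝒜 i , 𝒜 j ] b ≃ c

  -- Potential embeddings with domain 𝕀(i) and codomain 𝕀(j).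
  record PotEmb (i j : ℕ) : Set where
    constructor potEmb
    field
      range : Tuple (𝒜 j)
  open PotEmb public

  codeEmb : ∀ {i j} → PotEmb i j → ℕ
  codeEmb {i} {j} F = ⟨ 𝕀 i , ⟨ 𝕀 j , ⟪ j , range F ⟫ ⟩ ⟩

  IsEmb : ∀ {i j} → PotEmb i j → Set
  IsEmb {i} {j} F = [ 𝒜 i , 𝒜 j ] gens i ≃ range F

  encoded : ∀ {i j} (F : PotEmb i j) → IsEmb F → Embedding (𝒜 i) (𝒜 j)
  encoded {i} {j} F F-emb =
    Extend.extend (𝒜 i) (𝒜 j) {gens i} {range F} (generates i) F-emb

  IsIso : ∀ {i j} → PotEmb i j → Set
  IsIso H = Σ[ H-emb ∈ IsEmb H ] Onto (encoded H H-emb)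

  -- compose G _ F is the potential embedding G ∘ F.
  compose : ∀ {i j k} (G : PotEmb j k) → IsEmb G → PotEmb i j → PotEmb i k
  compose G G-emb F = potEmb (List.map (Embedding.to (encoded G G-emb)) (range F))

  IsAmalgamationDiagram : ∀ {i j₀ j₁ k} → PotEmb i j₀ → PotEmb i j₁ →
                          PotEmb j₀ k → PotEmb j₁ k → Set
  IsAmalgamationDiagram {k = k} F₀ F₁ G₀ G₁ =
    Σ[ g₀ ∈ IsEmb G₀ ]
    ((f₀ : IsEmb F₀) (f₁ : IsEmb F₁) →
      Σ[ g₁ ∈ IsEmb G₁ ]
      (∀ x → Structure._≈_ (𝒜 k)
        (Embedding.to (encoded G₀ g₀) (Embedding.to (encoded F₀ f₀) x))
        (Embedding.to (encoded G₁ g₁) (Embedding.to (encoded F₁ f₁) x))))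

module _ {L : Language} (X : Pred ℕ 0ℓ) (𝕂 : Presentation L) where
  open Presentation 𝕂

  -- 𝕂 is an 𝔰-computable representation of the age 𝒦.
  record Represents (𝒦 : Pred (Structure L) 0ℓ) : Set₁ where
    field
      triples-ce : CE (χ X) Triples
      isIndex    : ∀ i → IsIndexOf (𝒜ω i) (χ X) (index i)
      member     : ∀ i → 𝒦 (𝒜 i)
      covers     : ∀ B → 𝒦 B → ∃[ i ] B ≅ 𝒜 i

  cHP : Set
  cHP = ∃[ e ] (∀ i (b : Tuple (𝒜 i)) → ∃[ j ]
    φ (χ X) e ⟨ 𝕀 i , ⟪ i , b ⟫ ⟩ (𝕀 j) × [ 𝒜 j , 𝒜 i ] gens j ≃ b)

  cJEP : Set
  cJEP = ∃[ e ] (∀ i₀ i₁ → ∃[ k ] Σ[ F₀ ∈ PotEmb i₀ k ] Σ[ F₁ ∈ PotEmb i₁ k ]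
    φ (χ X) e ⟨ 𝕀 i₀ , 𝕀 i₁ ⟩ ⟨ codeEmb F₀ , codeEmb F₁ ⟩ × IsEmb F₀ × IsEmb F₁)

  -- Collections of (codes of) distinguished extensions.
  record DistinguishedExtensions (AB : Pred ℕ 0ℓ) : Set where
    field
      embeddings : ∀ n → AB n →
        ∃[ i ] ∃[ j ] Σ[ F ∈ PotEmb i j ] n ≡ codeEmb F × IsEmb F
      precomp    : ∀ {h i j} (H : PotEmb h i) (F : PotEmb i j) → IsIso H →
        (F-emb : IsEmb F) → AB (codeEmb F) → AB (codeEmb (compose F F-emb H))
      postcomp   : ∀ {i j k} (F : PotEmb i j) (H : PotEmb j k) →
        (H-iso : IsIso H) → AB (codeEmb F) →
        AB (codeEmb (compose H (proj₁ H-iso) F))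
      total      : ∀ i → ∃[ j ] Σ[ F ∈ PotEmb i j ] AB (codeEmb F)

  -- The partial function with index e is the second component of the
  -- witness (AB, f).
  record IsComputableCAPWitness (𝒦 : Pred (Structure L) 0ℓ)
         (AB : Pred ℕ 0ℓ) (e : ℕ) : Set₁ where
    field
      distinguished : DistinguishedExtensions AB
      bases         : ∀ {i j} (F : PotEmb i j) → AB (codeEmb F) →
                      AmalgamationBase 𝒦 (𝒜 j)
      AB-ce         : CE (χ X) AB
      amalgamates   : ∀ {h i j₀ j₁} (F : PotEmb h i)
                      (G₀ : PotEmb i j₀) (G₁ : PotEmb i j₁) → AB (codeEmb F) →
        ∃[ k ] Σ[ H₀ ∈ PotEmb j₀ k ] Σ[ H₁ ∈ PotEmb j₁ k ]
          φ (χ X) e ⟨ codeEmb F , ⟨ codeEmb G₀ , codeEmb G₁ ⟩ ⟩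
                    ⟨ codeEmb H₀ , codeEmb H₁ ⟩ ×
          IsAmalgamationDiagram G₀ G₁ H₀ H₁

  cCAP : Pred (Structure L) 0ℓ → Set₁
  cCAP 𝒦 = Σ[ AB ∈ Pred ℕ 0ℓ ] ∃[ e ] IsComputableCAPWitness 𝒦 AB e

module _ {L : Language} (Mω : ωStructure L) where
  private
    M : Structure L
    M = ωStructure.structure Mω
    module M = Structure M

    code : Tuple M → ℕ
    code = ⌜_⌝ Mω

  -- Cofinal collections of (codes of) tuples.
  record CofinalCollection (E : Pred ℕ 0ℓ) : Set where
    field
      tuples    : ∀ n → E n → ∃[ a ] n ≡ code a
      cofinal   : ∀ a → ∃[ b ] E (code b) × _⊆Cl_ M a b
      extension : ∀ a b → E (code b) → _⊆Cl_ M a b → E (code (a ++ b))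
      ≃-closed  : ∀ a b → E (code a) → [ M , M ] a ≃ b → E (code b)

  -- y is an index of a permutation of M sending a to b, which is an
  -- automorphism of M if a ≃ b.
  record IsIndexOfMatching (O : Oracle) (y : ℕ) (a b : Tuple M) : Set where
    field
      π            : Bijection M.setoid M.setoid
    open Bijection π using (to)
    field
      computes     : ∀ x → φ O y (proj₁ x) (proj₁ (to x))
      sends        : List.map (proj₁ ∘ to) a ≡ List.map proj₁ b
      automorphism : [ M , M ] a ≃ b → PreservesStructure M M to

  -- An 𝔰-computable collection E of tuples is one with an 𝔰-computable
  -- enumeration, in the sense in which a computable age is a c.e. set of
  -- triples. Deciding E cannot be asked for: for b in E the relation
  -- a ⊆ cl(b) is in general only c.e., and there are computable ages with
  -- (cHP), (cJEP), (cCAP) and computable embedding information no cofinal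
  -- limit of which has a decidable E of this kind.
  record ComputablyCofinallyUltrahomogeneous (X : Pred ℕ 0ℓ) : Set₁ where
    field
      E          : Pred ℕ 0ℓ
      isCofinal  : CofinalCollection E
      E-ce       : CE (χ X) E
      g          : ℕ
      g-domain   : ∀ n → (∃[ y ] φ (χ X) g n y) ⇔
                   (∃[ a ] ∃[ b ] n ≡ ⟨ code a , code b ⟩ × E (code a) × [ M , M ] a ∼ b)
      g-matching : ∀ a b y → E (code a) → [ M , M ] a ∼ b →
                   φ (χ X) g ⟨ code a , code b ⟩ y → IsIndexOfMatching (χ X) y a b

  record IsComputableCofinalFraïsséLimit (X : Pred ℕ 0ℓ) (𝕂 : Presentation L) : Set₁ where
    field
      computable      : ComputableStructure Mω (χ X)
      ultrahomogeneous : ComputablyCofinallyUltrahomogeneous X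
      represents      : Represents X 𝕂 (AgeOf M)

{-# OPTIONS --safe #-}
module Submission where

-- M is the direct limit of a chain 𝒜 (𝕜 0) → 𝒜 (𝕜 1) → ... in which stage s
-- amalgamates according to a task coded by s, jointly embeds 𝒜 s, and then
-- passes to the codomain of a distinguished extension. An embedding h is
-- evaluated by searching for the y with x ∷ a ≃ y ∷ h(a), where a generates,
-- so the embedding information replaces the evaluation of terms.
--
-- E consists of the tuples a of M such that a ≃ b for the generators b of the
-- codomain of a distinguished extension. By (cHP) and closure of the
-- distinguished extensions under isomorphisms this is a cofinal collection, and
-- it is c.e. since no closure has to be computed. For a in E and a ≃ b, the
-- amalgamation tasks allow every tuple containing a to be matched with one
-- containing b, so a search for matching tuples, alternating between the two
-- sides, converges to an automorphism. If a ∼ b but not a ≃ b, a product of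
-- transpositions is used instead.

-- Each task is carried out once, at the stage whose number is its code. This is possible because
-- `⟨_,_⟩` and `codeList` dominate their entries: every name in the tuple of task `s` is at most
-- `s`, and a name `⟨ t , y ⟩` exists from stage `t` on, so the tuple has an image at stage `s`. The
-- same bound makes the domain of M decidable: elements of M are least names, and stage `n` already
-- shows which names up to `n` agree with `n`.
--
-- Passing to a distinguished extension at the end of each step puts the generators of the new stage
-- into E. The back and forth adds such generators at every move, which keeps its source in E;
-- otherwise the next amalgamation would have no distinguished extension to start from.
--
-- Functions are written in Agda on typed data and proved computable separately, by the judgement
-- `ε ⊢ f`. Its environments may contain proofs, so a partial program such as the amalgamation
-- function is only ever run on inputs known to be admissible.

open import Defs
open import Level using (0ℓ)
open import Data.Fin.Base as Fin using (Fin)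
open import Data.List.Base as List using (List; []; _∷_; _++_; length; lookup)
import Data.List.Properties as Listₚ
open import Data.List.Membership.Propositional using (_∈_)
import Data.List.Membership.Propositional.Properties as ∈ₚ
open import Data.List.Relation.Binary.Pointwise as PWL using ([]; _∷_) renaming (Pointwise to PointwiseL)
open import Data.List.Relation.Unary.All as All using ()
open import Data.List.Relation.Unary.Any as Any using (here; there)
open import Data.Maybe.Base as Maybe using (Maybe; just; nothing)
open import Data.Nat.Base hiding (equal)
open import Data.Nat.Induction using (<-rec)
open import Data.Nat.Properties
open import Data.Product.Base using (Σ; ∃; ∃-syntax; Σ-syntax; _×_; _,_; proj₁; proj₂; uncurry)
open import Data.Sum.Base using (_⊎_; inj₁; inj₂)
open import Data.Vec.Base as Vec using (Vec; []; _∷_; toList)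
import Data.Vec.Properties as Vecₚ
open import Data.Vec.Relation.Binary.Pointwise.Inductive as PW using (Pointwise; []; _∷_)
open import Data.Vec.Relation.Unary.All as VecAll using ([]; _∷_)
open import Function.Base using (_∘_; id; const)
open import Function.Bundles using (_⇔_; mk⇔; Equivalence)
open import Relation.Binary.Definitions using (tri<; tri≈; tri>)
open import Relation.Binary.PropositionalEquality using (_≡_; _≢_; refl; sym; trans; cong; cong₂; subst)
open import Relation.Nullary.Decidable.Core using (Dec; yes; no; map′)
open import Relation.Nullary.Negation using (¬_; contradiction)
open import Relation.Unary using (Pred)

-- Codes and their evaluation

triangle-mono : ∀ {m n} → m ≤ n → triangle m ≤ triangle n
triangle-mono z≤n       = z≤n
triangle-mono (s≤s m≤n) = +-mono-≤ (s≤s m≤n) (triangle-mono m≤n)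

n≤triangle : ∀ n → n ≤ triangle n
n≤triangle zero    = z≤n
n≤triangle (suc n) = m≤m+n (suc n) (triangle n)

x≤⟨x,y⟩ : ∀ x y → x ≤ ⟨ x , y ⟩
x≤⟨x,y⟩ x y = m≤m+n x _

y≤⟨x,y⟩ : ∀ x y → y ≤ ⟨ x , y ⟩
y≤⟨x,y⟩ x y = ≤-trans (m≤n+m y x) (≤-trans (n≤triangle (x + y)) (m≤n+m _ x))

⟨⟩<triangle : ∀ x y → ⟨ x , y ⟩ < triangle (suc (x + y))
⟨⟩<triangle x y = s≤s (+-monoˡ-≤ (triangle (x + y)) (m≤m+n x y))

-- The codes on one antidiagonal all lie below `triangle` of the number of the next one, which is
-- where the codes of that one begin.
⟨⟩-diagonal : ∀ {x y x′ y′} → x + y < x′ + y′ → ⟨ x , y ⟩ < ⟨ x′ , y′ ⟩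
⟨⟩-diagonal {x} {y} {x′} {y′} lt = ≤-trans (⟨⟩<triangle x y)
  (≤-trans (triangle-mono lt) (m≤n+m (triangle (x′ + y′)) x′))

⟨⟩-injective : ∀ {x y x′ y′} → ⟨ x , y ⟩ ≡ ⟨ x′ , y′ ⟩ → x ≡ x′ × y ≡ y′
⟨⟩-injective {x} {y} {x′} {y′} eq with <-cmp (x + y) (x′ + y′)
... | tri< lt _ _ = contradiction eq (<⇒≢ (⟨⟩-diagonal {x} {y} {x′} {y′} lt))
... | tri> _ _ gt = contradiction (sym eq) (<⇒≢ (⟨⟩-diagonal {x′} {y′} {x} {y} gt))
... | tri≈ _ s _  = x≡x′ , +-cancelˡ-≡ x _ _ (trans s (cong (_+ y′) (sym x≡x′)))
  where
  x≡x′ : x ≡ x′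
  x≡x′ = +-cancelʳ-≡ (triangle (x + y)) _ _ (trans eq (cong (λ s → x′ + triangle s) (sym s)))

⟨⟩-injectiveˡ : ∀ {x y x′ y′} → ⟨ x , y ⟩ ≡ ⟨ x′ , y′ ⟩ → x ≡ x′
⟨⟩-injectiveˡ {x} {y} eq = proj₁ (⟨⟩-injective {x} {y} eq)

⟨⟩-injectiveʳ : ∀ {x y x′ y′} → ⟨ x , y ⟩ ≡ ⟨ x′ , y′ ⟩ → y ≡ y′
⟨⟩-injectiveʳ {x} {y} {x′} eq = proj₂ (⟨⟩-injective {x} {y} {x′} eq)

opaque
  -- Cantor's pairing is onto: the antidiagonals are walked one step at a time, and after `(x , 0)`
  -- the walk jumps to the start of the next one.
  unpair : ∀ n → ∃[ x ] ∃[ y ] ⟨ x , y ⟩ ≡ n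
  unpair zero = 0 , 0 , refl
  unpair (suc n) with unpair n
  ... | x , suc y , eq = suc x , y ,
        trans (cong (λ s → suc (x + triangle s)) (sym (+-suc x y))) (cong suc eq)
  ... | x , zero , eq = 0 , suc x ,
        cong suc (trans (cong (λ s → x + triangle s) (sym (+-identityʳ x))) eq)

π₁ π₂ : ℕ → ℕ
π₁ n = proj₁ (unpair n)
π₂ n = proj₁ (proj₂ (unpair n))

⟨π₁,π₂⟩ : ∀ n → ⟨ π₁ n , π₂ n ⟩ ≡ n
⟨π₁,π₂⟩ n = proj₂ (proj₂ (unpair n))

π₁-⟨⟩ : ∀ x y → π₁ ⟨ x , y ⟩ ≡ x
π₁-⟨⟩ x y = ⟨⟩-injectiveˡ {y = π₂ ⟨ x , y ⟩} {x} {y} (⟨π₁,π₂⟩ ⟨ x , y ⟩)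

π₂-⟨⟩ : ∀ x y → π₂ ⟨ x , y ⟩ ≡ y
π₂-⟨⟩ x y = ⟨⟩-injectiveʳ {π₁ ⟨ x , y ⟩} {x′ = x} (⟨π₁,π₂⟩ ⟨ x , y ⟩)

codeList-injective : ∀ {a b} → codeList a ≡ codeList b → a ≡ b
codeList-injective {[]}    {[]}    _  = refl
codeList-injective {x ∷ a} {y ∷ b} eq with ⟨⟩-injective {x} {codeList a} {y} {codeList b} (suc-injective eq)
... | refl , eq′ = cong (x ∷_) (codeList-injective eq′)

opaque
  decodeList : ∀ n → ∃[ a ] codeList a ≡ n
  decodeList = <-rec _ go
    where
    go : ∀ n → (∀ {m} → m < n → ∃[ a ] codeList a ≡ m) → ∃[ a ] codeList a ≡ n
    go zero    _   = [] , refl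
    go (suc n) rec with rec {π₂ n} (s≤s (subst (π₂ n ≤_) (⟨π₁,π₂⟩ n) (y≤⟨x,y⟩ (π₁ n) (π₂ n))))
    ... | a , eq = π₁ n ∷ a , cong suc (trans (cong ⟨ π₁ n ,_⟩ eq) (⟨π₁,π₂⟩ n))

∈⇒≤codeList : ∀ {x a} → x ∈ a → x ≤ codeList a
∈⇒≤codeList {a = y ∷ a} (here refl) = m≤n⇒m≤1+n (x≤⟨x,y⟩ y (codeList a))
∈⇒≤codeList {a = y ∷ a} (there x∈a) =
  m≤n⇒m≤1+n (≤-trans (∈⇒≤codeList x∈a) (y≤⟨x,y⟩ y (codeList a)))

-- Every code is a pair of a tag and arguments. In this form two different constructors are told
-- apart by a small numeral, and only equal constructors remain to be compared in
-- `encode-injective`.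
tag : Code → ℕ
tag zero       = 0
tag succ       = 1
tag fst        = 2
tag snd        = 3
tag oracle     = 4
tag univ       = 5
tag (pair _ _) = 6
tag (comp _ _) = 7
tag (prec _ _) = 8
tag (rfind _)  = 9

args : Code → ℕ
args (pair f g) = ⟨ encode f , encode g ⟩
args (comp f g) = ⟨ encode f , encode g ⟩
args (prec f g) = ⟨ encode f , encode g ⟩
args (rfind f)  = encode f
args _          = 0

encode-tag : ∀ c → encode c ≡ ⟨ tag c , args c ⟩
encode-tag zero       = refl
encode-tag succ       = refl
encode-tag fst        = refl
encode-tag snd        = refl
encode-tag oracle     = refl
encode-tag univ       = refl
encode-tag (pair _ _) = refl
encode-tag (comp _ _) = refl
encode-tag (prec _ _) = refl
encode-tag (rfind _)  = refl

mutual
  encode-injective : ∀ c d → encode c ≡ encode d → c ≡ d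
  encode-injective c d eq =
    let t , u = ⟨⟩-injective {tag c} {args c} {tag d} {args d}
                  (trans (sym (encode-tag c)) (trans eq (encode-tag d)))
    in tag-args-injective c d t u

  tag-args-injective : ∀ c d → tag c ≡ tag d → args c ≡ args d → c ≡ d
  tag-args-injective zero zero refl _ = refl
  tag-args-injective succ succ refl _ = refl
  tag-args-injective fst fst refl _ = refl
  tag-args-injective snd snd refl _ = refl
  tag-args-injective oracle oracle refl _ = refl
  tag-args-injective univ univ refl _ = refl
  tag-args-injective (pair f g) (pair f′ g′) refl eq =
    cong₂ pair (encode-injective f f′ (⟨⟩-injectiveˡ {encode f} {encode g} {encode f′} {encode g′} eq))
               (encode-injective g g′ (⟨⟩-injectiveʳ {encode f} {encode g} {encode f′} {encode g′} eq))
  tag-args-injective (comp f g) (comp f′ g′) refl eq =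
    cong₂ comp (encode-injective f f′ (⟨⟩-injectiveˡ {encode f} {encode g} {encode f′} {encode g′} eq))
               (encode-injective g g′ (⟨⟩-injectiveʳ {encode f} {encode g} {encode f′} {encode g′} eq))
  tag-args-injective (prec f g) (prec f′ g′) refl eq =
    cong₂ prec (encode-injective f f′ (⟨⟩-injectiveˡ {encode f} {encode g} {encode f′} {encode g′} eq))
               (encode-injective g g′ (⟨⟩-injectiveʳ {encode f} {encode g} {encode f′} {encode g′} eq))
  tag-args-injective (rfind f) (rfind f′) refl eq = cong rfind (encode-injective f f′ eq)

Functional : Oracle → Set
Functional O = ∀ {x y z} → O x y → O x z → y ≡ z

χ-functional : ∀ X → Functional (χ X)
χ-functional X (inj₁ (_ , refl)) (inj₁ (_ , refl)) = refl
χ-functional X (inj₁ (x , _))    (inj₂ (¬x , _))   = contradiction x ¬x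
χ-functional X (inj₂ (¬x , _))   (inj₁ (x , _))    = contradiction x ¬x
χ-functional X (inj₂ (_ , refl)) (inj₂ (_ , refl)) = refl

-- Matching both derivations at once needs their inputs to be distinct
-- variables, since ⟨_,_⟩ is not a constructor.
Eval-functional : ∀ {O} → Functional O → ∀ {c x x′ y y′} →
                  Eval O c x y → Eval O c x′ y′ → x ≡ x′ → y ≡ y′
Eval-functional O! zero zero _ = refl
Eval-functional O! succ succ eq = cong suc eq
Eval-functional O! (fst {x} {y}) (fst {x′} {y′}) eq = ⟨⟩-injectiveˡ {x} {y} {x′} {y′} eq
Eval-functional O! (snd {x} {y}) (snd {x′} {y′}) eq = ⟨⟩-injectiveʳ {x} {y} {x′} {y′} eq
Eval-functional O! (oracle {y = y} o) (oracle {y = y′} o′) refl = O! {y = y} {y′} o o′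
Eval-functional O! (univ {c} {x} p) (univ {c′} {x′} p′) eq
  with ⟨⟩-injective {encode c} {x} {encode c′} {x′} eq
... | ceq , refl with encode-injective c c′ ceq
...   | refl = Eval-functional O! p p′ refl
Eval-functional O! (pair p q) (pair p′ q′) eq =
  cong₂ ⟨_,_⟩ (Eval-functional O! p p′ eq) (Eval-functional O! q q′ eq)
Eval-functional O! (comp p q) (comp p′ q′) eq =
  Eval-functional O! q q′ (Eval-functional O! p p′ eq)
Eval-functional O! (prec-0 {x = x} p) (prec-0 {x = x′} p′) eq =
  Eval-functional O! p p′ (⟨⟩-injectiveˡ {x} {0} {x′} {0} eq)
Eval-functional O! (prec-0 {x = x} p) (prec-s {x = x′} {n′} p′ q′) eq
  with () ← ⟨⟩-injectiveʳ {x} {0} {x′} {suc n′} eq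
Eval-functional O! (prec-s {x = x} {n} p q) (prec-0 {x = x′} p′) eq
  with () ← ⟨⟩-injectiveʳ {x} {suc n} {x′} {0} eq
Eval-functional O! (prec-s {x = x} {n} p q) (prec-s {x = x′} {n′} p′ q′) eq
  with ⟨⟩-injective {x} {suc n} {x′} {suc n′} eq
... | refl , refl = Eval-functional O! q q′ (cong (λ y → ⟨ x , ⟨ n , y ⟩ ⟩) (Eval-functional O! p p′ refl))
Eval-functional O! (rfind {n = m} p ps) (rfind {n = n} q qs) refl with <-cmp m n
... | tri≈ _ eq _ = eq
... | tri< lt _ _ with () ← Eval-functional O! p (proj₂ (qs m lt)) refl
... | tri> _ _ gt with () ← Eval-functional O! (proj₂ (ps n gt)) q refl

φ-functional : ∀ {O} → Functional O → ∀ {e x y z} → φ O e x y → φ O e x z → y ≡ z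
φ-functional O! (c , refl , p) (d , eq , q) with encode-injective d c eq
... | refl = Eval-functional O! p q refl

opaque
  -- An opaque copy of ⟨_,_⟩, for which unification can invert pairing.
  infixr 5 _∙_
  _∙_ : ℕ → ℕ → ℕ
  x ∙ y = ⟨ x , y ⟩

  ∙≡⟨⟩ : ∀ x y → x ∙ y ≡ ⟨ x , y ⟩
  ∙≡⟨⟩ x y = refl

-- A positive answer is coded by 0, because `rfind` searches for a zero.
bit : {A : Set} → Dec A → ℕ
bit (yes _) = 0
bit (no _)  = 1

bit-cong : {A B : Set} {a? : Dec A} {b? : Dec B} → (A → B) → (B → A) → bit a? ≡ bit b?
bit-cong {a? = yes a} {yes b} f g = refl
bit-cong {a? = yes a} {no ¬b} f g = contradiction (f a) ¬b
bit-cong {a? = no ¬a} {yes b} f g = contradiction (g b) ¬a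
bit-cong {a? = no ¬a} {no ¬b} f g = refl

bit-yes : {A : Set} {a? : Dec A} → A → bit a? ≡ 0
bit-yes {a? = yes _} _ = refl
bit-yes {a? = no ¬a} a = contradiction a ¬a

bit-no : {A : Set} {a? : Dec A} → ¬ A → bit a? ≡ 1
bit-no {a? = yes a} ¬a = contradiction a ¬a
bit-no {a? = no _}  _  = refl

bit≡0 : {A : Set} {a? : Dec A} → bit a? ≡ 0 → A
bit≡0 {a? = yes a} _ = a

bit≢0 : {A : Set} {a? : Dec A} {n : ℕ} → bit a? ≡ suc n → ¬ A
bit≢0 {a? = no ¬a} _ = ¬a

module _ {P : ℕ → Set} (P? : ∀ n → Dec (P n)) where

  record Least (n : ℕ) : Set where
    constructor isLeast
    field
      holds   : P n
      minimal : ∀ m → m < n → ¬ P m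

  least-below : ∀ n → (∃[ m ] Least m) ⊎ (∀ m → m < n → ¬ P m)
  least-below zero = inj₂ λ _ ()
  least-below (suc n) with least-below n
  ... | inj₁ l = inj₁ l
  ... | inj₂ none with P? n
  ...   | yes p = inj₁ (n , isLeast p none)
  ...   | no ¬p = inj₂ λ m m<1+n → case-≤ m (≤-pred m<1+n)
    where
    case-≤ : ∀ m → m ≤ n → ¬ P m
    case-≤ m m≤n p with m≤n⇒m<n∨m≡n m≤n
    ... | inj₁ m<n  = none m m<n p
    ... | inj₂ refl = ¬p p

  least : ∃ P → ∃[ n ] Least n
  least (n , p) with least-below (suc n)
  ... | inj₁ l    = l
  ... | inj₂ none = contradiction p (none n ≤-refl)

  μ : ∃ P → ℕ
  μ e = proj₁ (least e)

  μ-holds : ∀ e → P (μ e)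
  μ-holds e = Least.holds (proj₂ (least e))

constCode : ℕ → Code
constCode zero    = zero
constCode (suc n) = comp succ (constCode n)

-- Codes are opaque from here on: an evaluated index is an astronomically
-- large unary number.
opaque
  quoteCode : Code → Code
  quoteCode c = constCode (encode c)

opaque
  -- There is no scheme for the identity, but every number is a pair, so pairing its two projections
  -- returns it.
  idCode : Code
  idCode = pair fst snd

opaque
  -- A primitive recursion whose step discards the previous value and returns the number of the
  -- stage.
  predCode : Code
  predCode = comp (prec zero (comp fst snd)) (pair zero idCode)

opaque
  curryCode : Code → ℕ → Code
  curryCode c x = comp c (pair (constCode x) idCode)

opaque
  -- Computes `encode (constCode n)` from `n`, by recursion on `n`; 7 is the tag of `comp` in
  -- `encode`.
  constIndexCode : Code
  constIndexCode = comp
    (prec (quoteCode zero) (pair (constCode 7) (pair (quoteCode succ) (comp snd snd))))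
    (pair zero idCode)

opaque
  -- The s-m-n function: it computes the index of `curryCode c x` from `x`. The constants 7 and 6
  -- are the tags of `comp` and `pair`.
  curryIndexCode : Code → Code
  curryIndexCode c = pair (constCode 7) (pair (quoteCode c)
    (pair (constCode 6) (pair constIndexCode (quoteCode idCode))))

opaque
  selfApply : Code
  selfApply = comp univ (pair fst idCode)

opaque
  -- Let `d` be the index of `diagonal body`. On input `x` the program `curryCode selfApply d` runs
  -- `d` on `⟨ d , x ⟩`, and therefore runs `body` on its own index paired with `x`.
  diagonal : Code → Code
  diagonal body = comp body (pair (comp (curryIndexCode selfApply) fst) snd)

-- Kleene's second recursion theorem.
opaque
  fixCode : Code → Code
  fixCode body = curryCode selfApply (encode (diagonal body))

-- Runs c only after a search for a zero of t has succeeded.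
opaque
  guardCode : Code → Code → Code
  guardCode t c = comp c (comp fst (pair idCode (rfind t)))

encode-pair : ∀ f g → 6 ∙ encode f ∙ encode g ≡ encode (pair f g)
encode-pair f g = trans (∙≡⟨⟩ 6 _) (cong ⟨ 6 ,_⟩ (∙≡⟨⟩ (encode f) (encode g)))

encode-comp : ∀ f g → 7 ∙ encode f ∙ encode g ≡ encode (comp f g)
encode-comp f g = trans (∙≡⟨⟩ 7 _) (cong ⟨ 7 ,_⟩ (∙≡⟨⟩ (encode f) (encode g)))

module _ {O : Oracle} where

  opaque
    unfolding _∙_

    Eval-fst : ∀ {x y} → Eval O fst (x ∙ y) x
    Eval-fst {x} {y} = fst {x = x} {y}

    Eval-snd : ∀ {x y} → Eval O snd (x ∙ y) y
    Eval-snd {x} {y} = snd {x = x} {y}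

    Eval-pair : ∀ {f g x y z} → Eval O f x y → Eval O g x z → Eval O (pair f g) x (y ∙ z)
    Eval-pair = pair

    Eval-univ : ∀ {c x y} → Eval O c x y → Eval O univ (encode c ∙ x) y
    Eval-univ = univ

    Eval-prec-0 : ∀ {f g x y} → Eval O f x y → Eval O (prec f g) (x ∙ 0) y
    Eval-prec-0 {f} {g} {x} {y} p = prec-0 {x = x} p

    Eval-prec-s : ∀ {f g x n y z} → Eval O (prec f g) (x ∙ n) y →
                  Eval O g (x ∙ n ∙ y) z → Eval O (prec f g) (x ∙ suc n) z
    Eval-prec-s {x = x} {n} p q = prec-s {x = x} {n} p q

    Eval-rfind : ∀ {f x n} → Eval O f (x ∙ n) 0 →
                 (∀ m → m < n → ∃[ k ] Eval O f (x ∙ m) (suc k)) → Eval O (rfind f) x n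
    Eval-rfind p ps = rfind p ps

  Eval-const : ∀ n {x} → Eval O (constCode n) x n
  Eval-const zero    = zero
  Eval-const (suc n) = comp (Eval-const n) succ

  opaque
    unfolding quoteCode
    Eval-quote : ∀ c {x} → Eval O (quoteCode c) x (encode c)
    Eval-quote c = Eval-const (encode c)

  opaque
    unfolding idCode
    Eval-id : ∀ {x} → Eval O idCode x x
    Eval-id {x} = subst (λ y → Eval O idCode y y) (trans (∙≡⟨⟩ (π₁ x) (π₂ x)) (⟨π₁,π₂⟩ x))
                        (Eval-pair Eval-fst Eval-snd)

  opaque
    unfolding predCode
    Eval-pred : ∀ {n} → Eval O predCode (suc n) n
    Eval-pred {n} =
      comp (Eval-pair zero Eval-id) (Eval-prec-s (proj₂ (any n)) (comp Eval-snd Eval-fst))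
      where
      any : ∀ m → ∃[ y ] Eval O (prec zero (comp fst snd)) (0 ∙ m) y
      any zero    = 0 , Eval-prec-0 zero
      any (suc m) = m , Eval-prec-s (proj₂ (any m)) (comp Eval-snd Eval-fst)

  opaque
    unfolding constIndexCode
    Eval-constIndex : ∀ n → Eval O constIndexCode n (encode (constCode n))
    Eval-constIndex n = comp (Eval-pair zero Eval-id) (go n)
      where
      go : ∀ n → Eval O (prec (quoteCode zero)
                              (pair (constCode 7) (pair (quoteCode succ) (comp snd snd))))
                      (0 ∙ n) (encode (constCode n))
      go zero    = Eval-prec-0 (Eval-quote zero)
      go (suc n) = subst (Eval O _ _) (encode-comp succ (constCode n))
        (Eval-prec-s (go n) (Eval-pair (Eval-const 7)
                               (Eval-pair (Eval-quote succ) (comp Eval-snd Eval-snd))))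

  opaque
    unfolding curryCode
    Eval-curry : ∀ {c x y z} → Eval O c (x ∙ y) z → Eval O (curryCode c x) y z
    Eval-curry {x = x} p = comp (Eval-pair (Eval-const x) Eval-id) p

  opaque
    unfolding curryIndexCode curryCode
    Eval-curryIndex : ∀ c x → Eval O (curryIndexCode c) x (encode (curryCode c x))
    Eval-curryIndex c x = subst (Eval O _ x)
      (trans (cong (λ n → 7 ∙ encode c ∙ n) (encode-pair (constCode x) idCode))
             (encode-comp c (pair (constCode x) idCode)))
      (Eval-pair (Eval-const 7) (Eval-pair (Eval-quote c)
        (Eval-pair (Eval-const 6) (Eval-pair (Eval-constIndex x) (Eval-quote idCode)))))

  opaque
    unfolding selfApply
    Eval-selfApply : ∀ {c x y} → Eval O c (encode c ∙ x) y → Eval O selfApply (encode c ∙ x) y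
    Eval-selfApply p = comp (Eval-pair Eval-fst Eval-id) (Eval-univ p)

  opaque
    unfolding diagonal
    Eval-diagonal : ∀ {body e x y} → Eval O body (encode (curryCode selfApply e) ∙ x) y →
                    Eval O (diagonal body) (e ∙ x) y
    Eval-diagonal {e = e} p =
      comp (Eval-pair (comp Eval-fst (Eval-curryIndex selfApply e)) Eval-snd) p

  opaque
    unfolding fixCode
    Eval-fix : ∀ {body x y} → Eval O body (encode (fixCode body) ∙ x) y → Eval O (fixCode body) x y
    Eval-fix {body} p = Eval-curry (Eval-selfApply {diagonal body} (Eval-diagonal p))

  opaque
    unfolding guardCode _∙_
    Eval-guard : ∀ {t c x n y} → Eval O t (x ∙ n) 0 →
                 (∀ m → m < n → ∃[ k ] Eval O t (x ∙ m) (suc k)) →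
                 Eval O c x y → Eval O (guardCode t c) x y
    Eval-guard p ps q = comp (comp (Eval-pair Eval-id (Eval-rfind p ps)) Eval-fst) q

    -- The result of the search sits in a component of a pair that is thrown away, but a pair halts
    -- only if both components do. This inversion is what keeps the domain of the final function `g`
    -- from being too large.
    guard-halts : ∀ {t c x y} → Eval O (guardCode t c) x y → ∃[ n ] Eval O t (x ∙ n) 0
    guard-halts (comp (comp (pair _ (rfind p _)) _) _) = _ , p

codeMaybe : {A : Set} → (A → ℕ) → Maybe A → ℕ
codeMaybe α nothing  = 0
codeMaybe α (just a) = suc (α a)

-- Uniform relative computability

nothing≢just : {A : Set} {a : A} → nothing ≢ just a
nothing≢just ()

just-injective : {A : Set} {a b : A} → just a ≡ just b → a ≡ b
just-injective refl = refl

consMaybe : {A : Set} → Maybe A → Maybe (List A) → Maybe (List A)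
consMaybe (just a) (just l) = just (a ∷ l)
consMaybe (just a) nothing  = nothing
consMaybe nothing  _        = nothing

traverse : {A B : Set} → (A → Maybe B) → List A → Maybe (List B)
traverse f []      = just []
traverse f (a ∷ l) = consMaybe (f a) (traverse f l)

certify : {P : ℕ → Set} {n : ℕ} → Dec (P n) → Maybe (∃ P)
certify (yes p) = just (_ , p)
certify (no _)  = nothing

certify-just : ∀ {P : ℕ → Set} {n c} (d : Dec (P n)) → certify {P} d ≡ just c → proj₁ c ≡ n
certify-just (yes _) refl = refl

certify-complete : ∀ {P : ℕ → Set} {n} (d : Dec (P n)) → P n →
                   ∃[ c ] certify {P} d ≡ just c × proj₁ c ≡ n
certify-complete (yes p) _ = _ , refl , refl
certify-complete (no ¬p) p = contradiction p ¬p

select : {A B : Set} → Dec A → B → B → B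
select (yes _) x y = x
select (no _)  x y = y

select-yes : ∀ {A B : Set} (d : Dec A) {x y : B} → A → select d x y ≡ x
select-yes (yes _) _ = refl
select-yes (no ¬a) a = contradiction a ¬a

select-no : ∀ {A B : Set} (d : Dec A) {x y : B} → ¬ A → select d x y ≡ y
select-no (yes a) ¬a = contradiction a ¬a
select-no (no _)  _  = refl

bit-map′ : ∀ {A B : Set} {f : A → B} {g : B → A} (d : Dec A) → bit d ≡ bit (map′ f g d)
bit-map′ (yes _) = refl
bit-map′ (no _)  = refl

module Computability (O : Oracle) where

  -- f γ is computed from ε γ, uniformly in γ. Since Γ may carry proofs, this
  -- also covers partial functions on their domains.
  infix 3 _⊢_
  record _⊢_ {Γ : Set} (ε f : Γ → ℕ) : Set where
    constructor computes
    field
      code : Code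
      eval : ∀ γ → Eval O code (ε γ) (f γ)
  open _⊢_

  private variable
    Γ Δ : Set
    ε δ f g h : Γ → ℕ

  infixl 4 _▹_
  -- Context extension: `A γ` is the type of a new variable and `α` its coding.
  _▹_ : {A : Γ → Set} → (Γ → ℕ) → (Σ Γ A → ℕ) → Σ Γ A → ℕ
  (ε ▹ α) x = ε (proj₁ x) ∙ α x

  index : ε ⊢ f → ℕ
  index p = encode (code p)

  index-φ : (p : ε ⊢ f) → ∀ γ → φ O (index p) (ε γ) (f γ)
  index-φ p γ = code p , refl , eval p γ

  abstract
    id⊢ : ε ⊢ ε
    id⊢ = computes idCode λ γ → Eval-id

    infixl 4 _⨾_
    _⨾_ : ε ⊢ f → f ⊢ g → ε ⊢ g
    p ⨾ q = computes (comp (code q) (code p)) λ γ → comp (eval p γ) (eval q γ)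

    reindex : (σ : Δ → Γ) → ε ⊢ f → ε ∘ σ ⊢ f ∘ σ
    reindex σ p = computes (code p) λ γ → eval p (σ γ)

    conv : (∀ γ → f γ ≡ g γ) → ε ⊢ f → ε ⊢ g
    conv eq p = computes (code p) λ γ → subst (Eval O (code p) _) (eq γ) (eval p γ)

    const⊢ : ∀ n → ε ⊢ const n
    const⊢ n = computes (constCode n) λ γ → Eval-const n

    suc⊢ : ε ⊢ f → ε ⊢ (λ γ → suc (f γ))
    suc⊢ p = computes (comp succ (code p)) λ γ → comp (eval p γ) succ

    pred⊢ : ε ⊢ (λ γ → suc (f γ)) → ε ⊢ f
    pred⊢ p = computes (comp predCode (code p)) λ γ → comp (eval p γ) Eval-pred

    infixr 5 _,⊢_
    _,⊢_ : ε ⊢ f → ε ⊢ g → ε ⊢ (λ γ → f γ ∙ g γ)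
    p ,⊢ q = computes (pair (code p) (code q)) λ γ → Eval-pair (eval p γ) (eval q γ)

    fst⊢ : ε ⊢ (λ γ → f γ ∙ g γ) → ε ⊢ f
    fst⊢ p = computes (comp fst (code p)) λ γ → comp (eval p γ) Eval-fst

    snd⊢ : ε ⊢ (λ γ → f γ ∙ g γ) → ε ⊢ g
    snd⊢ p = computes (comp snd (code p)) λ γ → comp (eval p γ) Eval-snd

    -- The index may itself be computed from the environment; it is then run by `univ`. Recursive
    -- calls and the programs supplied by the hypotheses all go through this rule.
    φ⊢ : ε ⊢ f → ε ⊢ g → (∀ γ → φ O (f γ) (g γ) (h γ)) → ε ⊢ h
    φ⊢ {ε = ε} {f = f} {g} {h} p q φs = computes (comp univ (pair (code p) (code q))) run
      where
      run : ∀ γ → Eval O (comp univ (pair (code p) (code q))) (ε γ) (h γ)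
      run γ with f γ | eval p γ | φs γ
      ... | _ | pγ | c , refl , r = comp (Eval-pair pγ (eval q γ)) (Eval-univ {c = c} r)

    rec⊢ : {f : Γ × ℕ → ℕ} → ε ⊢ (λ γ → f (γ , 0)) →
           (λ ((γ , n) : Γ × ℕ) → ε γ ∙ n ∙ f (γ , n)) ⊢ (λ (γ , n) → f (γ , suc n)) →
           ε ▹ proj₂ ⊢ f
    rec⊢ {ε = ε} {f} p q = computes (prec (code p) (code q)) (uncurry run)
      where
      run : ∀ γ n → Eval O (prec (code p) (code q)) (ε γ ∙ n) (f (γ , n))
      run γ zero    = Eval-prec-0 (eval p γ)
      run γ (suc n) = Eval-prec-s (run γ n) (eval q (γ , n))

  weaken : {A : Γ → Set} {α : Σ Γ A → ℕ} → ε ⊢ f → ε ▹ α ⊢ f ∘ proj₁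
  weaken p = fst⊢ id⊢ ⨾ reindex proj₁ p

  ⟨⟩⊢ : ε ⊢ f → ε ⊢ g → ε ⊢ (λ γ → ⟨ f γ , g γ ⟩)
  ⟨⟩⊢ p q = conv (λ γ → ∙≡⟨⟩ _ _) (p ,⊢ q)

  unpair⊢ : ε ⊢ (λ γ → ⟨ f γ , g γ ⟩) → ε ⊢ (λ γ → f γ ∙ g γ)
  unpair⊢ p = conv (λ γ → sym (∙≡⟨⟩ _ _)) p

  π₁⊢ : ε ⊢ f → ε ⊢ (λ γ → π₁ (f γ))
  π₁⊢ {f = f} p = fst⊢ (unpair⊢ {f = π₁ ∘ f} {π₂ ∘ f} (conv (λ γ → sym (⟨π₁,π₂⟩ (f γ))) p))

  π₂⊢ : ε ⊢ f → ε ⊢ (λ γ → π₂ (f γ))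
  π₂⊢ {f = f} p = snd⊢ (unpair⊢ {f = π₁ ∘ f} {π₂ ∘ f} (conv (λ γ → sym (⟨π₁,π₂⟩ (f γ))) p))

  via : (σ : Γ → Δ) → δ ⊢ h → ε ⊢ δ ∘ σ → ε ⊢ h ∘ σ
  via σ q p = p ⨾ reindex σ q

  abstract
    -- The branches are selected by their indices, so that only the branch
    -- taken is run.
    case⊢ : ε ⊢ g →
            (λ ((γ , _) : Σ Γ λ γ → g γ ≡ 0) → ε γ) ⊢ f ∘ proj₁ →
            (λ ((γ , m , _) : Σ Γ λ γ → ∃[ m ] g γ ≡ suc m) → ε γ ∙ m) ⊢ f ∘ proj₁ →
            ε ⊢ f
    case⊢ {Γ} {ε = ε} {g} {f} n p q = computes all λ γ → run γ (g γ) refl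
      where
      step sel all : Code
      step = comp (code q) (pair fst (comp predCode snd))
      sel = prec (quoteCode (comp (code p) fst)) (comp (quoteCode step) fst)
      all = comp univ (pair (comp sel (pair zero (code n))) (pair idCode (code n)))
      -- A primitive recursion evaluates all earlier stages, so they have to halt although the step
      -- discards their value.
      any : ∀ m → ∃[ y ] Eval O sel (0 ∙ m) y
      any zero    = _ , Eval-prec-0 (Eval-quote _)
      any (suc m) = _ , Eval-prec-s (proj₂ (any m)) (comp Eval-fst (Eval-quote _))
      run : ∀ γ m → g γ ≡ m → Eval O all (ε γ) (f γ)
      run γ zero eq = comp
        (Eval-pair (comp (Eval-pair zero (subst (Eval O _ _) eq (eval n γ))) (Eval-prec-0 (Eval-quote _)))
                   (Eval-pair Eval-id (eval n γ)))
        (Eval-univ {c = comp (code p) fst} (comp Eval-fst (eval p (γ , eq))))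
      run γ (suc m) eq = comp
        (Eval-pair (comp (Eval-pair zero n-eq)
                         (Eval-prec-s (proj₂ (any m)) (comp Eval-fst (Eval-quote _))))
                   (Eval-pair Eval-id n-eq))
        (Eval-univ {c = step} (comp (Eval-pair Eval-fst (comp Eval-snd Eval-pred)) (eval q (γ , m , eq))))
        where
        n-eq : Eval O (code n) (ε γ) (suc m)
        n-eq = subst (Eval O _ _) eq (eval n γ)

    -- The s-m-n theorem in uniform form; the indices of bijections returned by `g` are produced by
    -- it.
    curry⊢ : {A : Γ → Set} {α h : Σ Γ A → ℕ} →
             ε ▹ α ⊢ h →
             Σ[ s ∈ (Γ → ℕ) ] (ε ⊢ s) × (∀ γ a → φ O (s γ) (α (γ , a)) (h (γ , a)))
    curry⊢ {ε = ε} p =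
        (λ γ → encode (curryCode (code p) (ε γ)))
      , computes (curryIndexCode (code p)) (λ γ → Eval-curryIndex (code p) (ε γ))
      , λ γ a → curryCode (code p) (ε γ) , refl , Eval-curry (eval p (γ , a))

    μ⊢ : {P : Γ × ℕ → Set} (P? : ∀ x → Dec (P x)) (e : ∀ γ → ∃[ n ] P (γ , n)) →
         ε ▹ proj₂ ⊢ bit ∘ P? → ε ⊢ (λ γ → μ (λ n → P? (γ , n)) (e γ))
    μ⊢ {ε = ε} P? e p = computes (rfind (code p)) run
      where
      run : ∀ γ → Eval O (rfind (code p)) (ε γ) (μ (λ n → P? (γ , n)) (e γ))
      run γ with least (λ n → P? (γ , n)) (e γ)
      ... | n , isLeast holds minimal = Eval-rfind
              (subst (Eval O _ _) (bit-yes holds) (eval p (γ , n)))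
              (λ m m<n → 0 , subst (Eval O _ _) (bit-no (minimal m m<n)) (eval p (γ , m)))

  -- An argument of a recursive function together with an index of the
  -- function on smaller arguments.
  record Call {Γ : Set} (size ε f : Γ → ℕ) : Set where
    constructor mkCall
    field
      arg   : Γ
      self  : ℕ
      calls : ∀ δ → size δ < size arg → φ O self (ε δ) (f δ)

  abstract
    -- The recursion theorem supplies the body with an index of the function being defined. That
    -- index is known to be correct on smaller arguments only, which is why the induction on `size`
    -- goes through; `size` itself is never computed.
    fix⊢ : (size : Γ → ℕ) →
           (λ (x : Call size ε f) → Call.self x ∙ ε (Call.arg x)) ⊢ f ∘ Call.arg → ε ⊢ f
    fix⊢ {Γ} {ε} {f} size p = computes (fixCode (code p)) λ γ → below (suc (size γ)) γ ≤-refl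
      where
      below : ∀ n γ → size γ < n → Eval O (fixCode (code p)) (ε γ) (f γ)
      below (suc n) γ lt = Eval-fix (eval p (mkCall γ (encode (fixCode (code p)))
        λ δ δ<γ → fixCode (code p) , refl , below n δ (<-≤-trans δ<γ (≤-pred lt))))

  if⊢ : {D : Γ → Set} (d : ∀ γ → Dec (D γ)) → ε ⊢ (λ γ → bit (d γ)) →
        (λ ((γ , _) : Σ Γ D) → ε γ) ⊢ f ∘ proj₁ →
        (λ ((γ , _) : Σ Γ λ γ → ¬ D γ) → ε γ) ⊢ f ∘ proj₁ →
        ε ⊢ f
  if⊢ d b p q = case⊢ b
    (reindex (λ (γ , eq) → γ , bit≡0 {a? = d γ} eq) p)
    (fst⊢ id⊢ ⨾ reindex (λ (γ , _ , eq) → γ , bit≢0 {a? = d γ} eq) q)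

  -- Here the value may depend on the decision itself and on the proof inside it, so each branch is
  -- computed in an environment that contains that proof.
  dec⊢ : {D : Γ → Set} (F : ∀ γ → Dec (D γ) → ℕ) (d : ∀ γ → Dec (D γ)) → ε ⊢ (λ γ → bit (d γ)) →
         (λ ((γ , _) : Σ Γ D) → ε γ) ⊢ (λ (γ , p) → F γ (yes p)) →
         (λ ((γ , _) : Σ Γ λ γ → ¬ D γ) → ε γ) ⊢ (λ (γ , ¬p) → F γ (no ¬p)) →
         ε ⊢ (λ γ → F γ (d γ))
  dec⊢ {Γ} {D = D} F d b p q = case⊢ b
    (conv (λ (γ , eq) → cong (F γ) (sym (proj₂ (is-yes γ eq))))
      (reindex (λ (γ , eq) → γ , proj₁ (is-yes γ eq)) p))
    (fst⊢ (conv (λ (γ , m , eq) → cong (λ d → F γ d ∙ m) (sym (proj₂ (is-no γ eq))))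
      ((fst⊢ id⊢ ⨾ reindex (λ (γ , _ , eq) → γ , proj₁ (is-no γ eq)) q) ,⊢ snd⊢ id⊢)))
    where
    is-yes : ∀ γ → bit (d γ) ≡ 0 → Σ[ p ∈ D γ ] d γ ≡ yes p
    is-yes γ eq with d γ
    ... | yes p = p , refl
    is-no : ∀ γ {m} → bit (d γ) ≡ suc m → Σ[ ¬p ∈ ¬ D γ ] d γ ≡ no ¬p
    is-no γ eq with d γ
    ... | no ¬p = ¬p , refl

  bit-if⊢ : {C D : Γ → Set} (c : ∀ γ → Dec (C γ)) {d : ∀ γ → Dec (D γ)} →
            ε ⊢ (λ γ → bit (c γ)) → (∀ γ → D γ → C γ) →
            (λ ((γ , _) : Σ Γ C) → ε γ) ⊢ (λ (γ , _) → bit (d γ)) →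
            ε ⊢ (λ γ → bit (d γ))
  bit-if⊢ c {d} b D⇒C p = if⊢ c b p
    (conv (λ (γ , ¬C) → sym (bit-no {a? = d γ} (¬C ∘ D⇒C γ))) (const⊢ 1))

  maybe⊢ : {A : Γ → Set} {α : Σ Γ A → ℕ} (m : ∀ γ → Maybe (A γ)) →
           ε ⊢ (λ γ → codeMaybe (λ a → α (γ , a)) (m γ)) →
           (λ ((γ , _) : Σ Γ λ γ → m γ ≡ nothing) → ε γ) ⊢ f ∘ proj₁ →
           (λ ((γ , a , _) : Σ Γ λ γ → Σ[ a ∈ A γ ] m γ ≡ just a) → ε γ ∙ α (γ , a)) ⊢ f ∘ proj₁ →
           ε ⊢ f
  maybe⊢ {Γ} {ε = ε} {f = f} {A} {α} m c p q = case⊢ c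
    (reindex (λ (γ , eq) → γ , is-nothing γ eq) p)
    (conv″ (reindex (λ (γ , n , eq) → γ , is-just γ eq) q))
    where
    is-nothing : ∀ γ → codeMaybe (λ a → α (γ , a)) (m γ) ≡ 0 → m γ ≡ nothing
    is-nothing γ eq with m γ
    ... | nothing = refl
    is-just : ∀ γ {n} → codeMaybe (λ a → α (γ , a)) (m γ) ≡ suc n → Σ[ a ∈ A γ ] m γ ≡ just a
    is-just γ eq with m γ
    ... | just a = a , refl
    is-just-α : ∀ γ {n} (eq : codeMaybe (λ a → α (γ , a)) (m γ) ≡ suc n) →
                α (γ , proj₁ (is-just γ eq)) ≡ n
    is-just-α γ eq with m γ
    ... | just a = suc-injective eq
    B : Set
    B = Σ Γ λ γ → ∃[ n ] codeMaybe (λ a → α (γ , a)) (m γ) ≡ suc n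
    conv″ : (λ ((γ , n , eq) : B) → ε γ ∙ α (γ , proj₁ (is-just γ eq))) ⊢ f ∘ proj₁ →
            (λ ((γ , n , eq) : B) → ε γ ∙ n) ⊢ f ∘ proj₁
    conv″ r = conv (λ (γ , n , eq) → cong (ε γ ∙_) (sym (is-just-α γ eq))) id⊢ ⨾ r

  elim⊢ : {A : Γ → Set} {α : Σ Γ A → ℕ} (F : ∀ γ → Maybe (A γ) → ℕ) (m : ∀ γ → Maybe (A γ)) →
          ε ⊢ (λ γ → codeMaybe (λ a → α (γ , a)) (m γ)) →
          ε ⊢ (λ γ → F γ nothing) → ε ▹ α ⊢ (λ (γ , a) → F γ (just a)) →
          ε ⊢ (λ γ → F γ (m γ))
  elim⊢ {α = α} F m c p q = maybe⊢ {α = α} m c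
    (conv (λ (γ , eq) → cong (F γ) (sym eq)) (reindex proj₁ p))
    (conv (λ (γ , a , eq) → cong (F γ) (sym eq)) (reindex (λ (γ , a , _) → γ , a) q))

  ≟⊢ : ε ⊢ f → ε ⊢ g → ε ⊢ (λ γ → bit (f γ ≟ g γ))
  ≟⊢ {f = f} {g} p q = via (λ γ → f γ , g γ) equality (p ,⊢ q)
    where
    equality : (λ ((m , n) : ℕ × ℕ) → m ∙ n) ⊢ (λ (m , n) → bit (m ≟ n))
    equality = fix⊢ proj₁ (case⊢ (fst⊢ (snd⊢ id⊢))
      (case⊢ (snd⊢ (snd⊢ id⊢))
        (conv (λ ((mkCall (m , n) _ _ , m≡0) , n≡0) →
          sym (bit-yes {a? = m ≟ n} (trans m≡0 (sym n≡0)))) (const⊢ 0))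
        (conv (λ { ((mkCall (_ , _) _ _ , refl) , _ , refl) → refl }) (const⊢ 1)))
      (case⊢ (snd⊢ (snd⊢ (fst⊢ id⊢)))
        (conv (λ { ((mkCall (_ , _) _ _ , _ , refl) , refl) → refl }) (const⊢ 1))
        (φ⊢ (fst⊢ (fst⊢ (fst⊢ id⊢))) (snd⊢ (fst⊢ id⊢) ,⊢ snd⊢ id⊢)
          λ { ((mkCall (_ , _) e calls , m , refl) , n , refl) →
              subst (φ O e (m ∙ n)) (bit-cong {a? = m ≟ n} (cong suc) suc-injective)
                    (calls (m , n) ≤-refl) })))

  codeList-∷ : ∀ x a → suc (x ∙ codeList a) ≡ codeList (x ∷ a)
  codeList-∷ x a = cong suc (∙≡⟨⟩ x (codeList a))

  ∷⊢ : {x : Γ → ℕ} {l : Γ → List ℕ} → ε ⊢ x → ε ⊢ (λ γ → codeList (l γ)) →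
       ε ⊢ (λ γ → codeList (x γ ∷ l γ))
  ∷⊢ {x = x} {l} p q = conv (λ γ → codeList-∷ (x γ) (l γ)) (suc⊢ (p ,⊢ q))

  module _ {A : Γ → Set} {α : Σ Γ A → ℕ} where

    codes : ∀ {γ} → List (A γ) → ℕ
    codes {γ} l = codeList (List.map (λ a → α (γ , a)) l)

    listrec⊢ : {f : (Σ Γ λ γ → List (A γ)) → ℕ} →
      ε ⊢ (λ γ → f (γ , [])) →
      (λ ((γ , a , l) : Σ Γ λ γ → A γ × List (A γ)) → ε γ ∙ α (γ , a) ∙ codes l ∙ f (γ , l))
        ⊢ (λ (γ , a , l) → f (γ , a ∷ l)) →
      ε ▹ codes ∘ proj₂ ⊢ f
    listrec⊢ {ε = ε} {f} p q = fix⊢ (length ∘ proj₂) (case⊢ (snd⊢ (snd⊢ id⊢))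
      (conv (λ { (mkCall (_ , []) _ _ , _) → refl })
        (fst⊢ (snd⊢ id⊢) ⨾ reindex (λ x → proj₁ (Call.arg (proj₁ x))) p))
      (run (λ { (mkCall (_ , _ ∷ _) _ _ , _) → cong suc (sym (∙≡⟨⟩ _ _)) }) ))
      where
      C : Set
      C = Call {Γ = Σ Γ λ γ → List (A γ)} (length ∘ proj₂) (λ (γ , l) → ε γ ∙ codes l) f
      B : Set
      B = Σ C λ x → ∃[ m ] codes (proj₂ (Call.arg x)) ≡ suc m
      σ : B → Σ Γ λ γ → A γ × List (A γ)
      σ (mkCall (γ , a ∷ l) _ _ , _) = γ , a , l
      arg≡σ : ∀ b → Call.arg (proj₁ b) ≡ (proj₁ (σ b) , proj₁ (proj₂ (σ b)) ∷ proj₂ (proj₂ (σ b)))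
      arg≡σ (mkCall (γ , a ∷ l) _ _ , _) = refl
      run : (∀ (b : B) → codes (proj₂ (Call.arg (proj₁ b))) ≡
               suc (α (proj₁ (σ b) , proj₁ (proj₂ (σ b))) ∙ codes (proj₂ (proj₂ (σ b))))) →
            (λ ((x , m , _) : B) → (Call.self x ∙ ε (proj₁ (Call.arg x)) ∙ codes (proj₂ (Call.arg x))) ∙ m)
              ⊢ (λ b → f (Call.arg (proj₁ b)))
      run split = conv (λ b → sym (cong f (arg≡σ b)))
        (via σ q (env ,⊢ head ,⊢ tail ,⊢
          φ⊢ (fst⊢ (fst⊢ id⊢)) (env ,⊢ tail)
            λ { (mkCall (γ , a ∷ l) _ calls , _) → calls (γ , l) ≤-refl }))
        where
        parts : (λ ((x , m , _) : B) → (Call.self x ∙ ε (proj₁ (Call.arg x)) ∙ codes (proj₂ (Call.arg x))) ∙ m)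
                  ⊢ (λ b → α (proj₁ (σ b) , proj₁ (proj₂ (σ b))) ∙ codes (proj₂ (proj₂ (σ b))))
        parts = pred⊢ (conv split (snd⊢ (snd⊢ (fst⊢ id⊢))))
        head = fst⊢ parts
        tail = snd⊢ parts
        env : (λ ((x , m , _) : B) → (Call.self x ∙ ε (proj₁ (Call.arg x)) ∙ codes (proj₂ (Call.arg x))) ∙ m)
                ⊢ (λ b → ε (proj₁ (σ b)))
        env = conv (λ b → cong (ε ∘ proj₁) (arg≡σ b)) (fst⊢ (snd⊢ (fst⊢ id⊢)))

  private variable
    A B : Γ → Set
    α β : Σ Γ A → ℕ

  fold⊢ : {f : (Σ Γ λ γ → List (A γ)) → ℕ} (l : ∀ γ → List (A γ)) →
    ε ⊢ (λ γ → codeList (List.map (λ a → α (γ , a)) (l γ))) →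
    ε ⊢ (λ γ → f (γ , [])) →
    (λ ((γ , a , m) : Σ Γ λ γ → A γ × List (A γ)) →
       ε γ ∙ α (γ , a) ∙ codeList (List.map (λ a → α (γ , a)) m) ∙ f (γ , m))
      ⊢ (λ (γ , a , m) → f (γ , a ∷ m)) →
    ε ⊢ (λ γ → f (γ , l γ))
  fold⊢ {α = α} l p q r = via (λ γ → γ , l γ) (listrec⊢ {α = α} q r) (id⊢ ,⊢ p)

  map⊢ : {h : Σ Γ A → ℕ} (l : ∀ γ → List (A γ)) →
    ε ⊢ (λ γ → codeList (List.map (λ a → α (γ , a)) (l γ))) →
    ε ▹ α ⊢ h →
    ε ⊢ (λ γ → codeList (List.map (λ a → h (γ , a)) (l γ)))
  map⊢ {α = α} {h} l p q = fold⊢ {α = α} {f = λ (γ , m) → codeList (List.map (λ a → h (γ , a)) m)} l p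
    (const⊢ 0)
    (∷⊢ (via (λ (γ , a , m) → γ , a) q (fst⊢ id⊢ ,⊢ fst⊢ (snd⊢ id⊢))) (snd⊢ (snd⊢ (snd⊢ id⊢))))

  map-id⊢ : {l : Γ → List ℕ} → ε ⊢ (λ γ → codeList (l γ)) → ε ⊢ (λ γ → codeList (List.map id (l γ)))
  map-id⊢ {l = l} = conv (λ γ → cong codeList (sym (Listₚ.map-id (l γ))))

  ++⊢ : {k l : Γ → List ℕ} → ε ⊢ (λ γ → codeList (k γ)) → ε ⊢ (λ γ → codeList (l γ)) →
        ε ⊢ (λ γ → codeList (k γ ++ l γ))
  ++⊢ {k = k} {l} p q = fold⊢ {α = proj₂} {f = λ (γ , m) → codeList (m ++ l γ)} k (map-id⊢ p) q
    (∷⊢ (fst⊢ (snd⊢ id⊢)) (snd⊢ (snd⊢ (snd⊢ id⊢))))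

  traverse⊢ : (t : ∀ γ → A γ → Maybe (B γ)) (l : ∀ γ → List (A γ)) →
    ε ⊢ (λ γ → codeList (List.map (λ a → α (γ , a)) (l γ))) →
    ε ▹ α ⊢ (λ (γ , a) → codeMaybe (λ b → β (γ , b)) (t γ a)) →
    ε ⊢ (λ γ → codeMaybe (λ m → codeList (List.map (λ b → β (γ , b)) m)) (traverse (t γ) (l γ)))
  traverse⊢ {α = α} {β = β} t l p q =
    fold⊢ {α = α} {f = λ (γ , m) → codeTuple γ (traverse (t γ) m)} l p (const⊢ 1)
      (elim⊢ {α = λ ((γ , _) , b) → β (γ , b)}
        (λ (γ , a , m) o → codeTuple γ (consMaybe o (traverse (t γ) m))) (λ (γ , a , m) → t γ a)
        (via (λ (γ , a , m) → γ , a) q (fst⊢ id⊢ ,⊢ fst⊢ (snd⊢ id⊢)))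
        (const⊢ 0)
        (elim⊢ {α = λ (((γ , _) , _) , n) → codeList (List.map (λ b → β (γ , b)) n)}
          (λ ((γ , _) , b) o → codeTuple γ (consMaybe (just b) o)) (λ ((γ , a , m) , _) → traverse (t γ) m)
          (snd⊢ (snd⊢ (snd⊢ (fst⊢ id⊢)))) (const⊢ 0)
          (suc⊢ (∷⊢ (snd⊢ (fst⊢ id⊢)) (snd⊢ id⊢)))))
    where
    codeTuple : ∀ γ → Maybe (List _) → ℕ
    codeTuple γ = codeMaybe (λ m → codeList (List.map (λ b → β (γ , b)) m))

  certify⊢ : {P : Γ → ℕ → Set} {n : Γ → ℕ} (d : ∀ γ → Dec (P γ (n γ))) → ε ⊢ n →
             ε ⊢ (λ γ → bit (d γ)) → ε ⊢ (λ γ → codeMaybe proj₁ (certify {P γ} (d γ)))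
  certify⊢ {P = P} d p q = dec⊢ (λ γ d → codeMaybe proj₁ (certify {P γ} d)) d q
    (suc⊢ (reindex proj₁ p)) (const⊢ 0)

  decide : ∀ {e} {P : Pred ℕ 0ℓ} → Decides O e P → ∀ n → Dec (P n)
  decide d n with d n
  ... | inj₁ (p , _)  = yes p
  ... | inj₂ (¬p , _) = no ¬p

  decide⊢ : {e n : Γ → ℕ} {P : Γ → Pred ℕ 0ℓ} (d : ∀ γ → Decides O (e γ) (P γ)) →
            ε ⊢ e → ε ⊢ n → ε ⊢ (λ γ → bit (decide (d γ) (n γ)))
  decide⊢ {Γ} {ε = ε} {e} {n} d p q = case⊢ {g = value} (φ⊢ p q value-φ)
    (conv (λ (γ , eq) → no-bit γ eq) (const⊢ 1))
    (conv (λ (γ , _ , eq) → yes-bit γ eq) (const⊢ 0))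
    where
    value : Γ → ℕ
    value γ with d γ (n γ)
    ... | inj₁ _ = 1
    ... | inj₂ _ = 0
    value-φ : ∀ γ → φ O (e γ) (n γ) (value γ)
    value-φ γ with d γ (n γ)
    ... | inj₁ (_ , r) = r
    ... | inj₂ (_ , r) = r
    no-bit : ∀ γ → value γ ≡ 0 → 1 ≡ bit (decide (d γ) (n γ))
    no-bit γ eq with d γ (n γ)
    no-bit γ () | inj₁ _
    no-bit γ eq | inj₂ _ = refl
    yes-bit : ∀ γ {m} → value γ ≡ suc m → 0 ≡ bit (decide (d γ) (n γ))
    yes-bit γ eq with d γ (n γ)
    yes-bit γ eq | inj₁ _ = refl
    yes-bit γ () | inj₂ _

  decides : {P : Pred ℕ 0ℓ} (P? : ∀ n → Dec (P n)) (p : id ⊢ (λ n → bit (P? n))) → Decidable O P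
  decides {P} P? p = index q , λ n → correct n (P? n) refl
    where
    -- Passes from the convention of `bit`, where 0 means yes, to that of `Decides`, where 1 does.
    q : id ⊢ (λ n → 1 ∸ bit (P? n))
    q = case⊢ p (conv (λ (n , eq) → sym (cong (1 ∸_) eq)) (const⊢ 1))
                (conv (λ (n , m , eq) → sym (trans (cong (1 ∸_) eq) (0∸n≡0 m))) (const⊢ 0))
    correct : ∀ n (d : Dec (P n)) → P? n ≡ d → (P n × φ O (index q) n 1) ⊎ (¬ P n × φ O (index q) n 0)
    correct n (yes p) eq = inj₁ (p , subst (λ d → φ O (index q) n (1 ∸ bit d)) eq (index-φ q n))
    correct n (no ¬p) eq = inj₂ (¬p , subst (λ d → φ O (index q) n (1 ∸ bit d)) eq (index-φ q n))

  listed : ∀ {e} {P : Pred ℕ 0ℓ} → Enumerates O e P → ℕ → Maybe (∃ P)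
  listed (total , lists) s with total s
  ... | zero  , _ = nothing
  ... | suc n , r = just (n , Equivalence.from (lists n) (s , r))

  listed⊢ : {e s : Γ → ℕ} {P : Γ → Pred ℕ 0ℓ} (en : ∀ γ → Enumerates O (e γ) (P γ)) →
            ε ⊢ e → ε ⊢ s → ε ⊢ (λ γ → codeMaybe proj₁ (listed (en γ) (s γ)))
  listed⊢ {e = e} {s} en p q = φ⊢ p q run
    where
    run : ∀ γ → φ O (e γ) (s γ) (codeMaybe proj₁ (listed (en γ) (s γ)))
    run γ with proj₁ (en γ) (s γ)
    ... | zero  , r = r
    ... | suc n , r = r

  listed-complete : Functional O → ∀ {e} {P : Pred ℕ 0ℓ} (en : Enumerates O e P) →
                    ∀ n → P n → ∃[ s ] ∃[ p ] listed en s ≡ just (n , p)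
  listed-complete O! (total , lists) n p with Equivalence.to (lists n) p
  ... | s , r = s , value
    where
    value : ∃[ p ] listed (total , lists) s ≡ just (n , p)
    value with total s
    ... | m , r′ with φ-functional O! r′ r
    ... | refl = _ , refl

  -- Soundness comes from the type of `t`, whose values carry proofs of membership; only
  -- completeness has to be supplied.
  enumerates : Functional O → {P : Pred ℕ 0ℓ} (t : ℕ → Maybe (∃ P)) (p : id ⊢ (λ s → codeMaybe proj₁ (t s))) →
               (∀ n → P n → ∃[ s ] ∃[ p ] t s ≡ just (n , p)) → CE O P
  enumerates O! {P} t p complete = index p ,
    (λ s → _ , index-φ p s) , λ n → mk⇔
      (λ Pn → let s , Pn′ , eq = complete n Pn in
              s , subst (λ x → φ O (index p) s (codeMaybe proj₁ x)) eq (index-φ p s))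
      (λ (s , r) → sound n (t s) (φ-functional O! (index-φ p s) r))
    where
    sound : ∀ n (x : Maybe (∃ P)) → codeMaybe proj₁ x ≡ suc n → P n
    sound n (just (.n , Pn)) refl = Pn

  -- The program for `f` is known to behave only on `D` and might halt elsewhere. Guarding it by the
  -- search for `s` confines the domain, while `witness` ensures that the search succeeds on all of
  -- `D`.
  semidecide⊢ : Functional O → {P : ℕ × ℕ → Set} (P? : ∀ x → Dec (P x)) {D : ℕ → Set} {f : Σ ℕ D → ℕ} →
    (λ ((n , s) : ℕ × ℕ) → n ∙ s) ⊢ (λ x → bit (P? x)) → proj₁ ⊢ f →
    (∀ n → D n → ∃[ s ] P (n , s)) →
    ∃[ e ] (∀ n y → φ O e n y → ∃[ s ] P (n , s)) × (∀ n (d : D n) → φ O e n (f (n , d)))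
  semidecide⊢ O! {P} P? {D} {f} p q witness = encode e , halts-only , λ n d → e , refl , halts n d
    where
    e : Code
    e = guardCode (code p) (code q)
    halts : ∀ n (d : D n) → Eval O e n (f (n , d))
    halts n d with least (λ s → P? (n , s)) (witness n d)
    ... | s , isLeast holds minimal = Eval-guard
      (subst (Eval O _ _) (bit-yes {a? = P? (n , s)} holds) (eval p (n , s)))
      (λ m m<s → 0 , subst (Eval O _ _) (bit-no {a? = P? (n , m)} (minimal m m<s)) (eval p (n , m)))
      (eval q (n , d))
    halts-only : ∀ n y → φ O (encode e) n y → ∃[ s ] P (n , s)
    halts-only n y (c , eq , r) with encode-injective c e eq
    ... | refl = let s , r′ = guard-halts r in
      s , bit≡0 {a? = P? (n , s)} (Eval-functional O! (eval p (n , s)) r′ refl)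

-- Partial isomorphisms and embeddings

-- The correspondence between two tuples, as a relation between elements. Working with it avoids the
-- casts between `Fin (length a)` and `Fin (length b)` that are built into `_≃_`.
data Zip {A B : Set} : List A → List B → A → B → Set where
  here  : ∀ {x y a b} → Zip (x ∷ a) (y ∷ b) x y
  there : ∀ {x y a b x′ y′} → Zip a b x y → Zip (x′ ∷ a) (y′ ∷ b) x y

module _ {A B : Set} where

  zip-lookup : ∀ (a : List A) (b : List B) (eq : length a ≡ length b) i →
               Zip a b (lookup a i) (lookup b (Fin.cast eq i))
  zip-lookup (x ∷ a) (y ∷ b) eq Fin.zero    = here
  zip-lookup (x ∷ a) (y ∷ b) eq (Fin.suc i) = there (zip-lookup a b (suc-injective eq) i)

  zip-position : ∀ {a : List A} {b : List B} (eq : length a ≡ length b) {x y} → Zip a b x y →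
                 ∃[ i ] x ≡ lookup a i × y ≡ lookup b (Fin.cast eq i)
  zip-position eq here = Fin.zero , refl , refl
  zip-position eq (there z) with zip-position (suc-injective eq) z
  ... | i , refl , refl = Fin.suc i , refl , refl

  zip-sym : ∀ {a : List A} {b : List B} {x y} → Zip a b x y → Zip b a y x
  zip-sym here      = here
  zip-sym (there z) = there (zip-sym z)

  zip-∈ˡ : ∀ {a : List A} {b : List B} {x y} → Zip a b x y → x ∈ a
  zip-∈ˡ here      = here refl
  zip-∈ˡ (there z) = there (zip-∈ˡ z)

  ∈-zip : ∀ {a : List A} {b : List B} {x} → length a ≡ length b → x ∈ a → ∃[ y ] Zip a b x y
  ∈-zip {b = y ∷ b} eq (here refl) = y , here
  ∈-zip {b = _ ∷ b} eq (there x∈a) = let y , z = ∈-zip (suc-injective eq) x∈a in y , there z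

  zip-++ˡ : ∀ {a : List A} {b : List B} {a′ b′ x y} → Zip a b x y → Zip (a ++ a′) (b ++ b′) x y
  zip-++ˡ here      = here
  zip-++ˡ (there z) = there (zip-++ˡ z)

  zip-++ʳ : ∀ (a : List A) (b : List B) {a′ b′ x y} → length a ≡ length b →
            Zip a′ b′ x y → Zip (a ++ a′) (b ++ b′) x y
  zip-++ʳ []      []      eq z = z
  zip-++ʳ (_ ∷ a) (_ ∷ b) eq z = there (zip-++ʳ a b (suc-injective eq) z)

  zip-++⁻ : ∀ (a : List A) (b : List B) {a′ b′ x y} → length a ≡ length b →
            Zip (a ++ a′) (b ++ b′) x y → Zip a b x y ⊎ Zip a′ b′ x y
  zip-++⁻ []      []      eq z = inj₂ z
  zip-++⁻ (_ ∷ a) (_ ∷ b) eq here = inj₁ here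
  zip-++⁻ (_ ∷ a) (_ ∷ b) eq (there z) with zip-++⁻ a b (suc-injective eq) z
  ... | inj₁ z′ = inj₁ (there z′)
  ... | inj₂ z′ = inj₂ z′

  zip-map : ∀ (f : A → B) (a : List A) {x y} → Zip a (List.map f a) x y → y ≡ f x
  zip-map f (x ∷ a) here      = refl
  zip-map f (x ∷ a) (there z) = zip-map f a z

  zip-pointwise : ∀ {R : A → B → Set} {a : List A} {b : List B} → PointwiseL R a b →
                  ∀ {x y} → Zip a b x y → R x y
  zip-pointwise (r ∷ rs) here      = r
  zip-pointwise (r ∷ rs) (there z) = zip-pointwise rs z

zip-compose : ∀ {A B C : Set} (a : List A) (b : List B) (c : List C) {x z} → length a ≡ length b →
              Zip a c x z → ∃[ y ] Zip a b x y × Zip b c y z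
zip-compose (_ ∷ a) (y ∷ b) (_ ∷ c) eq here = y , here , here
zip-compose (_ ∷ a) (_ ∷ b) (_ ∷ c) eq (there z) =
  let y , p , q = zip-compose a b c (suc-injective eq) z in y , there p , there q

module _ {L : Language} where
  open Language L

  mutual
    rename : ∀ {m n} → (Fin m → Fin n) → Term L m → Term L n
    rename θ (var i)    = var (θ i)
    rename θ (app f ts) = app f (rename* θ ts)

    rename* : ∀ {m n k} → (Fin m → Fin n) → Vec (Term L m) k → Vec (Term L n) k
    rename* θ []       = []
    rename* θ (t ∷ ts) = rename θ t ∷ rename* θ ts

  module _ (A : Structure L) where
    open Structure A using (Carrier; _≈_) renaming (refl to ≈-refl; sym to ≈-sym; trans to ≈-trans)
    private module A = Structure A

    module _ {m n} (θ : Fin m → Fin n) (ρ : Fin n → Carrier) where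
      mutual
        ⟦rename⟧ : ∀ t → ⟦_⟧ A ρ (rename θ t) ≡ ⟦_⟧ A (ρ ∘ θ) t
        ⟦rename⟧ (var i)    = refl
        ⟦rename⟧ (app f ts) = cong (A.fun f) (⟦rename⟧* ts)

        ⟦rename⟧* : ∀ {k} (ts : Vec (Term L m) k) → ⟦_⟧* A ρ (rename* θ ts) ≡ ⟦_⟧* A (ρ ∘ θ) ts
        ⟦rename⟧* []       = refl
        ⟦rename⟧* (t ∷ ts) = cong₂ _∷_ (⟦rename⟧ t) (⟦rename⟧* ts)

    module _ {n} {ρ σ : Fin n → Carrier} (ρ≈σ : ∀ i → ρ i ≈ σ i) where
      mutual
        ⟦⟧-cong : ∀ t → ⟦_⟧ A ρ t ≈ ⟦_⟧ A σ t
        ⟦⟧-cong (var i)    = ρ≈σ i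
        ⟦⟧-cong (app f ts) = A.fun-cong f (⟦⟧*-cong ts)

        ⟦⟧*-cong : ∀ {k} (ts : Vec (Term L n) k) → Pointwise _≈_ (⟦_⟧* A ρ ts) (⟦_⟧* A σ ts)
        ⟦⟧*-cong []       = []
        ⟦⟧*-cong (t ∷ ts) = ⟦⟧-cong t ∷ ⟦⟧*-cong ts

      ⊨-cong : ∀ ψ → _⊨_ A ρ ψ → _⊨_ A σ ψ
      ⊨-cong (s ≐ t)    e = ≈-trans (≈-sym (⟦⟧-cong s)) (≈-trans e (⟦⟧-cong t))
      ⊨-cong (rel r ts) p = A.Rel-resp r (⟦⟧*-cong ts) p

    ⟦vars⟧ : ∀ {n k} (θ : Fin k → Fin n) (ρ : Fin n → Carrier) →
             ⟦_⟧* A ρ (Vec.tabulate (var ∘ θ)) ≡ Vec.tabulate (ρ ∘ θ)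
    ⟦vars⟧ {k = zero}  θ ρ = refl
    ⟦vars⟧ {k = suc k} θ ρ = cong (ρ (θ Fin.zero) ∷_) (⟦vars⟧ (θ ∘ Fin.suc) ρ)

    module _ {a : Tuple A} where
      mutual
        cl-term : ∀ {x} → Cl A a x → Σ[ t ∈ Term L (length a) ] x ≈ ⟦_⟧ A (lookup a) t
        cl-term (gen i e)    = var i , e
        cl-term (app f ps e) =
          let ts , es = cl-terms ps in app f ts , ≈-trans e (A.fun-cong f es)

        cl-terms : ∀ {k} {v : Vec Carrier k} → VecAll.All (Cl A a) v →
                   Σ[ ts ∈ Vec (Term L (length a)) k ] Pointwise _≈_ v (⟦_⟧* A (lookup a) ts)
        cl-terms []       = [] , []
        cl-terms (p ∷ ps) =
          let t , e = cl-term p ; ts , es = cl-terms ps in t ∷ ts , e ∷ es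

      mutual
        term-cl : ∀ {n} {ρ : Fin n → Carrier} → (∀ i → Cl A a (ρ i)) → ∀ t → Cl A a (⟦_⟧ A ρ t)
        term-cl p (var i)    = p i
        term-cl p (app f ts) = app f (terms-cl p ts) ≈-refl

        terms-cl : ∀ {n k} {ρ : Fin n → Carrier} → (∀ i → Cl A a (ρ i)) →
                   ∀ (ts : Vec (Term L n) k) → VecAll.All (Cl A a) (⟦_⟧* A ρ ts)
        terms-cl p []       = []
        terms-cl p (t ∷ ts) = term-cl p t ∷ terms-cl p ts

      cl-resp : ∀ {x y} → x ≈ y → Cl A a x → Cl A a y
      cl-resp e (gen i e′)    = gen i (≈-trans (≈-sym e) e′)
      cl-resp e (app f ps e′) = app f ps (≈-trans (≈-sym e) e′)

      ∈-cl : ∀ {x} → x ∈ a → Cl A a x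
      ∈-cl x∈a = gen (Any.index x∈a) (subst (_ ≈_) (∈-lookup-index x∈a) ≈-refl)
        where
        ∈-lookup-index : ∀ {b : Tuple A} {x} (x∈b : x ∈ b) → x ≡ lookup b (Any.index x∈b)
        ∈-lookup-index (here eq)   = eq
        ∈-lookup-index (there x∈b) = ∈-lookup-index x∈b

    cl-elim : ∀ {a} (P : Carrier → Set) → (∀ {x y} → x ≈ y → P x → P y) →
              (∀ x → x ∈ a → P x) → (∀ f v → VecAll.All P v → P (A.fun f v)) →
              ∀ {x} → Cl A a x → P x
    cl-elim {a} P resp gens funs = go
      where
      mutual
        go : ∀ {x} → Cl A a x → P x
        go (gen i e)        = resp (≈-sym e) (gens _ (∈ₚ.∈-lookup i))
        go (app f {v} ps e) = resp (≈-sym e) (funs f v (go* ps))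

        go* : ∀ {k} {v : Vec Carrier k} → VecAll.All (Cl A a) v → VecAll.All P v
        go* []       = []
        go* (p ∷ ps) = go p ∷ go* ps

    cl-trans : ∀ {a b} → (∀ x → x ∈ a → Cl A b x) → ∀ {x} → Cl A a x → Cl A b x
    cl-trans {b = b} p = cl-elim (Cl A b) cl-resp p (λ f v ps → app f ps ≈-refl)

  module _ {A B : Structure L} (h : Embedding A B) where
    private
      module A = Structure A
      module B = Structure B
    open Embedding h using (to; injective; preservesRel; preservesFun) renaming (cong to to-cong)

    map-pointwise : ∀ {k} {v : Vec A.Carrier k} {w : Vec B.Carrier k} → Pointwise (λ x y → to x B.≈ y) v w →
                    Pointwise B._≈_ (Vec.map to v) w
    map-pointwise []       = []
    map-pointwise (e ∷ es) = e ∷ map-pointwise es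

    module _ {n} (ρ : Fin n → A.Carrier) where
      mutual
        to-⟦⟧ : ∀ t → to (⟦_⟧ A ρ t) B.≈ ⟦_⟧ B (to ∘ ρ) t
        to-⟦⟧ (var i)    = B.refl
        to-⟦⟧ (app f ts) = B.trans (preservesFun f _) (B.fun-cong f (map-pointwise (to-⟦⟧* ts)))

        to-⟦⟧* : ∀ {k} (ts : Vec (Term L n) k) →
                 Pointwise (λ x y → to x B.≈ y) (⟦_⟧* A ρ ts) (⟦_⟧* B (to ∘ ρ) ts)
        to-⟦⟧* []       = []
        to-⟦⟧* (t ∷ ts) = to-⟦⟧ t ∷ to-⟦⟧* ts

      to-⊨ : ∀ ψ → _⊨_ A ρ ψ ⇔ _⊨_ B (to ∘ ρ) ψ
      to-⊨ (s ≐ t) = mk⇔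
        (λ e → B.trans (B.sym (to-⟦⟧ s)) (B.trans (to-cong e) (to-⟦⟧ t)))
        (λ e → injective (B.trans (to-⟦⟧ s) (B.trans e (B.sym (to-⟦⟧ t)))))
      to-⊨ (rel r ts) = mk⇔
        (λ p → B.Rel-resp r es (Equivalence.to (preservesRel r _) p))
        (λ p → Equivalence.from (preservesRel r _) (B.Rel-resp r (PW.sym B.sym es) p))
        where es = map-pointwise (to-⟦⟧* ts)

  -- Says that `R` extends to an isomorphism between the substructures generated by its two sides.
  -- This single notion covers similar tuples (through `Zip`), embeddings (through their graphs),
  -- and the union of all rounds of the back and forth.
  record PartialIso (A B : Structure L)
                    (R : Structure.Carrier A → Structure.Carrier B → Set) : Set where
    constructor partialIso
    field
      same : ∀ n (ρ : Fin n → Structure.Carrier A) (σ : Fin n → Structure.Carrier B) →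
             (∀ i → R (ρ i) (σ i)) → ∀ ψ → _⊨_ A ρ ψ ⇔ _⊨_ B σ ψ
  open PartialIso

  module _ {A B : Structure L} where
    private
      module A = Structure A
      module B = Structure B

    partialIso-⊆ : ∀ {R S : A.Carrier → B.Carrier → Set} → (∀ {x y} → R x y → S x y) →
                   PartialIso A B S → PartialIso A B R
    partialIso-⊆ R⊆S p = partialIso λ n ρ σ Rρσ → same p n ρ σ (R⊆S ∘ Rρσ)

    partialIso-sym : ∀ {R : A.Carrier → B.Carrier → Set} →
                     PartialIso A B R → PartialIso B A (λ y x → R x y)
    partialIso-sym p = partialIso λ n σ ρ Rρσ ψ →
      mk⇔ (Equivalence.from (same p n ρ σ Rρσ ψ)) (Equivalence.to (same p n ρ σ Rρσ ψ))

    partialIso-resp : ∀ {R : A.Carrier → B.Carrier → Set} → PartialIso A B R →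
      PartialIso A B (λ x y → ∃[ x′ ] ∃[ y′ ] x A.≈ x′ × y B.≈ y′ × R x′ y′)
    partialIso-resp p = partialIso λ n ρ σ r ψ →
      let s = same p n (λ i → proj₁ (r i)) (λ i → proj₁ (proj₂ (r i)))
                       (λ i → proj₂ (proj₂ (proj₂ (proj₂ (r i))))) ψ
          eˡ = λ i → proj₁ (proj₂ (proj₂ (r i)))
          eʳ = λ i → proj₁ (proj₂ (proj₂ (proj₂ (r i))))
      in mk⇔
        (λ h → ⊨-cong B (λ i → B.sym (eʳ i)) ψ (Equivalence.to s (⊨-cong A eˡ ψ h)))
        (λ h → ⊨-cong A (λ i → A.sym (eˡ i)) ψ (Equivalence.from s (⊨-cong B eʳ ψ h)))

    embedding-partialIso : (h : Embedding A B) → PartialIso A B (λ x y → Embedding.to h x B.≈ y)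
    embedding-partialIso h = partialIso λ n ρ σ e ψ → mk⇔
      (λ p → ⊨-cong B e ψ (Equivalence.to (to-⊨ h ρ ψ) p))
      (λ p → Equivalence.from (to-⊨ h ρ ψ) (⊨-cong B (B.sym ∘ e) ψ p))

    -- The equation between a variable and a term is an atomic formula. The new variable takes
    -- position zero, so the term is shifted by `Fin.suc`.
    partialIso-term : ∀ {R : A.Carrier → B.Carrier → Set} → PartialIso A B R →
      ∀ {n} {ρ : Fin n → A.Carrier} {σ} → (∀ i → R (ρ i) (σ i)) → ∀ t {x y} → R x y →
      x A.≈ ⟦_⟧ A ρ t → y B.≈ ⟦_⟧ B σ t
    partialIso-term {R} p {n} {ρ} {σ} Rρσ t {x} {y} Rxy e =
      subst (y B.≈_) (⟦rename⟧ B Fin.suc σ′ t)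
        (Equivalence.to (same p (suc n) ρ′ σ′ R′ (var Fin.zero ≐ rename Fin.suc t))
          (subst (x A.≈_) (sym (⟦rename⟧ A Fin.suc ρ′ t)) e))
      where
      ρ′ : Fin (suc n) → A.Carrier
      ρ′ Fin.zero    = x
      ρ′ (Fin.suc i) = ρ i
      σ′ : Fin (suc n) → B.Carrier
      σ′ Fin.zero    = y
      σ′ (Fin.suc i) = σ i
      R′ : ∀ i → R (ρ′ i) (σ′ i)
      R′ Fin.zero    = Rxy
      R′ (Fin.suc i) = Rρσ i

    partialIso-functional : ∀ {R : A.Carrier → B.Carrier → Set} → PartialIso A B R →
                            ∀ {x x′ y y′} → R x y → R x′ y′ → x A.≈ x′ → y B.≈ y′
    partialIso-functional p {x′ = x′} {y′ = y′} r r′ e =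
      partialIso-term p {1} {λ _ → x′} {λ _ → y′} (λ _ → r′) (var Fin.zero) r e

    partialIso-preserves : ∀ {h : A.Carrier → B.Carrier} → PartialIso A B (λ x y → y ≡ h x) →
                           PreservesStructure A B h
    partialIso-preserves {h} p = record { preservesRel = preservesRel ; preservesFun = preservesFun }
      where
      ⟦vars⟧-lookup : ∀ {k} (v : Vec A.Carrier k) →
                      ⟦_⟧* A (Vec.lookup v) (Vec.tabulate (var ∘ id)) ≡ v
      ⟦vars⟧-lookup v = trans (⟦vars⟧ A id (Vec.lookup v)) (Vecₚ.tabulate∘lookup v)
      ⟦vars⟧-map : ∀ {k} (v : Vec A.Carrier k) →
                   ⟦_⟧* B (h ∘ Vec.lookup v) (Vec.tabulate (var ∘ id)) ≡ Vec.map h v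
      ⟦vars⟧-map v = trans (⟦vars⟧ B id (h ∘ Vec.lookup v))
        (trans (Vecₚ.tabulate-∘ h (Vec.lookup v)) (cong (Vec.map h) (Vecₚ.tabulate∘lookup v)))
      preservesRel : ∀ r v → A.Rel r v ⇔ B.Rel r (Vec.map h v)
      preservesRel r v = mk⇔
        (λ q → subst (B.Rel r) (⟦vars⟧-map v)
                 (Equivalence.to s (subst (A.Rel r) (sym (⟦vars⟧-lookup v)) q)))
        (λ q → subst (A.Rel r) (⟦vars⟧-lookup v)
                 (Equivalence.from s (subst (B.Rel r) (sym (⟦vars⟧-map v)) q)))
        where s = same p _ (Vec.lookup v) (h ∘ Vec.lookup v) (λ _ → refl) (rel r (Vec.tabulate var))
      preservesFun : ∀ f v → h (A.fun f v) B.≈ B.fun f (Vec.map h v)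
      preservesFun f v = subst (λ w → h (A.fun f v) B.≈ B.fun f w) (⟦vars⟧-map v)
        (partialIso-term p {ρ = Vec.lookup v} (λ _ → refl) (app f (Vec.tabulate var)) refl
          (subst (λ w → A.fun f v A.≈ A.fun f w) (sym (⟦vars⟧-lookup v)) A.refl))

  partialIso-trans : ∀ {A B C : Structure L} {R S} → PartialIso A B R → PartialIso B C S →
                     PartialIso A C (λ x z → ∃[ y ] R x y × S y z)
  partialIso-trans p q = partialIso λ n ρ τ r ψ →
    let s = same p n ρ (λ i → proj₁ (r i)) (λ i → proj₁ (proj₂ (r i))) ψ
        t = same q n (λ i → proj₁ (r i)) τ (λ i → proj₂ (proj₂ (r i))) ψ
    in mk⇔ (λ h → Equivalence.to t (Equivalence.to s h))
           (λ h → Equivalence.from s (Equivalence.from t h))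

  atomic-rename : ∀ {m n} → (Fin m → Fin n) → Atomic L m → Atomic L n
  atomic-rename θ (s ≐ t)    = rename θ s ≐ rename θ t
  atomic-rename θ (rel r ts) = rel r (rename* θ ts)

  ⊨-rename : ∀ (A : Structure L) {m n} (θ : Fin m → Fin n) (ρ : Fin n → Structure.Carrier A) ψ →
             _⊨_ A ρ (atomic-rename θ ψ) ≡ _⊨_ A (ρ ∘ θ) ψ
  ⊨-rename A θ ρ (s ≐ t)    = cong₂ (Structure._≈_ A) (⟦rename⟧ A θ ρ s) (⟦rename⟧ A θ ρ t)
  ⊨-rename A θ ρ (rel r ts) = cong (Structure.Rel A r) (⟦rename⟧* A θ ρ ts)

  module _ {A B : Structure L} where
    private
      module A = Structure A
      module B = Structure B

    ≃⇒partialIso : ∀ a b → [ A , B ] a ≃ b → PartialIso A B (Zip a b)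
    ≃⇒partialIso a b (eq , a≃b) = partialIso λ n ρ σ z ψ →
      let θ : Fin n → Fin (length a)
          θ i = proj₁ (zip-position eq (z i))
          ρ-eq : ∀ i → ρ i ≡ lookup a (θ i)
          ρ-eq i = proj₁ (proj₂ (zip-position eq (z i)))
          σ-eq : ∀ i → σ i ≡ lookup b (Fin.cast eq (θ i))
          σ-eq i = proj₂ (proj₂ (zip-position eq (z i)))
      in mk⇔
      (λ h → ⊨-cong B (λ i → B.reflexive (sym (σ-eq i))) ψ
        (subst id (⊨-rename B θ _ ψ) (Equivalence.to (a≃b (atomic-rename θ ψ))
          (subst id (sym (⊨-rename A θ _ ψ)) (⊨-cong A (λ i → A.reflexive (ρ-eq i)) ψ h)))))
      (λ h → ⊨-cong A (λ i → A.reflexive (sym (ρ-eq i))) ψ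
        (subst id (⊨-rename A θ _ ψ) (Equivalence.from (a≃b (atomic-rename θ ψ))
          (subst id (sym (⊨-rename B θ _ ψ)) (⊨-cong B (λ i → B.reflexive (σ-eq i)) ψ h)))))

    partialIso⇒≃ : ∀ a b → length a ≡ length b → PartialIso A B (Zip a b) → [ A , B ] a ≃ b
    partialIso⇒≃ a b eq p = eq , same p _ _ _ (zip-lookup a b eq)

    map-≃ : ∀ (h : Embedding A B) a → [ A , B ] a ≃ List.map (Embedding.to h) a
    map-≃ h a = partialIso⇒≃ a _ (sym (Listₚ.length-map _ a))
      (partialIso-⊆ (λ z → B.reflexive (sym (zip-map _ a z))) (embedding-partialIso h))

  ≃-sym : ∀ {A B : Structure L} a b → [ A , B ] a ≃ b → [ B , A ] b ≃ a
  ≃-sym a b a≃b = partialIso⇒≃ b a (sym (proj₁ a≃b))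
    (partialIso-⊆ zip-sym (partialIso-sym (≃⇒partialIso a b a≃b)))

  ≃-trans : ∀ {A B C : Structure L} a b c → [ A , B ] a ≃ b → [ B , C ] b ≃ c → [ A , C ] a ≃ c
  ≃-trans a b c p q = partialIso⇒≃ a c (trans (proj₁ p) (proj₁ q))
    (partialIso-⊆ (zip-compose a b c (proj₁ p))
      (partialIso-trans (≃⇒partialIso a b p) (≃⇒partialIso b c q)))

  pointwise-≃ : ∀ {A : Structure L} {a b} → PointwiseL (Structure._≈_ A) a b → [ A , A ] a ≃ b
  pointwise-≃ {A} {a} {b} es = partialIso⇒≃ a b (PWL.Pointwise-length es) (partialIso λ n ρ σ z ψ →
    mk⇔ (⊨-cong A (λ i → zip-pointwise es (z i)) ψ)
        (⊨-cong A (λ i → Structure.sym A (zip-pointwise es (z i))) ψ))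

module _ {L : Language} where
  open Language L

  idₑ : ∀ {A : Structure L} → Embedding A A
  idₑ {A} = record
    { injection = record { to = id ; cong = id ; injective = id }
    ; preserves = record
      { preservesRel = λ r v → subst (λ w → A.Rel r v ⇔ A.Rel r w) (sym (Vecₚ.map-id v)) (mk⇔ id id)
      ; preservesFun = λ f v → A.reflexive (cong (A.fun f) (sym (Vecₚ.map-id v)))
      }
    }
    where module A = Structure A

  infixr 9 _∘ₑ_
  _∘ₑ_ : ∀ {A B C : Structure L} → Embedding B C → Embedding A B → Embedding A C
  _∘ₑ_ {A} {B} {C} g f = record
    { injection = record
      { to        = g.to ∘ f.to
      ; cong      = g.cong ∘ f.cong
      ; injective = f.injective ∘ g.injective
      }
    ; preserves = record
      { preservesRel = λ r v → subst (λ w → A.Rel r v ⇔ C.Rel r w) (sym (Vecₚ.map-∘ g.to f.to v))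
          (mk⇔ (Equivalence.to (g.preservesRel r _) ∘ Equivalence.to (f.preservesRel r v))
               (Equivalence.from (f.preservesRel r v) ∘ Equivalence.from (g.preservesRel r _)))
      ; preservesFun = λ φ v → C.trans (g.cong (f.preservesFun φ v))
          (subst (λ w → g.to (B.fun φ (Vec.map f.to v)) C.≈ C.fun φ w) (sym (Vecₚ.map-∘ g.to f.to v))
            (g.preservesFun φ _))
      }
    }
    where
    module A = Structure A
    module B = Structure B
    module C = Structure C
    module f = Embedding f
    module g = Embedding g

  ≅-trans : ∀ {A B C : Structure L} → A ≅ B → B ≅ C → A ≅ C
  ≅-trans {C = C} (f , f-onto) (g , g-onto) = g ∘ₑ f , λ z →
    let y , g-y = g-onto z ; x , f-x = f-onto y
    in x , λ e → g-y (f-x e)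

  module _ {A B : Structure L} where
    private
      module A = Structure A
      module B = Structure B

    extendₑ : ∀ {a} b → Generates A a → [ A , B ] a ≃ b → Embedding A B
    extendₑ {a} b gen-a a≃b = Extend.extend A B {a} {b} gen-a a≃b

    extendₑ-sends : ∀ {a} b (gen-a : Generates A a) (a≃b : [ A , B ] a ≃ b) →
                    ∀ {x y} → Zip a b x y → Embedding.to (extendₑ b gen-a a≃b) x B.≈ y
    extendₑ-sends {a} b gen-a a≃b z with zip-position (proj₁ a≃b) z
    ... | i , refl , refl = Extend.extend-sends A B {a} {b} gen-a a≃b i

    -- Every element is the value of a term in the generators, and both `R` and `h` commute with
    -- terms, so agreement on the generators puts `R` inside the graph of `h`.
    partialIso-extend : ∀ {R : A.Carrier → B.Carrier → Set} → PartialIso A B R →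
      ∀ {a b} → Generates A a → (eq : length a ≡ length b) → (∀ {x y} → Zip a b x y → R x y) →
      (h : Embedding A B) → (∀ {x y} → Zip a b x y → Embedding.to h x B.≈ y) →
      ∀ {x y} → R x y → y B.≈ Embedding.to h x
    partialIso-extend p {a} {b} gen-a eq zip⊆R h h-sends {x} r =
      let t , e = cl-term A (gen-a x) in
      B.trans (partialIso-term p (λ i → zip⊆R (zip-lookup a b eq i)) t r e)
        (B.sym (B.trans (Embedding.cong h e)
          (B.trans (to-⟦⟧ h (lookup a) t) (⟦⟧-cong B (λ i → h-sends (zip-lookup a b eq i)) t))))

    partialIso-cl : ∀ {R : A.Carrier → B.Carrier → Set} → PartialIso A B R →
      ∀ a b → length a ≡ length b → (∀ {x y} → Zip a b x y → R x y) →
      ∀ {x y} → R x y → Cl A a x → Cl B b y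
    partialIso-cl p a b eq zip⊆R r x∈cl =
      let t , e = cl-term A x∈cl in
      cl-resp B (B.sym (partialIso-term p (λ i → zip⊆R (zip-lookup a b eq i)) t r e))
        (term-cl B (λ i → gen (Fin.cast eq i) B.refl) t)

    map-cl : ∀ (h : Embedding A B) {a x} → Cl A a x → Cl B (List.map (Embedding.to h) a) (Embedding.to h x)
    map-cl h {a} = partialIso-cl (embedding-partialIso h) a _ (sym (Listₚ.length-map _ a))
      (λ z → B.reflexive (sym (zip-map _ a z))) B.refl

    cl-image : ∀ (h : Embedding A B) {b} → (∀ y → y ∈ b → ∃[ x ] Embedding.to h x B.≈ y) →
               ∀ {y} → Cl B b y → ∃[ x ] Embedding.to h x B.≈ y
    cl-image h hits = cl-elim B (λ y → ∃[ x ] Embedding.to h x B.≈ y)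
      (λ e (x , e′) → x , B.trans e′ e) hits
      (λ f v ps → let w , es = preimages ps in
        A.fun f w , B.trans (Embedding.preservesFun h f w) (B.fun-cong f es))
      where
      preimages : ∀ {k} {v : Vec B.Carrier k} → VecAll.All (λ y → ∃[ x ] Embedding.to h x B.≈ y) v →
                  Σ[ w ∈ Vec A.Carrier k ] Pointwise B._≈_ (Vec.map (Embedding.to h) w) v
      preimages []             = [] , []
      preimages ((x , e) ∷ ps) = let w , es = preimages ps in x ∷ w , e ∷ es

    extendₑ-onto : ∀ {a b} (gen-a : Generates A a) (a≃b : [ A , B ] a ≃ b) → Generates B b →
                   Onto (extendₑ b gen-a a≃b)
    extendₑ-onto {a} {b} gen-a a≃b gen-b y =
      let x , e = cl-image h hits (gen-b y) in x , λ e′ → B.trans (Embedding.cong h e′) e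
      where
      h = extendₑ b gen-a a≃b
      hits : ∀ y → y ∈ b → ∃[ x ] Embedding.to h x B.≈ y
      hits y y∈b = let x , z = ∈-zip (sym (proj₁ a≃b)) y∈b in x , extendₑ-sends b gen-a a≃b (zip-sym z)

    ≃⇒≅ : ∀ {a} b → Generates A a → Generates B b → [ A , B ] a ≃ b → A ≅ B
    ≃⇒≅ b gen-a gen-b a≃b = extendₑ b gen-a a≃b , extendₑ-onto gen-a a≃b gen-b

  module _ (A : Structure L) where
    private module A = Structure A

    clInclusion : ∀ a → Embedding (clStructure A a) A
    clInclusion a = record
      { injection = record { to = proj₁ ; cong = id ; injective = id }
      ; preserves = record { preservesRel = λ r v → mk⇔ id id ; preservesFun = λ f v → A.refl }
      }

    clGens : ∀ {a b} → (∀ x → x ∈ a → Cl A b x) → List (∃ (Cl A b))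
    clGens {[]}    p = []
    clGens {x ∷ a} p = (x , p x (here refl)) ∷ clGens (λ y → p y ∘ there)

    map-clGens : ∀ {a b} (p : ∀ x → x ∈ a → Cl A b x) → List.map proj₁ (clGens p) ≡ a
    map-clGens {[]}    p = refl
    map-clGens {x ∷ a} p = cong (x ∷_) (map-clGens (λ y → p y ∘ there))

    ∈-clGens : ∀ {a b} (p : ∀ x → x ∈ a → Cl A b x) {x} → x ∈ a →
               ∃[ q ] (x , q) ∈ clGens p
    ∈-clGens {y ∷ a} p (here refl)  = _ , here refl
    ∈-clGens {y ∷ a} p (there x∈a) = let q , m = ∈-clGens (λ y → p y ∘ there) x∈a in q , there m

    clTuple : ∀ a → Tuple (clStructure A a)
    clTuple a = clGens (λ x → ∈-cl A)

    clTuple-generates : ∀ a → Generates (clStructure A a) (clTuple a)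
    clTuple-generates a (x , p) = proj₂ (cl-elim A P resp gens funs p) p
      where
      -- Elements of `clStructure A a` carry a proof of closure, which their equality ignores.
      -- Quantifying over all such proofs makes the induction one about bare elements of `A`.
      P : A.Carrier → Set
      P x = Cl A a x × (∀ q → Cl (clStructure A a) (clTuple a) (x , q))
      resp : ∀ {x y} → x A.≈ y → P x → P y
      resp e (p , c) = cl-resp A e p , λ q → cl-resp (clStructure A a) {x = _ , p} e (c p)
      gens : ∀ x → x ∈ a → P x
      gens x x∈a = ∈-cl A x∈a , λ q → cl-resp (clStructure A a) {x = x , proj₁ m} A.refl
        (∈-cl (clStructure A a) (proj₂ m))
        where m = ∈-clGens (λ x → ∈-cl A {a} {x}) x∈a
      lift : ∀ {k} {v : Vec A.Carrier k} → VecAll.All P v →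
             Σ[ w ∈ Vec (∃ (Cl A a)) k ]
               values A w ≡ v × VecAll.All (Cl (clStructure A a) (clTuple a)) w
      lift []             = [] , refl , []
      lift ((p , c) ∷ ps) = let w , eq , cs = lift ps in
        (_ , p) ∷ w , cong (_ ∷_) eq , c p ∷ cs
      funs : ∀ f v → VecAll.All P v → P (A.fun f v)
      funs f v ps with lift ps
      ... | w , refl , cs = app f (values-all A w) A.refl , λ q → app f cs A.refl

    clTuple-≃ : ∀ a → [ clStructure A a , A ] clTuple a ≃ a
    clTuple-≃ a = subst (λ b → [ clStructure A a , A ] clTuple a ≃ b) (map-clGens {a} {a} (λ x → ∈-cl A))
      (map-≃ (clInclusion a) (clTuple a))

module _ {L : Language} (M : ωStructure L) where
  open ωStructure M using (Carrier; _≈_; structure)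

  raw : List Carrier → List ℕ
  raw = List.map proj₁

  raw-pointwise : ∀ {a b : List Carrier} → raw a ≡ raw b → PointwiseL _≈_ a b
  raw-pointwise {[]}    {[]}    _  = []
  raw-pointwise {x ∷ a} {y ∷ b} eq = Listₚ.∷-injectiveˡ eq ∷ raw-pointwise (Listₚ.∷-injectiveʳ eq)

  ⌜⌝-≃ : ∀ {a b} → ⌜_⌝ M a ≡ ⌜_⌝ M b → [ structure , structure ] a ≃ b
  ⌜⌝-≃ eq = pointwise-≃ (raw-pointwise (codeList-injective eq))

-- The construction of the limit

-- Turns an enumeration that hits every key into a computable choice of an entry for each key. It
-- recovers the triple `𝕀 i` from `i`, and it chooses a distinguished extension with domain `i`.
module Search {O : Oracle} {A : Set} {α : A → ℕ} (t : ℕ → Maybe A) (key : A → ℕ)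
              (hit : ∀ i → ∃[ s ] ∃[ a ] t s ≡ just a × key a ≡ i) where
  open Computability O

  Hit : ℕ × ℕ → Set
  Hit (i , s) = codeMaybe key (t s) ≡ suc i

  hit? : ∀ x → Dec (Hit x)
  hit? (i , s) = codeMaybe key (t s) ≟ suc i

  hits : ∀ i → ∃[ s ] Hit (i , s)
  hits i = let s , a , eq , key≡i = hit i in
    s , trans (cong (codeMaybe key) eq) (cong suc key≡i)

  time : ℕ → ℕ
  time i = μ (λ s → hit? (i , s)) (hits i)

  found : ∀ i → Σ[ a ∈ A ] t (time i) ≡ just a × key a ≡ i
  found i = extract (t (time i)) refl (μ-holds (λ s → hit? (i , s)) (hits i))
    where
    extract : ∀ x → t (time i) ≡ x → codeMaybe key x ≡ suc i →
              Σ[ a ∈ A ] t (time i) ≡ just a × key a ≡ i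
    extract (just a) eq refl = a , eq , refl

  pick : ℕ → A
  pick i = proj₁ (found i)

  key-pick : ∀ i → key (pick i) ≡ i
  key-pick i = proj₂ (proj₂ (found i))

  pick⊢ : α ⊢ key → id ⊢ (λ s → codeMaybe α (t s)) → id ⊢ (λ i → α (pick i))
  pick⊢ κ τ = pred⊢ (conv (λ i → cong (codeMaybe α) (proj₁ (proj₂ (found i))))
                          (time⊢ ⨾ reindex time τ))
    where
    key⊢ : id ⊢ (λ s → codeMaybe key (t s))
    key⊢ = maybe⊢ {α = α ∘ proj₂} t τ
      (conv (λ (s , eq) → sym (cong (codeMaybe key) eq)) (const⊢ 0))
      (conv (λ (s , a , eq) → sym (cong (codeMaybe key) eq))
        (suc⊢ (via (λ (s , a , _) → a) κ (snd⊢ id⊢))))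
    time⊢ : id ⊢ time
    time⊢ = μ⊢ hit? hits (≟⊢ (snd⊢ id⊢ ⨾ reindex proj₂ key⊢) (suc⊢ (fst⊢ id⊢)))

map-zip-≡ : ∀ {A B C : Set} (f : A → C) (g : B → C) (a : List A) (b : List B) → length a ≡ length b →
            (∀ {x y} → Zip a b x y → f x ≡ g y) → List.map f a ≡ List.map g b
map-zip-≡ f g []      []      eq e = refl
map-zip-≡ f g (x ∷ a) (y ∷ b) eq e = cong₂ _∷_ (e here) (map-zip-≡ f g a b (suc-injective eq) (e ∘ there))

traverse-just : ∀ {A B : Set} {f : A → Maybe B} {a b} → PointwiseL (λ x y → f x ≡ just y) a b →
                traverse f a ≡ just b
traverse-just []       = refl
traverse-just (e ∷ es) = cong₂ consMaybe e (traverse-just es)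

just-traverse : ∀ {A B : Set} {f : A → Maybe B} a {b} → traverse f a ≡ just b →
                PointwiseL (λ x y → f x ≡ just y) a b
just-traverse []      refl = []
just-traverse {f = f} (x ∷ a) eq with f x in fx | traverse f a in fa
just-traverse (x ∷ a) refl | just y | just b = fx ∷ just-traverse a fa

traverse-map : ∀ {A B C : Set} {R : A → C → Set} {f : B → Maybe C} (g : A → B) →
               (∀ x → ∃[ y ] f (g x) ≡ just y × R x y) →
               ∀ a → ∃[ b ] traverse f (List.map g a) ≡ just b × PointwiseL R a b
traverse-map g total a = let b , es , rs = go a in b , traverse-just es , rs
  where
  go : ∀ a → ∃[ b ] PointwiseL (λ x y → _ ≡ just y) (List.map g a) b × PointwiseL _ a b
  go []      = [] , [] , []
  go (x ∷ a) = let y , e , r = total x ; b , es , rs = go a in y ∷ b , e ∷ es , r ∷ rs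

split : ∀ {A B : Set} (a b : List A) (w : List B) → length w ≡ length (a ++ b) →
        ∃[ u ] ∃[ v ] w ≡ u ++ v × length u ≡ length a × length v ≡ length b
split []      b w       eq = [] , w , refl , refl , eq
split (x ∷ a) b (y ∷ w) eq =
  let u , v , w≡ , eqᵘ , eqᵛ = split a b w (suc-injective eq)
  in y ∷ u , v , cong (y ∷_) w≡ , cong suc eqᵘ , eqᵛ

finite-bound : ∀ n (f : Fin n → ℕ) → ∃[ b ] (∀ i → f i ≤ b)
finite-bound zero    f = 0 , λ ()
finite-bound (suc n) f = let b , le = finite-bound n (f ∘ Fin.suc) in
  f Fin.zero + b , λ where
    Fin.zero    → m≤m+n (f Fin.zero) b
    (Fin.suc i) → ≤-trans (le i) (m≤n+m b (f Fin.zero))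

-- Finite permutations as products of transpositions

swap : ℕ → ℕ → ℕ → ℕ
swap u v x = select (x ≟ u) v (select (x ≟ v) u x)

swap-left : ∀ u v → swap u v u ≡ v
swap-left u v = select-yes (u ≟ u) refl

swap-right : ∀ u v → swap u v v ≡ u
swap-right u v with v ≟ u
... | yes v≡u = v≡u
... | no _    = select-yes (v ≟ v) refl

swap-other : ∀ {u v x} → x ≢ u → x ≢ v → swap u v x ≡ x
swap-other {u} {v} {x} x≢u x≢v = trans (select-no (x ≟ u) x≢u) (select-no (x ≟ v) x≢v)

swap-involutive : ∀ u v x → swap u v (swap u v x) ≡ x
swap-involutive u v x = go (x ≟ u) (x ≟ v)
  where
  go : Dec (x ≡ u) → Dec (x ≡ v) → swap u v (swap u v x) ≡ x
  go (yes refl) _          = trans (cong (swap u v) (swap-left u v)) (swap-right u v)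
  go (no _)     (yes refl) = trans (cong (swap u v) (swap-right u v)) (swap-left u v)
  go (no x≢u)   (no x≢v)   = trans (cong (swap u v) (swap-other x≢u x≢v)) (swap-other x≢u x≢v)

swap-preserves : ∀ (P : ℕ → Set) {u v x} → P u → P v → P x → P (swap u v x)
swap-preserves P {u} {v} {x} pu pv px with x ≟ u | x ≟ v
... | yes _ | _     = pv
... | no _  | yes _ = pu
... | no _  | no _  = px

-- Sends a to b if the two lists have the same equalities between coordinates.
permutation : List ℕ → List ℕ → ℕ → ℕ
permutation (u ∷ a) (v ∷ b) x = swap (permutation a b u) v (permutation a b x)
permutation _       _       x = x

permutation-injective : ∀ a b {x y} → permutation a b x ≡ permutation a b y → x ≡ y
permutation-injective []      b       eq = eq
permutation-injective (u ∷ a) []      eq = eq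
permutation-injective (u ∷ a) (v ∷ b) eq = permutation-injective a b
  (trans (sym (swap-involutive _ v _)) (trans (cong (swap (permutation a b u) v) eq) (swap-involutive _ v _)))

permutation-preserves : ∀ (P : ℕ → Set) a b → (∀ {x} → x ∈ a → P x) → (∀ {x} → x ∈ b → P x) →
                        ∀ {x} → P x → P (permutation a b x)
permutation-preserves P []      b       pa pb px = px
permutation-preserves P (u ∷ a) []      pa pb px = px
permutation-preserves P (u ∷ a) (v ∷ b) pa pb px =
  swap-preserves P (rec (pa (here refl))) (pb (here refl)) (rec px)
  where
  rec : ∀ {x} → P x → P (permutation a b x)
  rec = permutation-preserves P a b (pa ∘ there) (pb ∘ there)

permutation-surjective : ∀ (P : ℕ → Set) a b → (∀ {x} → x ∈ a → P x) → (∀ {x} → x ∈ b → P x) →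
                         ∀ {y} → P y → ∃[ x ] P x × permutation a b x ≡ y
permutation-surjective P []      b       pa pb py = _ , py , refl
permutation-surjective P (u ∷ a) []      pa pb py = _ , py , refl
permutation-surjective P (u ∷ a) (v ∷ b) pa pb {y} py =
  let w = permutation a b u
      x , px , e = permutation-surjective P a b (pa ∘ there) (pb ∘ there) {swap w v y}
        (swap-preserves P (permutation-preserves P a b (pa ∘ there) (pb ∘ there) (pa (here refl)))
          (pb (here refl)) py)
  in x , px , trans (cong (swap w v) e) (swap-involutive w v y)

SameEqualities : List ℕ → List ℕ → Set
SameEqualities a b = ∀ {x y x′ y′} → Zip a b x y → Zip a b x′ y′ → x ≡ x′ ⇔ y ≡ y′

-- The last transposition exchanges `w` and `v`, and it must not disturb a value `y` obtained from
-- the tails. If `y` is `w`, injectivity gives that `x` is `u`, so `y` is `v` as well; if `y` is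
-- `v`, then `x` is `u` and hence `w` is `v`. In either case the transposition is trivial.
permutation-sends : ∀ a b → SameEqualities a b → ∀ {x y} → Zip a b x y → permutation a b x ≡ y
permutation-sends (u ∷ a) (v ∷ b) same here = swap-left (permutation a b u) v
permutation-sends (u ∷ a) (v ∷ b) same {x} {y} (there z) =
  trans (cong (swap w v) ih) (go (y ≟ w) (y ≟ v))
  where
  w = permutation a b u
  ih : permutation a b x ≡ y
  ih = permutation-sends a b (λ z z′ → same (there z) (there z′)) z
  x≢u : y ≢ v → x ≢ u
  x≢u y≢v x≡u = y≢v (Equivalence.to (same (there z) here) x≡u)
  go : Dec (y ≡ w) → Dec (y ≡ v) → swap w v y ≡ y
  go _         (yes refl) = trans (cong (swap w v) (trans (sym ih)
    (cong (permutation a b) (Equivalence.from (same (there z) here) refl)))) (swap-left w v)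
  go (yes y≡w) (no y≢v)   = contradiction (permutation-injective a b (trans ih y≡w)) (x≢u y≢v)
  go (no y≢w)  (no y≢v)   = swap-other y≢w y≢v

module Construction {L : Language} (X : Pred ℕ 0ℓ) (𝒦 : Pred (Structure L) 0ℓ) (𝕂 : Presentation L)
  (represents : Represents X 𝕂 𝒦) (ei : Presentation.EI 𝕂 ≤ᵀ X) (chp : cHP X 𝕂)
  (cjep : cJEP X 𝕂) (ccap : cCAP X 𝕂 𝒦) where

  open Language L
  open Presentation 𝕂 renaming (index to indexOf)
  open Represents represents
  open IsComputableCAPWitness (proj₂ (proj₂ ccap))
  open DistinguishedExtensions distinguished
  open Computability (χ X)

  private variable
    Γ : Set
    ε f : Γ → ℕ

  O! : Functional (χ X)
  O! = χ-functional X

  Elt : ℕ → Set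
  Elt i = Structure.Carrier (𝒜 i)

  infix 4 _⟶_
  _⟶_ : ℕ → ℕ → Set
  i ⟶ j = Embedding (𝒜 i) (𝒜 j)

  infixr 9 _$_
  _$_ : ∀ {i j} → i ⟶ j → Elt i → Elt j
  h $ x = Embedding.to h x

  codeₑ : ∀ {i j} → i ⟶ j → ℕ
  codeₑ {i} h = codeList (List.map (λ x → proj₁ (h $ x)) (gens i))

  𝕀-injective : ∀ {i j} → 𝕀 i ≡ 𝕀 j → i ≡ j
  𝕀-injective {i} {j} eq = ⟨⟩-injectiveʳ {indexOf i} {i} {indexOf j} {j}
    (⟨⟩-injectiveʳ {⟪ i , gens i ⟫} {⟨ indexOf i , i ⟩} {⟪ j , gens j ⟫} {⟨ indexOf j , j ⟩} eq)

  module _ {i j i′ j′} (F : PotEmb i j) (F′ : PotEmb i′ j′) (eq : codeEmb F ≡ codeEmb F′) where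
    private
      eqʳ : ⟨ 𝕀 j , ⟪ j , range F ⟫ ⟩ ≡ ⟨ 𝕀 j′ , ⟪ j′ , range F′ ⟫ ⟩
      eqʳ = ⟨⟩-injectiveʳ {𝕀 i} {_} {𝕀 i′} eq

    codeEmb-dom : i ≡ i′
    codeEmb-dom = 𝕀-injective (⟨⟩-injectiveˡ {𝕀 i} {⟨ 𝕀 j , ⟪ j , range F ⟫ ⟩}
                                             {𝕀 i′} {⟨ 𝕀 j′ , ⟪ j′ , range F′ ⟫ ⟩} eq)

    codeEmb-codom : j ≡ j′
    codeEmb-codom = 𝕀-injective (⟨⟩-injectiveˡ {𝕀 j} {⟪ j , range F ⟫} {𝕀 j′} {⟪ j′ , range F′ ⟫} eqʳ)

  -- Computing with the presentation

  last⊢ : ε ⊢ (λ γ → 𝕀 (f γ)) → ε ⊢ f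
  last⊢ {f = f} p = snd⊢ (unpair⊢ {f = λ γ → indexOf (f γ)} {f}
    (snd⊢ (unpair⊢ {f = λ γ → ⟪ f γ , gens (f γ) ⟫} {λ γ → ⟨ indexOf (f γ) , f γ ⟩} p)))

  tripleIndex : ∃ Triples → ℕ
  tripleIndex (_ , i , _) = i

  triple-listed : ∀ i → ∃[ s ] ∃[ t ] listed (proj₂ triples-ce) s ≡ just t × tripleIndex t ≡ i
  triple-listed i = let s , p , eq = listed-complete O! (proj₂ triples-ce) (𝕀 i) (i , refl) in
    s , _ , eq , sym (𝕀-injective (proj₂ p))

  module Triple = Search {χ X} {α = proj₁} (listed (proj₂ triples-ce)) tripleIndex triple-listed

  -- The set of triples is enumerable and contains exactly one triple ending in `i`, so it can be
  -- searched for. From here on a structure of the presentation is coded by its number alone.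
  𝕀⊢ : ε ⊢ f → ε ⊢ (λ γ → 𝕀 (f γ))
  𝕀⊢ {f = f} p = via f (conv (λ i → trans (proj₂ (proj₂ (Triple.pick i))) (cong 𝕀 (Triple.key-pick i)))
    (Triple.pick⊢ (last⊢ (conv (λ (_ , _ , eq) → eq) id⊢))
                  (listed⊢ {e = const _} {P = const Triples} (λ _ → proj₂ triples-ce) (const⊢ _) id⊢))) p

  module _ {f : Γ → ℕ} (p : ε ⊢ f) where
    private
      parts : ε ⊢ (λ γ → ⟪ f γ , gens (f γ) ⟫ ∙ ⟨ indexOf (f γ) , f γ ⟩)
      parts = unpair⊢ {f = λ γ → ⟪ f γ , gens (f γ) ⟫} {λ γ → ⟨ indexOf (f γ) , f γ ⟩} (𝕀⊢ p)

    gens⊢ : ε ⊢ (λ γ → ⟪ f γ , gens (f γ) ⟫)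
    gens⊢ = fst⊢ parts

    index⊢ : ε ⊢ (λ γ → indexOf (f γ))
    index⊢ = fst⊢ (unpair⊢ {f = λ γ → indexOf (f γ)} {f} (snd⊢ parts))

    private
      module I (γ : Γ) = IsIndexOf (isIndex (f γ))
      tail₁ : ε ⊢ (λ γ → I.dom γ ∙ ⟨ I.pos γ , ⟨ I.neg γ , I.graph γ ⟩ ⟩)
      tail₁ = unpair⊢ {f = I.dom} {λ γ → ⟨ I.pos γ , ⟨ I.neg γ , I.graph γ ⟩ ⟩}
                (conv (λ γ → I.components γ) index⊢)
      tail₂ : ε ⊢ (λ γ → I.pos γ ∙ ⟨ I.neg γ , I.graph γ ⟩)
      tail₂ = unpair⊢ {f = I.pos} {λ γ → ⟨ I.neg γ , I.graph γ ⟩} (snd⊢ tail₁)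
      tail₃ : ε ⊢ (λ γ → I.neg γ ∙ I.graph γ)
      tail₃ = unpair⊢ {f = I.neg} {I.graph} (snd⊢ tail₂)

    domIndex⊢ : ε ⊢ (λ γ → IsIndexOf.dom (isIndex (f γ)))
    domIndex⊢ = fst⊢ tail₁

    posIndex⊢ : ε ⊢ (λ γ → IsIndexOf.pos (isIndex (f γ)))
    posIndex⊢ = fst⊢ tail₂

    negIndex⊢ : ε ⊢ (λ γ → IsIndexOf.neg (isIndex (f γ)))
    negIndex⊢ = fst⊢ tail₃

    graphIndex⊢ : ε ⊢ (λ γ → IsIndexOf.graph (isIndex (f γ)))
    graphIndex⊢ = snd⊢ tail₃

  dom? : ∀ i n → Dec (ωStructure.Dom (𝒜ω i) n)
  dom? i = decide (IsIndexOf.decidesDom (isIndex i))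

  validate : ∀ i → ℕ → Maybe (Elt i)
  validate i n = certify (dom? i n)

  validate-complete : ∀ i (x : Elt i) → ∃[ y ] validate i (proj₁ x) ≡ just y × proj₁ y ≡ proj₁ x
  validate-complete i (n , p) = certify-complete (dom? i n) p

  validate⊢ : {i n : Γ → ℕ} → ε ⊢ i → ε ⊢ n → ε ⊢ (λ γ → codeMaybe proj₁ (validate (i γ) (n γ)))
  validate⊢ {i = i} {n} p q = certify⊢ {P = λ γ → ωStructure.Dom (𝒜ω (i γ))} (λ γ → dom? (i γ) (n γ)) q
    (decide⊢ (λ γ → IsIndexOf.decidesDom (isIndex (i γ))) (domIndex⊢ p) q)

  query : ℕ → ℕ → ℕ → ℕ → ℕ
  query i a j b = ⟨ 𝕀 i , ⟨ a , ⟨ 𝕀 j , b ⟩ ⟩ ⟩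

  -- The last argument of a query may be any number, since a positive answer also certifies that it
  -- codes a tuple of `𝒜 j`. This allows `apply⊢` to search through all numbers without testing
  -- membership in the domain.
  query-sound : ∀ i a j n → EI (query i ⟪ i , a ⟫ j n) →
                Σ[ c ∈ Tuple (𝒜 j) ] ⟪ j , c ⟫ ≡ n × ([ 𝒜 i , 𝒜 j ] a ≃ c)
  query-sound i a j n (i′ , b , j′ , c , eq , b≃c) =
    go (𝕀-injective (⟨⟩-injectiveˡ {𝕀 i} {⟨ ⟪ i , a ⟫ , ⟨ 𝕀 j , n ⟩ ⟩}
                                   {𝕀 i′} {⟨ ⟪ i′ , b ⟫ , ⟨ 𝕀 j′ , ⟪ j′ , c ⟫ ⟩ ⟩} eq))
       (⟨⟩-injectiveˡ {⟪ i , a ⟫} {⟨ 𝕀 j , n ⟩} {⟪ i′ , b ⟫} {⟨ 𝕀 j′ , ⟪ j′ , c ⟫ ⟩} eq₁)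
       (𝕀-injective (⟨⟩-injectiveˡ {𝕀 j} {n} {𝕀 j′} {⟪ j′ , c ⟫} eq₂))
       (⟨⟩-injectiveʳ {𝕀 j} {n} {𝕀 j′} {⟪ j′ , c ⟫} eq₂) b≃c
    where
    eq₁ : ⟨ ⟪ i , a ⟫ , ⟨ 𝕀 j , n ⟩ ⟩ ≡ ⟨ ⟪ i′ , b ⟫ , ⟨ 𝕀 j′ , ⟪ j′ , c ⟫ ⟩ ⟩
    eq₁ = ⟨⟩-injectiveʳ {𝕀 i} {_} {𝕀 i′} eq
    eq₂ : ⟨ 𝕀 j , n ⟩ ≡ ⟨ 𝕀 j′ , ⟪ j′ , c ⟫ ⟩
    eq₂ = ⟨⟩-injectiveʳ {⟪ i , a ⟫} {_} {⟪ i′ , b ⟫} eq₁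
    go : ∀ {i′ j′} {b : Tuple (𝒜 i′)} {c : Tuple (𝒜 j′)} → i ≡ i′ → ⟪ i , a ⟫ ≡ ⟪ i′ , b ⟫ → j ≡ j′ →
         n ≡ ⟪ j′ , c ⟫ → [ 𝒜 i′ , 𝒜 j′ ] b ≃ c →
         Σ[ c ∈ Tuple (𝒜 j) ] ⟪ j , c ⟫ ≡ n × ([ 𝒜 i , 𝒜 j ] a ≃ c)
    go {b = b} {c} refl a≡b refl n≡c b≃c = c , sym n≡c , ≃-trans a b c (⌜⌝-≃ (𝒜ω i) a≡b) b≃c

  query⊢ : {i a j b : Γ → ℕ} → ε ⊢ i → ε ⊢ a → ε ⊢ j → ε ⊢ b →
           ε ⊢ (λ γ → bit (decide (proj₂ ei) (query (i γ) (a γ) (j γ) (b γ))))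
  query⊢ p q r s = decide⊢ {e = const _} {P = const EI} (λ _ → proj₂ ei) (const⊢ _)
    (⟨⟩⊢ (𝕀⊢ p) (⟨⟩⊢ q (⟨⟩⊢ (𝕀⊢ r) s)))

  ≃? : ∀ i a j b → Dec ([ 𝒜 i , 𝒜 j ] a ≃ b)
  ≃? i a j b = map′
    (λ q → let c , eq , a≃c = query-sound i a j _ q in ≃-trans a c b a≃c (⌜⌝-≃ (𝒜ω j) eq))
    (λ a≃b → i , a , j , b , refl , a≃b)
    (decide (proj₂ ei) (query i ⟪ i , a ⟫ j ⟪ j , b ⟫))

  ≃?⊢ : {i j : Γ → ℕ} (a : ∀ γ → Tuple (𝒜 (i γ))) (b : ∀ γ → Tuple (𝒜 (j γ))) →
        ε ⊢ i → ε ⊢ (λ γ → ⟪ i γ , a γ ⟫) → ε ⊢ j → ε ⊢ (λ γ → ⟪ j γ , b γ ⟫) →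
        ε ⊢ (λ γ → bit (≃? (i γ) (a γ) (j γ) (b γ)))
  ≃?⊢ a b p q r s = conv (λ γ → bit-map′ (decide (proj₂ ei) _)) (query⊢ p q r s)

  -- If a generates, then h x is the only y for which y ∷ h a has the atomic
  -- type of x ∷ a.
  apply⊢ : {i j : Γ → ℕ} (h : ∀ γ → i γ ⟶ j γ) (x : ∀ γ → Elt (i γ)) →
           ε ⊢ i → ε ⊢ j → ε ⊢ (λ γ → codeₑ (h γ)) → ε ⊢ (λ γ → proj₁ (x γ)) →
           ε ⊢ (λ γ → proj₁ (h γ $ x γ))
  apply⊢ {Γ} {ε} {i} {j} h x p q r s = conv (λ γ → value γ _ (μ-holds (λ n → P? (γ , n)) (holds γ)))
    (μ⊢ P? holds (query⊢ (weaken p)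
      (∷⊢ (weaken s) (gens⊢ (weaken p))) (weaken q) (∷⊢ (snd⊢ id⊢) (weaken r))))
    where
    P : Γ × ℕ → Set
    P (γ , n) = EI (query (i γ) ⟪ i γ , x γ ∷ gens (i γ) ⟫ (j γ)
                          (codeList (n ∷ List.map (λ y → proj₁ (h γ $ y)) (gens (i γ)))))
    P? : ∀ γ → Dec (P γ)
    P? (γ , n) = decide (proj₂ ei) _
    images : ∀ γ → Tuple (𝒜 (j γ))
    images γ = List.map (h γ $_) (gens (i γ))
    raw-images : ∀ γ → raw (𝒜ω (j γ)) (images γ) ≡ List.map (λ y → proj₁ (h γ $ y)) (gens (i γ))
    raw-images γ = sym (Listₚ.map-∘ (gens (i γ)))
    holds : ∀ γ → ∃[ n ] P (γ , n)
    holds γ = proj₁ (h γ $ x γ) , i γ , x γ ∷ gens (i γ) , j γ , (h γ $ x γ) ∷ images γ ,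
      cong (λ b → query (i γ) ⟪ i γ , x γ ∷ gens (i γ) ⟫ (j γ) (codeList (proj₁ (h γ $ x γ) ∷ b)))
           (sym (raw-images γ)) ,
      map-≃ (h γ) (x γ ∷ gens (i γ))
    value : ∀ γ n → P (γ , n) → n ≡ proj₁ (h γ $ x γ)
    value γ n holds with query-sound (i γ) (x γ ∷ gens (i γ)) (j γ) _ holds
    ... | [] , () , _
    ... | y ∷ c , eq , a≃c = trans (sym (Listₚ.∷-injectiveˡ eq′))
      (partialIso-extend (≃⇒partialIso (x γ ∷ gens (i γ)) (y ∷ c) a≃c) (generates (i γ))
        (suc-injective (proj₁ a≃c)) there (h γ) sends here)
      where
      eq′ : proj₁ y ∷ raw (𝒜ω (j γ)) c ≡ n ∷ List.map (λ y → proj₁ (h γ $ y)) (gens (i γ))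
      eq′ = codeList-injective eq
      sends : ∀ {u v} → Zip (gens (i γ)) c u v → proj₁ (h γ $ u) ≡ proj₁ v
      sends {u} z with zip-compose (gens (i γ)) (images γ) c (sym (Listₚ.length-map _ (gens (i γ)))) z
      ... | w , z₁ , z₂ = trans (cong proj₁ (sym (zip-map (h γ $_) (gens (i γ)) z₁)))
        (zip-pointwise (raw-pointwise (𝒜ω (j γ)) (trans (raw-images γ) (sym (Listₚ.∷-injectiveʳ eq′)))) z₂)

  -- One-step extensions from joint embedding, distinguished extensions and amalgamation

  record Ext (i : ℕ) : Set where
    constructor ext
    field
      {tip} : ℕ
      arrow    : i ⟶ tip
  open Ext

  codeExt : ∀ {i} → Ext i → ℕ
  codeExt e = tip e ∙ codeₑ (arrow e)

  infixl 5 _▷_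
  _▷_ : ∀ {i} (e : Ext i) → Ext (tip e) → Ext i
  e ▷ e′ = ext (arrow e′ ∘ₑ arrow e)

  ▷⊢ : {i : Γ → ℕ} (e : ∀ γ → Ext (i γ)) (e′ : ∀ γ → Ext (tip (e γ))) →
       ε ⊢ i → ε ⊢ (λ γ → codeExt (e γ)) → ε ⊢ (λ γ → codeExt (e′ γ)) →
       ε ⊢ (λ γ → codeExt (e γ ▷ e′ γ))
  ▷⊢ {Γ} {ε} {i} e e′ p q r = fst⊢ r ,⊢
    map⊢ {α = α} (λ γ → gens (i γ)) (snd⊢ q)
      (apply⊢ (λ (γ , _) → arrow (e′ γ)) (λ (γ , x) → arrow (e γ) $ x)
        (weaken (fst⊢ q)) (weaken (fst⊢ r))
        (weaken (snd⊢ r)) (snd⊢ {f = λ (γ , _) → ε γ} id⊢))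
    where
    α : (Σ Γ λ γ → Elt (i γ)) → ℕ
    α (γ , x) = proj₁ (arrow (e γ) $ x)

  codeₑ-encoded : ∀ {i j} (F : PotEmb i j) (F-emb : IsEmb F) → codeₑ (encoded F F-emb) ≡ ⟪ j , range F ⟫
  codeₑ-encoded {i} {j} F F-emb = cong codeList (map-zip-≡ _ _ (gens i) (range F) (proj₁ F-emb)
    (extendₑ-sends (range F) (generates i) F-emb))

  module _ {i j : Γ → ℕ} (F : ∀ γ → PotEmb (i γ) (j γ)) (p : ε ⊢ (λ γ → codeEmb (F γ))) where
    private
      parts : ε ⊢ (λ γ → 𝕀 (j γ) ∙ ⟪ j γ , range (F γ) ⟫)
      parts = unpair⊢ {f = λ γ → 𝕀 (j γ)} {λ γ → ⟪ j γ , range (F γ) ⟫}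
        (snd⊢ (unpair⊢ {f = λ γ → 𝕀 (i γ)} {λ γ → ⟨ 𝕀 (j γ) , ⟪ j γ , range (F γ) ⟫ ⟩} p))

    dom⊢ : ε ⊢ i
    dom⊢ = last⊢ (fst⊢ (unpair⊢ {f = λ γ → 𝕀 (i γ)} {λ γ → ⟨ 𝕀 (j γ) , ⟪ j γ , range (F γ) ⟫ ⟩} p))

    codom⊢ : ε ⊢ j
    codom⊢ = last⊢ (fst⊢ parts)

    encoded⊢ : (F-emb : ∀ γ → IsEmb (F γ)) → ε ⊢ (λ γ → codeExt (ext (encoded (F γ) (F-emb γ))))
    encoded⊢ F-emb = codom⊢ ,⊢ conv (λ γ → sym (codeₑ-encoded (F γ) (F-emb γ))) (snd⊢ parts)

  codeEmb⊢ : {i j : Γ → ℕ} (F : ∀ γ → PotEmb (i γ) (j γ)) → ε ⊢ i → ε ⊢ j →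
             ε ⊢ (λ γ → ⟪ j γ , range (F γ) ⟫) → ε ⊢ (λ γ → codeEmb (F γ))
  codeEmb⊢ F p q r = ⟨⟩⊢ (𝕀⊢ p) (⟨⟩⊢ (𝕀⊢ q) r)

  module _ (i ℓ : ℕ) where
    private
      witness = proj₂ cjep i ℓ
      k  = proj₁ witness
      F₀ = proj₁ (proj₂ witness)
      F₁ = proj₁ (proj₂ (proj₂ witness))
      φF = proj₁ (proj₂ (proj₂ (proj₂ witness)))
      f₀ = proj₁ (proj₂ (proj₂ (proj₂ (proj₂ witness))))
      f₁ = proj₂ (proj₂ (proj₂ (proj₂ (proj₂ witness))))

    jepRange : PotEmb i k
    jepRange = F₀

    jepRange-isEmb : IsEmb jepRange
    jepRange-isEmb = f₀

    jepCode : ℕ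
    jepCode = codeEmb F₁

    jep-φ : φ (χ X) (proj₁ cjep) ⟨ 𝕀 i , 𝕀 ℓ ⟩ ⟨ codeEmb jepRange , jepCode ⟩
    jep-φ = φF

    opaque
      jepExt : Ext i
      jepExt = ext (encoded F₀ f₀)

      jepEmbedding : ℓ ⟶ tip jepExt
      jepEmbedding = encoded F₁ f₁

  opaque
    unfolding jepExt
    jepExt⊢ : {i ℓ : Γ → ℕ} → ε ⊢ i → ε ⊢ ℓ → ε ⊢ (λ γ → codeExt (jepExt (i γ) (ℓ γ)))
    jepExt⊢ {i = i} {ℓ} p q = encoded⊢ (λ γ → jepRange (i γ) (ℓ γ))
      (fst⊢ (unpair⊢ {f = λ γ → codeEmb (jepRange (i γ) (ℓ γ))} {λ γ → jepCode (i γ) (ℓ γ)}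
        (φ⊢ (const⊢ _) (⟨⟩⊢ (𝕀⊢ p) (𝕀⊢ q)) (λ γ → jep-φ (i γ) (ℓ γ)))))
      (λ γ → jepRange-isEmb (i γ) (ℓ γ))

  AB : Pred ℕ 0ℓ
  AB = proj₁ ccap

  module _ (d : ∃ AB) where
    private
      witness = embeddings (proj₁ d) (proj₂ d)

    domᵈ codomᵈ : ℕ
    domᵈ   = proj₁ witness
    codomᵈ = proj₁ (proj₂ witness)

    embᵈ : PotEmb domᵈ codomᵈ
    embᵈ = proj₁ (proj₂ (proj₂ witness))

    codeᵈ : proj₁ d ≡ codeEmb embᵈ
    codeᵈ = proj₁ (proj₂ (proj₂ (proj₂ witness)))

    isEmbᵈ : IsEmb embᵈ
    isEmbᵈ = proj₂ (proj₂ (proj₂ (proj₂ witness)))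

    isABᵈ : AB (codeEmb embᵈ)
    isABᵈ = subst AB codeᵈ (proj₂ d)

  listAB : ℕ → Maybe (∃ AB)
  listAB = listed (proj₂ AB-ce)

  listAB⊢ : {s : Γ → ℕ} → ε ⊢ s → ε ⊢ (λ γ → codeMaybe proj₁ (listAB (s γ)))
  listAB⊢ p = listed⊢ {e = const _} {P = const AB} (λ _ → proj₂ AB-ce) (const⊢ _) p

  embᵈ⊢ : (d : Γ → ∃ AB) → ε ⊢ (λ γ → proj₁ (d γ)) → ε ⊢ (λ γ → codeEmb (embᵈ (d γ)))
  embᵈ⊢ d = conv (λ γ → codeᵈ (d γ))

  AB-listed : ∀ i → ∃[ s ] ∃[ d ] listAB s ≡ just d × domᵈ d ≡ i
  AB-listed i = let j , F , ab = total i ; s , p , eq = listed-complete O! (proj₂ AB-ce) (codeEmb F) ab in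
    s , (_ , p) , eq , sym (codeEmb-dom F (embᵈ (_ , p)) (codeᵈ (_ , p)))

  module ABSearch = Search {χ X} {α = proj₁} listAB domᵈ AB-listed

  Distinguished : ℕ → Set
  Distinguished j = ∃[ i ] Σ[ F ∈ PotEmb i j ] AB (codeEmb F)

  extᵈ : (d : ∃ AB) → Ext (domᵈ d)
  extᵈ d = ext (encoded (embᵈ d) (isEmbᵈ d))

  codeExt-subst : ∀ {i j} (eq : i ≡ j) (e : Ext i) → codeExt (subst Ext eq e) ≡ codeExt e
  codeExt-subst refl e = refl

  distinguished-subst : ∀ {i j} (eq : i ≡ j) (e : Ext i) → Distinguished (tip e) →
                        Distinguished (tip (subst Ext eq e))
  distinguished-subst refl e p = p

  opaque
    abExt : ∀ i → Ext i
    abExt i = subst Ext (ABSearch.key-pick i) (extᵈ (ABSearch.pick i))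

    abExt-distinguished : ∀ i → Distinguished (tip (abExt i))
    abExt-distinguished i = distinguished-subst (ABSearch.key-pick i) (extᵈ (ABSearch.pick i))
      (domᵈ d , embᵈ d , isABᵈ d)
      where
      d : ∃ AB
      d = ABSearch.pick i

    abExt⊢ : {i : Γ → ℕ} → ε ⊢ i → ε ⊢ (λ γ → codeExt (abExt (i γ)))
    abExt⊢ {i = i} p = conv (λ γ → sym (codeExt-subst (ABSearch.key-pick (i γ)) _))
      (encoded⊢ (λ γ → embᵈ (ABSearch.pick (i γ)))
        (embᵈ⊢ (λ γ → ABSearch.pick (i γ))
          (via i (ABSearch.pick⊢ (dom⊢ embᵈ (embᵈ⊢ id id⊢)) (listAB⊢ id⊢)) p))
        (λ γ → isEmbᵈ (ABSearch.pick (i γ))))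

  record Task (k : ℕ) : Set where
    constructor task
    field
      base   : ∃ AB
      left   : Tuple (𝒜 k)
      {node} : ℕ
      right  : Tuple (𝒜 node)

  module _ {k : ℕ} (t : Task k) where
    open Task t
    private
      G₀ : PotEmb (codomᵈ base) k
      G₀ = potEmb left
      G₁ : PotEmb (codomᵈ base) node
      G₁ = potEmb right
      witness = amalgamates (embᵈ base) G₀ G₁ (isABᵈ base)
      H₀ = proj₁ (proj₂ witness)
      H₁ = proj₁ (proj₂ (proj₂ witness))
      φH = proj₁ (proj₂ (proj₂ (proj₂ witness)))
      diagram = proj₂ (proj₂ (proj₂ (proj₂ witness)))

    capInput : ℕ
    capInput = ⟨ codeEmb (embᵈ base) , ⟨ codeEmb G₀ , codeEmb G₁ ⟩ ⟩

    capRange : PotEmb k (proj₁ witness)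
    capRange = H₀

    capRange-isEmb : IsEmb capRange
    capRange-isEmb = proj₁ diagram

    capCode : ℕ
    capCode = codeEmb H₁

    cap-φ : φ (χ X) (proj₁ (proj₂ ccap)) capInput ⟨ codeEmb capRange , capCode ⟩
    cap-φ = φH

    opaque
      capExt : Ext k
      capExt = ext (encoded capRange capRange-isEmb)

      capExt-amalgamates : [ 𝒜 (codomᵈ base) , 𝒜 k ] gens (codomᵈ base) ≃ left →
        [ 𝒜 (codomᵈ base) , 𝒜 node ] gens (codomᵈ base) ≃ right →
        Σ[ h ∈ node ⟶ tip capExt ]
          (∀ {x y} → Zip left right x y → proj₁ (arrow capExt $ x) ≡ proj₁ (h $ y))
      capExt-amalgamates g₀ g₁ with proj₂ diagram g₀ g₁
      ... | h₁ , commutes = encoded H₁ h₁ , λ z →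
        let u , z₀ , z₁ = zip-compose left (gens (codomᵈ base)) right (sym (proj₁ g₀)) z in
        trans (sym (Embedding.cong (arrow capExt) (extendₑ-sends left (generates _) g₀ (zip-sym z₀))))
          (trans (commutes u)
            (Embedding.cong (encoded H₁ h₁) (extendₑ-sends right (generates _) g₁ z₁)))

  opaque
    unfolding capExt
    capExt⊢ : {k : Γ → ℕ} (t : ∀ γ → Task (k γ)) → ε ⊢ k →
              ε ⊢ (λ γ → proj₁ (Task.base (t γ))) → ε ⊢ (λ γ → ⟪ k γ , Task.left (t γ) ⟫) →
              ε ⊢ (λ γ → Task.node (t γ)) → ε ⊢ (λ γ → ⟪ Task.node (t γ) , Task.right (t γ) ⟫) →
              ε ⊢ (λ γ → codeExt (capExt (t γ)))
    capExt⊢ {ε = ε} t p q r s u = encoded⊢ (λ γ → capRange (t γ))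
      (fst⊢ (unpair⊢ {f = λ γ → codeEmb (capRange (t γ))} {λ γ → capCode (t γ)}
        (φ⊢ (const⊢ _)
          (⟨⟩⊢ base⊢ (⟨⟩⊢ (codeEmb⊢ (λ γ → potEmb (Task.left (t γ))) (codom⊢ _ base⊢) p r)
                          (codeEmb⊢ (λ γ → potEmb (Task.right (t γ))) (codom⊢ _ base⊢) s u)))
          (λ γ → cap-φ (t γ)))))
      (λ γ → capRange-isEmb (t γ))
      where
      base⊢ : ε ⊢ (λ γ → codeEmb (embᵈ (Task.base (t γ))))
      base⊢ = embᵈ⊢ (λ γ → Task.base (t γ)) q

  -- The chain of stages

  listOf : ℕ → List ℕ
  listOf n = proj₁ (decodeList n)

  listOf-codeList : ∀ a → listOf (codeList a) ≡ a
  listOf-codeList a = codeList-injective (proj₂ (decodeList (codeList a)))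

  listOf⊢ : {n : Γ → ℕ} → ε ⊢ n → ε ⊢ (λ γ → codeList (List.map id (listOf (n γ))))
  listOf⊢ {n = n} p = map-id⊢ {l = λ γ → listOf (n γ)} (conv (λ γ → sym (proj₂ (decodeList (n γ)))) p)

  capStep : ∀ {k m} → Maybe (∃ AB) → Maybe (Tuple (𝒜 k)) → Maybe (Tuple (𝒜 m)) → Ext k
  capStep (just d) (just a) (just b) = capExt (task d a b)
  capStep (just d) (just a) nothing  = ext idₑ
  capStep (just d) nothing  _        = ext idₑ
  capStep nothing  _        _        = ext idₑ

  capStep⊢ : {k m : Γ → ℕ} (d : Γ → Maybe (∃ AB))
    (a : ∀ γ → Maybe (Tuple (𝒜 (k γ)))) (b : ∀ γ → Maybe (Tuple (𝒜 (m γ)))) →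
    ε ⊢ k → ε ⊢ m → ε ⊢ (λ γ → codeMaybe proj₁ (d γ)) →
    ε ⊢ (λ γ → codeMaybe (⟪_,_⟫ (k γ)) (a γ)) → ε ⊢ (λ γ → codeMaybe (⟪_,_⟫ (m γ)) (b γ)) →
    ε ⊢ (λ γ → codeExt (capStep (d γ) (a γ) (b γ)))
  capStep⊢ {Γ} {k = k} {m} d a b p q r s t =
    elim⊢ {α = λ (_ , d) → proj₁ d} (λ γ d → codeExt (capStep d (a γ) (b γ))) d r stay
      (elim⊢ {α = λ ((γ , _) , a) → ⟪ k γ , a ⟫} (λ (γ , d) a → codeExt (capStep (just d) a (b γ)))
        (λ (γ , _) → a γ) (weaken s) (weaken stay)
        (elim⊢ {α = λ (((γ , _) , _) , b) → ⟪ m γ , b ⟫}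
          (λ ((γ , d) , a) b → codeExt (capStep (just d) (just a) b)) (λ ((γ , _) , _) → b γ)
          (weaken (weaken t))
          (weaken (weaken stay))
          (capExt⊢ (λ (((γ , d) , a) , b) → task d a b)
            (weaken (weaken (weaken p)))
            (snd⊢ (fst⊢ (fst⊢ id⊢))) (snd⊢ (fst⊢ id⊢))
            (weaken (weaken (weaken q))) (snd⊢ id⊢))))
    where
    stay = p ,⊢ gens⊢ p

  -- `at n` is the current image of the element named `n`. The state carries these images forward,
  -- so earlier embeddings of the chain need not be remembered.
  record Stage : Set where
    constructor stageAt
    field
      level : ℕ
      at    : ℕ → Maybe (Elt level)
  open Stage

  module _ (s : ℕ) (st : Stage) where

    -- s = ⟨ q , ⟨ b , ⟨ m , c ⟩ ⟩ ⟩ asks to amalgamate the copy of the codomain of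
    -- the q-th distinguished extension named by b with its copy c in 𝒜 m.
    step₁ : Ext (level st)
    step₁ = capStep (listAB (π₁ s)) (traverse (at st) (listOf (π₁ (π₂ s))))
              (traverse (validate (π₁ (π₂ (π₂ s)))) (listOf (π₂ (π₂ (π₂ s)))))

    step₂ : Ext (tip step₁)
    step₂ = jepExt (tip step₁) s

    step₃ : Ext (tip step₂)
    step₃ = abExt (tip step₂)

    opaque
      next : Ext (level st)
      next = step₁ ▷ step₂ ▷ step₃

  opaque
    unfolding next
    next⊢ : (s : Γ → ℕ) (st : Γ → Stage) → ε ⊢ s → ε ⊢ (λ γ → level (st γ)) →
            ε ▹ proj₂ ⊢ (λ (γ , n) → codeMaybe proj₁ (at (st γ) n)) →
            ε ⊢ (λ γ → codeExt (next (s γ) (st γ)))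
    next⊢ {Γ} {ε} s st p q r = ▷⊢ (λ γ → step₁ (s γ) (st γ) ▷ step₂ (s γ) (st γ)) (λ γ → step₃ (s γ) (st γ))
      q step₁₂⊢ (abExt⊢ (fst⊢ step₂⊢))
      where
      m⊢ : ε ⊢ (λ γ → π₁ (π₂ (π₂ (s γ))))
      m⊢ = π₁⊢ (π₂⊢ (π₂⊢ p))
      step₁⊢ : ε ⊢ (λ γ → codeExt (step₁ (s γ) (st γ)))
      step₁⊢ = capStep⊢ _ _ _ q m⊢ (listAB⊢ (π₁⊢ p))
        (traverse⊢ {α = proj₂} {β = proj₁ ∘ proj₂} (λ γ → at (st γ)) (λ γ → listOf (π₁ (π₂ (s γ))))
          (listOf⊢ (π₁⊢ (π₂⊢ p))) r)
        (traverse⊢ {α = proj₂} {β = proj₁ ∘ proj₂} (λ γ → validate (π₁ (π₂ (π₂ (s γ)))))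
          (λ γ → listOf (π₂ (π₂ (π₂ (s γ))))) (listOf⊢ (π₂⊢ (π₂⊢ (π₂⊢ p))))
          (validate⊢ (weaken m⊢) (snd⊢ id⊢)))
      step₂⊢ : ε ⊢ (λ γ → codeExt (step₂ (s γ) (st γ)))
      step₂⊢ = jepExt⊢ (fst⊢ step₁⊢) p
      step₁₂⊢ : ε ⊢ (λ γ → codeExt (step₁ (s γ) (st γ) ▷ step₂ (s γ) (st γ)))
      step₁₂⊢ = ▷⊢ (λ γ → step₁ (s γ) (st γ)) (λ γ → step₂ (s γ) (st γ)) q step₁⊢ step₂⊢

  -- The name `⟨ s , y ⟩` comes into existence at stage `s`, provided that `y` belongs to the
  -- structure there; every other name keeps the image computed before.
  enter : ∀ s k → ℕ → Maybe (Elt k) → Maybe (Elt k)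
  enter s k n old = select (π₁ n ≟ s) (validate k (π₂ n)) old

  enter⊢ : {s k n : Γ → ℕ} (old : ∀ γ → Maybe (Elt (k γ))) → ε ⊢ s → ε ⊢ k → ε ⊢ n →
           ε ⊢ (λ γ → codeMaybe proj₁ (old γ)) →
           ε ⊢ (λ γ → codeMaybe proj₁ (enter (s γ) (k γ) (n γ) (old γ)))
  enter⊢ {s = s} {k} {n} old p q r t =
    dec⊢ (λ γ d → codeMaybe proj₁ (select d (validate (k γ) (π₂ (n γ))) (old γ))) (λ γ → π₁ (n γ) ≟ s γ)
      (≟⊢ (π₁⊢ r) p) (reindex proj₁ (validate⊢ q (π₂⊢ r))) (reindex proj₁ t)

  successor : ℕ → Stage → Stage
  successor s st = stageAt (tip e) λ n → enter (suc s) (tip e) n (Maybe.map (arrow e $_) (at st n))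
    where e = next s st

  opaque
    stage : ℕ → Stage
    stage zero    = stageAt 0 λ n → enter 0 0 n nothing
    stage (suc s) = successor s (stage s)

  codeStage : ℕ × ℕ → ℕ
  codeStage (s , n) = level (stage s) ∙ codeMaybe proj₁ (at (stage s) n)

  opaque
    unfolding stage
    -- A stage contains a function on ω, so what is computed is its level together with the image of
    -- one name. Stage `suc s` needs the previous stage not only at `n` but also at the names
    -- occurring in the task, hence the recursion by `fix⊢` rather than `rec⊢`.
    stage⊢ : (λ ((s , n) : ℕ × ℕ) → s ∙ n) ⊢ codeStage
    stage⊢ = fix⊢ proj₁ (case⊢ (fst⊢ (snd⊢ id⊢))
      (conv (λ { (mkCall (_ , n) _ _ , refl) → refl })
        (const⊢ 0 ,⊢ enter⊢ (λ _ → nothing) (const⊢ 0) (const⊢ 0) (snd⊢ (snd⊢ id⊢)) (const⊢ 0)))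
      (conv (λ { (mkCall (_ , n) _ _ , s , refl) → refl })
        (via prev step (fst⊢ (fst⊢ id⊢) ,⊢ snd⊢ id⊢ ,⊢ snd⊢ (snd⊢ (fst⊢ id⊢))))))
      where
      C : Set
      C = Call proj₁ (λ ((s , n) : ℕ × ℕ) → s ∙ n) codeStage
      Prev : Set
      Prev = Σ[ s ∈ ℕ ] ℕ × Σ[ e ∈ ℕ ] (∀ m → φ (χ X) e (s ∙ m) (codeStage (s , m)))
      prev : (Σ C λ x → ∃[ s ] proj₁ (Call.arg x) ≡ suc s) → Prev
      prev (c , s , eq) = s , proj₂ (Call.arg c) , Call.self c ,
        λ m → Call.calls c (s , m) (subst (s <_) (sym eq) ≤-refl)
      η : Prev → ℕ
      η (s , n , e , _) = e ∙ s ∙ n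
      call : η ▹ proj₂ ⊢ (λ ((s , _) , m) → codeStage (s , m))
      call = φ⊢ (fst⊢ (fst⊢ id⊢)) (fst⊢ (snd⊢ (fst⊢ id⊢)) ,⊢ snd⊢ id⊢) (λ ((s , n , e , calls) , m) → calls m)
      here⊢ : {m : Prev → ℕ} → η ⊢ m → η ⊢ (λ x → codeStage (proj₁ x , m x))
      here⊢ {m} p = via (λ x → x , m x) call (id⊢ ,⊢ p)
      n⊢ : η ⊢ (λ x → proj₁ (proj₂ x))
      n⊢ = snd⊢ (snd⊢ id⊢)
      s⊢ : η ⊢ proj₁
      s⊢ = fst⊢ (snd⊢ id⊢)
      ext⊢ : η ⊢ (λ (s , _) → codeExt (next s (stage s)))
      ext⊢ = next⊢ proj₁ (λ (s , _) → stage s) s⊢ (fst⊢ (here⊢ n⊢)) (snd⊢ call)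
      step : η ⊢ (λ (s , n , _) → codeStage (suc s , n))
      step = fst⊢ ext⊢ ,⊢ enter⊢ _ (suc⊢ s⊢) (fst⊢ ext⊢) n⊢
        (elim⊢ {α = λ ((s , n , _) , x) → proj₁ x}
          (λ (s , n , _) x → codeMaybe proj₁ (Maybe.map (arrow (next s (stage s)) $_) x))
          (λ (s , n , _) → at (stage s) n) (snd⊢ (here⊢ n⊢)) (const⊢ 0)
          (suc⊢ (apply⊢ (λ ((s , _) , _) → arrow (next s (stage s))) proj₂
            (weaken (fst⊢ (here⊢ n⊢))) (weaken (fst⊢ ext⊢))
            (weaken (snd⊢ ext⊢)) (snd⊢ id⊢))))

  -- The chain of embeddings and the names of elements

  𝕜 : ℕ → ℕ
  𝕜 s = level (stage s)

  level⊢ : {s : Γ → ℕ} → ε ⊢ s → ε ⊢ (λ γ → 𝕜 (s γ))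
  level⊢ {s = s} p = fst⊢ (via (λ γ → s γ , 0) stage⊢ (p ,⊢ const⊢ 0))

  at⊢ : {s n : Γ → ℕ} → ε ⊢ s → ε ⊢ n → ε ⊢ (λ γ → codeMaybe proj₁ (at (stage (s γ)) (n γ)))
  at⊢ {s = s} {n} p q = snd⊢ (via (λ γ → s γ , n γ) stage⊢ (p ,⊢ q))

  opaque
    unfolding stage

    arr : ∀ T → 𝕜 T ⟶ 𝕜 (suc T)
    arr T = arrow (next T (stage T))

    at-zero : ∀ n → at (stage 0) n ≡ enter 0 (𝕜 0) n nothing
    at-zero n = refl

    at-suc-enter : ∀ T n → at (stage (suc T)) n ≡
                   enter (suc T) (𝕜 (suc T)) n (Maybe.map (arr T $_) (at (stage T) n))
    at-suc-enter T n = refl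

  up : ∀ {T T′} → T ≤′ T′ → 𝕜 T ⟶ 𝕜 T′
  up ≤′-refl       = idₑ
  up (≤′-step T≤S) = arr _ ∘ₑ up T≤S

  -- At T n x : n = ⟨ t , y ⟩ with t ≤ T and y ∈ 𝒜 (𝕜 t), and the chain sends y
  -- to the element x of 𝒜 (𝕜 T).
  record At (T n : ℕ) (x : Elt (𝕜 T)) : Set where
    constructor isAt
    field
      {value} : Elt (𝕜 T)
      defined : at (stage T) n ≡ just value
      equal   : proj₁ value ≡ proj₁ x

  enter-now : ∀ s k n old → π₁ n ≡ s → enter s k n old ≡ validate k (π₂ n)
  enter-now s k n old = select-yes (π₁ n ≟ s)

  enter-before : ∀ s k n old → π₁ n ≢ s → enter s k n old ≡ old
  enter-before s k n old = select-no (π₁ n ≟ s)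

  map-just : ∀ {A B : Set} {f : A → B} o {b} → Maybe.map f o ≡ just b → ∃[ a ] o ≡ just a
  map-just (just a) _ = a , refl

  at-earlier : ∀ T n {x} → π₁ n ≢ suc T → at (stage (suc T)) n ≡ just x → ∃[ y ] at (stage T) n ≡ just y
  at-earlier T n ne eq = map-just _ (trans (sym (enter-before (suc T) _ n _ ne))
    (trans (sym (at-suc-enter T n)) eq))

  at-level : ∀ T n {x} → at (stage T) n ≡ just x → π₁ n ≤ T
  at-level T n eq with π₁ n ≟ T
  at-level T n eq       | yes n≡T = ≤-reflexive n≡T
  at-level zero n eq    | no ne
    with () ← trans (sym eq) (trans (at-zero n) (enter-before 0 _ n nothing ne))
  at-level (suc T) n eq | no ne = m≤n⇒m≤1+n (at-level T n (proj₂ (at-earlier T n ne eq)))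

  at-suc : ∀ T n {x} → at (stage T) n ≡ just x → at (stage (suc T)) n ≡ just (arr T $ x)
  at-suc T n eq = trans (at-suc-enter T n)
    (trans (enter-before (suc T) _ n _ (<⇒≢ (s≤s (at-level T n eq)))) (cong (Maybe.map (arr T $_)) eq))

  at-up : ∀ {T T′} (T≤T′ : T ≤′ T′) {n x} → at (stage T) n ≡ just x → at (stage T′) n ≡ just (up T≤T′ $ x)
  at-up ≤′-refl       eq = eq
  at-up (≤′-step {S} T≤S) {n} eq = at-suc S n (at-up T≤S eq)

  at-down : ∀ T n {x} → at (stage T) n ≡ just x → ∃[ y ] at (stage (π₁ n)) n ≡ just y
  at-down T n {x} eq with π₁ n ≟ T
  at-down T n {x} eq | yes refl = x , eq
  at-down zero n eq  | no ne
    with () ← trans (sym eq) (trans (at-zero n) (enter-before 0 _ n nothing ne))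
  at-down (suc T) n eq | no ne = at-down T n (proj₂ (at-earlier T n ne eq))

  at-new : ∀ T (x : Elt (𝕜 T)) → At T ⟨ T , proj₁ x ⟩ x
  at-new T x =
    let y , eq , y≡x = validate-complete (𝕜 T) x in
    isAt (trans (entered T) (trans (cong (validate (𝕜 T)) (π₂-⟨⟩ T (proj₁ x))) eq)) y≡x
    where
    entered : ∀ S → at (stage S) ⟨ S , proj₁ x ⟩ ≡ validate (𝕜 S) (π₂ ⟨ S , proj₁ x ⟩)
    entered zero    = trans (at-zero ⟨ 0 , proj₁ x ⟩) (enter-now 0 _ ⟨ 0 , proj₁ x ⟩ _ (π₁-⟨⟩ 0 (proj₁ x)))
    entered (suc S) = trans (at-suc-enter S ⟨ suc S , proj₁ x ⟩)
      (enter-now (suc S) _ ⟨ suc S , proj₁ x ⟩ _ (π₁-⟨⟩ (suc S) (proj₁ x)))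

  At-resp : ∀ {T n x y} → proj₁ x ≡ proj₁ y → At T n x → At T n y
  At-resp e (isAt eq e′) = isAt eq (trans e′ e)

  At-functional : ∀ {T n x y} → At T n x → At T n y → proj₁ x ≡ proj₁ y
  At-functional (isAt eq e) (isAt eq′ e′) with trans (sym eq) eq′
  ... | refl = trans (sym e) e′

  At-up : ∀ {T T′} (T≤T′ : T ≤′ T′) {n x} → At T n x → At T′ n (up T≤T′ $ x)
  At-up T≤T′ (isAt eq e) = isAt (at-up T≤T′ eq) (Embedding.cong (up T≤T′) e)

  At-transfer : ∀ {T T′ m n x y x′ y′} → At T m x → At T n y → At T′ m x′ → At T′ n y′ →
                proj₁ x ≡ proj₁ y → proj₁ x′ ≡ proj₁ y′
  At-transfer {T} {T′} {x = x} {y} {x′} {y′} p q p′ q′ e = Embedding.injective v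
    (trans (At-functional (At-up T′≤ p′) (At-up T≤ p))
      (trans (Embedding.cong u e) (At-functional (At-up T≤ q) (At-up T′≤ q′))))
    where
    T≤ : T ≤′ T + T′
    T≤ = ≤⇒≤′ (m≤m+n T T′)
    T′≤ : T′ ≤′ T + T′
    T′≤ = ≤⇒≤′ (m≤n+m T′ T)
    u : 𝕜 T ⟶ 𝕜 (T + T′)
    u = up T≤
    v : 𝕜 T′ ⟶ 𝕜 (T + T′)
    v = up T′≤

  valueAt : ℕ → ℕ → ℕ
  valueAt T n = codeMaybe proj₁ (at (stage T) n)

  At-value : ∀ {T n x} → At T n x → valueAt T n ≡ suc (proj₁ x)
  At-value (isAt eq e) = trans (cong (codeMaybe proj₁) eq) (cong suc e)

  value-At : ∀ T n x → valueAt T n ≡ suc (proj₁ x) → At T n x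
  value-At T n x eq = go (at (stage T) n) refl eq
    where
    go : ∀ o → at (stage T) n ≡ o → codeMaybe proj₁ o ≡ suc (proj₁ x) → At T n x
    go (just y) eq e = isAt eq (suc-injective e)

  -- Stage `n` is late enough to compare `n` with all smaller numbers, since a name `m` has entered
  -- the chain by stage `m`. The search for the least name therefore takes place in one stage, and
  -- it ends at `n` at the latest.
  Rep : ℕ × ℕ → Set
  Rep (n , m) = valueAt n m ≡ valueAt n n

  rep? : ∀ x → Dec (Rep x)
  rep? (n , m) = valueAt n m ≟ valueAt n n

  opaque
    rep : ℕ → ℕ
    rep n = μ (λ m → rep? (n , m)) (n , refl)

    rep⊢ : {n : Γ → ℕ} → ε ⊢ n → ε ⊢ (λ γ → rep (n γ))
    rep⊢ {n = n} p = via n (μ⊢ rep? (λ n → n , refl)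
      (≟⊢ (at⊢ (fst⊢ id⊢) (snd⊢ id⊢)) (at⊢ (fst⊢ id⊢) (fst⊢ id⊢)))) p

    rep-holds : ∀ n → Rep (n , rep n)
    rep-holds n = μ-holds (λ m → rep? (n , m)) (n , refl)

    rep-minimal : ∀ n m → Rep (n , m) → rep n ≤ m
    rep-minimal n m r = ≮⇒≥ λ m<rep →
      Least.minimal (proj₂ (least (λ m → rep? (n , m)) (n , refl))) m m<rep r

  infix 4 _~_
  -- A partial equivalence relation: `n ~ n` says that `n` is the name of an element at all.
  _~_ : ℕ → ℕ → Set
  m ~ n = ∃[ T ] ∃[ x ] At T m x × At T n x

  ~-sym : ∀ {m n} → m ~ n → n ~ m
  ~-sym (T , x , p , q) = T , x , q , p

  ~-trans : ∀ {l m n} → l ~ m → m ~ n → l ~ n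
  ~-trans (T , x , p , q) (S , y , r , s) = T + S , up S≤ $ y ,
    At-resp (At-functional (At-up T≤ q) (At-up S≤ r)) (At-up T≤ p) , At-up S≤ s
    where
    T≤ : T ≤′ T + S
    T≤ = ≤⇒≤′ (m≤m+n T S)
    S≤ : S ≤′ T + S
    S≤ = ≤⇒≤′ (m≤n+m S T)

  ~-At : ∀ {m n T x y} → m ~ n → At T m x → At T n y → proj₁ x ≡ proj₁ y
  ~-At (S , z , p , q) p′ q′ = At-transfer p q p′ q′ refl

  At-self : ∀ T n {x} → At T n x → ∃[ y ] At n n y
  At-self T n (isAt eq _) =
    let y , eq′ = at-down T n eq
        π₁n≤n = ≤⇒≤′ (subst (π₁ n ≤_) (⟨π₁,π₂⟩ n) (x≤⟨x,y⟩ (π₁ n) (π₂ n)))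
    in up π₁n≤n $ y , isAt (at-up π₁n≤n eq′) refl

  -- A name has an image from its own stage on, and that stage is at most the name itself, so both
  -- images exist at `T`. Since the maps of the chain are injective, an identification seen at any
  -- stage already holds there.
  ~-At-below : ∀ {m n T} → m ~ n → m ≤ T → n ≤ T → ∃[ x ] At T m x × At T n x
  ~-At-below {m} {n} {T} m~n@(S , z , p , q) m≤T n≤T =
    let x , p′ = At-self S m p ; y , q′ = At-self S n q
        p″ = At-up (≤⇒≤′ m≤T) p′ ; q″ = At-up (≤⇒≤′ n≤T) q′
    in up (≤⇒≤′ m≤T) $ x , p″ , At-resp (sym (~-At m~n p″ q″)) q″

  ~⇒Rep : ∀ {m n} → m ~ n → m ≤ n → Rep (n , m)
  ~⇒Rep m~n m≤n = let x , p , q = ~-At-below m~n m≤n ≤-refl in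
    trans (At-value p) (sym (At-value q))

  rep-~ : ∀ {n} → n ~ n → rep n ~ n
  rep-~ {n} n~n = let x , p , _ = ~-At-below n~n ≤-refl ≤-refl in
    n , x , value-At n (rep n) x (trans (rep-holds n) (At-value p)) , p

  rep-≤ : ∀ {m n} → m ~ n → rep n ≤ m
  rep-≤ {m} {n} m~n with ≤-total m n
  ... | inj₁ m≤n = rep-minimal n m (~⇒Rep m~n m≤n)
  ... | inj₂ n≤m = ≤-trans (rep-minimal n n refl) n≤m

  rep-unique : ∀ {m n} → m ~ n → rep m ≡ rep n
  rep-unique m~n = ≤-antisym (rep-≤ (~-trans (rep-~ (~-trans (~-sym m~n) m~n)) (~-sym m~n)))
                             (rep-≤ (~-trans (rep-~ (~-trans m~n (~-sym m~n))) m~n))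

  DomM : ℕ → Set
  DomM n = n ~ n × rep n ≡ n

  rep-DomM : ∀ {n} → n ~ n → DomM (rep n)
  rep-DomM n~n = ~-trans (rep-~ n~n) (~-sym (rep-~ n~n)) , rep-unique (rep-~ n~n)

  named? : ∀ n → Dec (n ~ n)
  named? n = go (at (stage n) n) refl
    where
    go : ∀ o → at (stage n) n ≡ o → Dec (n ~ n)
    go (just x) eq = yes (n , x , isAt eq refl , isAt eq refl)
    go nothing  eq = no λ n~n → let x , isAt eq′ _ , _ = ~-At-below n~n ≤-refl ≤-refl in
      nothing≢just (trans (sym eq) eq′)

  named?⊢ : {n : Γ → ℕ} → ε ⊢ n → ε ⊢ (λ γ → bit (named? (n γ)))
  named?⊢ {n = n} p = via n (maybe⊢ {α = λ (n , x) → proj₁ x} (λ n → at (stage n) n) (at⊢ id⊢ id⊢)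
    (conv (λ (n , eq) → sym (bit-no {a? = named? n} λ n~n →
      let x , isAt eq′ _ , _ = ~-At-below n~n ≤-refl ≤-refl in nothing≢just (trans (sym eq) eq′))) (const⊢ 1))
    (conv (λ (n , x , eq) → sym (bit-yes {a? = named? n} (n , x , isAt eq refl , isAt eq refl)))
      (const⊢ 0))) p

  domM? : ∀ n → Dec (DomM n)
  domM? n with named? n | rep n ≟ n
  ... | yes p | yes q = yes (p , q)
  ... | no ¬p | _     = no (¬p ∘ proj₁)
  ... | yes _ | no ¬q = no (¬q ∘ proj₂)

  domM?⊢ : {n : Γ → ℕ} → ε ⊢ n → ε ⊢ (λ γ → bit (domM? (n γ)))
  domM?⊢ {n = n} p = via n (bit-if⊢ named? (named?⊢ id⊢) (λ _ → proj₁)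
    (conv (λ (n , n~n) → bit-cong {a? = rep n ≟ n} {domM? n} (n~n ,_) proj₂)
      (reindex proj₁ (≟⊢ (rep⊢ id⊢) id⊢)))) p

  ∣M∣ : Set
  ∣M∣ = ∃ DomM

  M-≡ : ∀ (c d : ∣M∣) → proj₁ c ~ proj₁ d → proj₁ c ≡ proj₁ d
  M-≡ (_ , _ , c-rep) (_ , _ , d-rep) c~d = trans (sym c-rep) (trans (rep-unique c~d) d-rep)

  -- Unlike At, this allows n to enter the chain only after stage T: the least
  -- name of an element of 𝒜 (𝕜 T) may belong to a later structure.
  record Names (T n : ℕ) (x : Elt (𝕜 T)) : Set where
    constructor names
    field same : n ~ ⟨ T , proj₁ x ⟩
  open Names using (same)

  At⇒Names : ∀ {T n x} → At T n x → Names T n x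
  At⇒Names {T} {n} {x} p = names (T , x , p , at-new T x)

  Names-resp : ∀ {T n x y} → proj₁ x ≡ proj₁ y → Names T n x → Names T n y
  Names-resp {T} {n} e (names p) = names (subst (λ v → n ~ ⟨ T , v ⟩) e p)

  Names-up : ∀ {T T′} (T≤T′ : T ≤′ T′) {n x} → Names T n x → Names T′ n (up T≤T′ $ x)
  Names-up {T} {T′} T≤T′ {n} {x} (names p) =
    names (~-trans p (T′ , up T≤T′ $ x , At-up T≤T′ (at-new T x) , at-new T′ (up T≤T′ $ x)))

  Names-functional : ∀ {T n x y} → Names T n x → Names T n y → proj₁ x ≡ proj₁ y
  Names-functional {T} {n} {x} {y} (names p) (names q) =
    ~-At (~-trans (~-sym p) q) (at-new T x) (at-new T y)

  Names-injective : ∀ (c d : ∣M∣) {T x y} → Names T (proj₁ c) x → Names T (proj₁ d) y →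
                    proj₁ x ≡ proj₁ y → proj₁ c ≡ proj₁ d
  Names-injective c d {x = x} {y} p q e =
    M-≡ c d (~-trans (same (Names-resp {x = x} {y} e p)) (~-sym (same q)))

  opaque
    At-total : ∀ (c : ∣M∣) {T} → proj₁ c ≤ T → ∃[ x ] At T (proj₁ c) x
    At-total (n , n~n , _) n≤T = let x , p , _ = ~-At-below n~n n≤T n≤T in x , p

    name : ∀ T → Elt (𝕜 T) → ∣M∣
    name T x = rep ⟨ T , proj₁ x ⟩ , rep-DomM (T , x , at-new T x , at-new T x)

    name-rep : ∀ T x → proj₁ (name T x) ≡ rep ⟨ T , proj₁ x ⟩
    name-rep T x = refl

    name-Names : ∀ T x → Names T (proj₁ (name T x)) x
    name-Names T x = names (rep-~ (T , x , at-new T x , at-new T x))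

  -- The limit structure

  module 𝒜 (T : ℕ) = Structure (𝒜 (𝕜 T))

  NamesV : ∀ {k} T → Vec ∣M∣ k → Vec (Elt (𝕜 T)) k → Set
  NamesV T = Pointwise (λ c x → Names T (proj₁ c) x)

  pullV : ∀ {k} (v : Vec ∣M∣ k) → ∃[ T ] ∃[ w ] NamesV T v w
  namesV-up : ∀ {k T T′} (T≤T′ : T ≤′ T′) {v : Vec ∣M∣ k} {w} → NamesV T v w →
              NamesV T′ v (Vec.map (up T≤T′ $_) w)
  namesV-up T≤T′ []       = []
  namesV-up T≤T′ (p ∷ ps) = Names-up T≤T′ p ∷ namesV-up T≤T′ ps

  pullV []      = 0 , [] , []
  pullV (c ∷ v) =
    let T , w , ps = pullV v ; x , p = At-total c {proj₁ c + T} (m≤m+n _ T) in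
    proj₁ c + T , x ∷ _ , At⇒Names p ∷ namesV-up (≤⇒≤′ (m≤n+m T (proj₁ c))) ps

  namesV-functional : ∀ {k T} {v v′ : Vec ∣M∣ k} {w w′ : Vec (Elt (𝕜 T)) k} →
                      Pointwise (λ c d → proj₁ c ≡ proj₁ d) v v′ → NamesV T v w → NamesV T v′ w′ →
                      Pointwise (λ x y → proj₁ x ≡ proj₁ y) w w′
  namesV-functional []         []       []       = []
  namesV-functional (refl ∷ es) (p ∷ ps) (q ∷ qs) = Names-functional p q ∷ namesV-functional es ps qs

  namesV-name : ∀ {k} T (w : Vec (Elt (𝕜 T)) k) → NamesV T (Vec.map (name T) w) w
  namesV-name T []      = []
  namesV-name T (x ∷ w) = name-Names T x ∷ namesV-name T w

  namesV-transfer : ∀ {k T T′} {v v′ : Vec ∣M∣ k} {w w′} → Pointwise (λ c d → proj₁ c ≡ proj₁ d) v v′ →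
                    NamesV T v w → NamesV T′ v′ w′ →
                    Σ[ p ∈ T ≤′ T + T′ ] Σ[ q ∈ T′ ≤′ T + T′ ]
                    Pointwise (λ x y → proj₁ x ≡ proj₁ y) (Vec.map (up p $_) w) (Vec.map (up q $_) w′)
  namesV-transfer {T = T} {T′} es ps qs =
    let p = ≤⇒≤′ (m≤m+n T T′) ; q = ≤⇒≤′ (m≤n+m T′ T) in
    p , q , namesV-functional es (namesV-up p ps) (namesV-up q qs)

  RelM : (r : RelSym) → Vec ∣M∣ (arityᴿ r) → Set
  RelM r v = ∃[ T ] ∃[ w ] NamesV T v w × 𝒜.Rel T r w

  -- Both stages are compared inside stage `S + T`. Because the maps of the chain reflect relations
  -- as well as preserve them, truth at one stage passes to every stage that names the arguments.
  RelM⇒ : ∀ r {v v′} → Pointwise (λ c d → proj₁ c ≡ proj₁ d) v v′ → RelM r v →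
          ∀ {T w} → NamesV T v′ w → 𝒜.Rel T r w
  RelM⇒ r es (S , u , qs , Ru) {T} {w} ps =
    let p , q , es′ = namesV-transfer es qs ps in
    Equivalence.from (Embedding.preservesRel (up q) r w)
      (𝒜.Rel-resp (S + T) r es′ (Equivalence.to (Embedding.preservesRel (up p) r u) Ru))

  opaque
    funM : (f : FunSym) → Vec ∣M∣ (arityᶠ f) → ∣M∣
    funM f v = let T , w , _ = pullV v in name T (𝒜.fun T f w)

    funM-Names : ∀ f v {v′ T w} → Pointwise (λ c d → proj₁ c ≡ proj₁ d) v v′ → NamesV T v′ w →
                 Names T (proj₁ (funM f v)) (𝒜.fun T f w)
    funM-Names f v {T = T} {w} es ps =
      let S , u , qs = pullV v
          p , q , es′ = namesV-transfer es qs ps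
          c = name S (𝒜.fun S f u) ; d = name T (𝒜.fun T f w)
          e = trans (Embedding.preservesFun (up p) f u)
                (trans (𝒜.fun-cong (S + T) f es′) (sym (Embedding.preservesFun (up q) f w)))
      in subst (λ n → Names T n (𝒜.fun T f w))
           (sym (Names-injective c d (Names-up p (name-Names S _)) (Names-up q (name-Names T _)) e))
           (name-Names T (𝒜.fun T f w))

  Mω : ωStructure L
  Mω = record
    { Dom   = DomM
    ; onDom = record
      { Rel      = RelM
      ; fun      = funM
      ; Rel-resp = λ r es Rv → let T , w , ps = pullV _ in T , w , ps , RelM⇒ r es Rv ps
      ; fun-cong = λ f {v} {w} es → let T , u , ps = pullV w in
          Names-injective (funM f v) (funM f w)
            (funM-Names f v es ps) (funM-Names f w (PW.refl refl) ps) refl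
      }
    }

  M : Structure L
  M = ωStructure.structure Mω

  nameₑ : ∀ T → Embedding (𝒜 (𝕜 T)) M
  nameₑ T = record
    { injection = record
      { to        = name T
      ; cong      = λ {x} {y} e → Names-injective (name T x) (name T y) (name-Names T x) (name-Names T y) e
      ; injective = λ {x} {y} e → Names-functional (name-Names T x)
                      (subst (λ n → Names T n y) (sym e) (name-Names T y))
      }
    ; preserves = record
      { preservesRel = λ r w → mk⇔ (λ Rw → T , w , namesV-name T w , Rw)
                                    (λ Rv → RelM⇒ r (PW.refl refl) Rv (namesV-name T w))
      ; preservesFun = λ f w → Names-injective (name T (𝒜.fun T f w)) (funM f (Vec.map (name T) w))
          (name-Names T (𝒜.fun T f w))
          (funM-Names f (Vec.map (name T) w) (PW.refl refl) (namesV-name T w)) refl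
      }
    }

  opaque
    unfolding stage next arr

    level-distinguished : ∀ T → Distinguished (𝕜 (suc T))
    level-distinguished T = abExt-distinguished (tip (step₂ T (stage T)))

    level-embeds : ∀ ℓ → ℓ ⟶ 𝕜 (suc ℓ)
    level-embeds ℓ = arrow (step₃ ℓ (stage ℓ)) ∘ₑ jepEmbedding (tip (step₁ ℓ (stage ℓ))) ℓ

    level-amalgamates : ∀ s {q k m n} →
      π₁ s ≡ q → listOf (π₁ (π₂ s)) ≡ k → π₁ (π₂ (π₂ s)) ≡ m → listOf (π₂ (π₂ (π₂ s))) ≡ n →
      ∀ {d a} {c : Tuple (𝒜 m)} →
      listAB q ≡ just d → traverse (at (stage s)) k ≡ just a → traverse (validate m) n ≡ just c →
      [ 𝒜 (codomᵈ d) , 𝒜 (𝕜 s) ] gens (codomᵈ d) ≃ a → [ 𝒜 (codomᵈ d) , 𝒜 m ] gens (codomᵈ d) ≃ c →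
      Σ[ h ∈ m ⟶ 𝕜 (suc s) ] (∀ {x y} → Zip a c x y → proj₁ (arr s $ x) ≡ proj₁ (h $ y))
    level-amalgamates s {m = m} refl refl refl refl {d} {a} {c} eq₁ eq₂ eq₃ g₀ g₁ =
      later ∘ₑ proj₁ merged , λ z → Embedding.cong later (proj₂ merged z)
      where
      later : tip (step₁ s (stage s)) ⟶ 𝕜 (suc s)
      later = arrow (step₃ s (stage s)) ∘ₑ arrow (step₂ s (stage s))
      Merges : Ext (𝕜 s) → Set
      Merges e = Σ[ h ∈ m ⟶ tip e ] (∀ {x y} → Zip a c x y → proj₁ (arrow e $ x) ≡ proj₁ (h $ y))
      merged : Merges (step₁ s (stage s))
      merged = go eq₁ eq₂ eq₃
        where
        go : ∀ {x y z} → x ≡ just d → y ≡ just a → z ≡ just c → Merges (capStep x y z)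
        go refl refl refl = capExt-amalgamates (task d a c) g₀ g₁

  -- The extension property of the limit

  names⇒≡ : ∀ (c : ∣M∣) {T x} → Names T (proj₁ c) x → proj₁ (name T x) ≡ proj₁ c
  names⇒≡ c {T} {x} p = Names-injective (name T x) c (name-Names T x) p refl

  name-arr : ∀ T x → proj₁ (name (suc T) (arr T $ x)) ≡ proj₁ (name T x)
  name-arr T x = names⇒≡ (name T x) (Names-up (≤′-step ≤′-refl) (name-Names T x))

  bounded : ∀ (a : Tuple M) {T} → ⌜_⌝ Mω a ≤ T → ∀ {c} → c ∈ a → proj₁ c ≤ T
  bounded a a≤T c∈a = ≤-trans (∈⇒≤codeList (∈ₚ.∈-map⁺ proj₁ c∈a)) a≤T

  pull : ∀ (a : Tuple M) {T} → ⌜_⌝ Mω a ≤ T →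
         ∃[ b ] traverse (at (stage T)) (raw Mω a) ≡ just b × PointwiseL (λ c x → At T (proj₁ c) x) a b
  pull a {T} a≤T = let b , es , ps = go a (bounded a a≤T) in b , traverse-just es , ps
    where
    go : ∀ a → (∀ {c} → c ∈ a → proj₁ c ≤ T) →
         ∃[ b ] PointwiseL (λ n x → at (stage T) n ≡ just x) (raw Mω a) b ×
                PointwiseL (λ c x → At T (proj₁ c) x) a b
    go []      le = [] , [] , []
    go (c ∷ a) le =
      let _ , isAt {y} eq _ = At-total c (le (here refl))
          b , es , ps = go a (le ∘ there)
      in y ∷ b , eq ∷ es , isAt eq refl ∷ ps

  named-≃ : ∀ {T a b} → PointwiseL (λ c x → At T (proj₁ c) x) a b → [ 𝒜 (𝕜 T) , M ] b ≃ a
  named-≃ {T} {a} {b} ps = partialIso⇒≃ b a (sym (PWL.Pointwise-length ps))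
    (partialIso-⊆ (λ {x} {y} z → names⇒≡ y (At⇒Names (zip-pointwise ps (zip-sym z))))
      (embedding-partialIso (nameₑ T)))

  levelGens : ℕ → Tuple M
  levelGens T = List.map (name T) (gens (𝕜 T))

  levelGens-≃ : ∀ T → [ 𝒜 (𝕜 T) , M ] gens (𝕜 T) ≃ levelGens T
  levelGens-≃ T = map-≃ (nameₑ T) (gens (𝕜 T))

  levelGens-cl : ∀ T (c : ∣M∣) → proj₁ c ≤ T → Cl M (levelGens T) c
  levelGens-cl T c c≤T = let x , p = At-total c c≤T in
    cl-resp M {levelGens T} {name T x} {c} (names⇒≡ c (At⇒Names p))
      (map-cl (nameₑ T) {gens (𝕜 T)} {x} (generates (𝕜 T) x))

  -- The data are coded as a task `s`. Since `s` bounds the code of `b`, every entry of `b` has an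
  -- image at stage `s`, where the task is carried out; stage `suc s` then receives a copy of `𝒜 m`
  -- in which `c` lies over `b`.
  extension-property : ∀ {l m} → Distinguished l → (b : Tuple M) (c : Tuple (𝒜 m)) →
    [ 𝒜 l , M ] gens l ≃ b → [ 𝒜 l , 𝒜 m ] gens l ≃ c →
    Σ[ h ∈ Embedding (𝒜 m) M ] (∀ {x y} → Zip c b x y → proj₁ (Embedding.to h x) ≡ proj₁ y)
  extension-property {l} {m} (_ , F , ab) b c l≃b l≃c = nameₑ (suc s) ∘ₑ h , λ {x} {y} z →
    let u , z₁ , z₀ = zip-compose c c₁ b (PWL.Pointwise-length c≈c₁) z
        v , z₂ , z₃ = zip-compose c₁ b₁ b
          (trans (sym (PWL.Pointwise-length c≈c₁)) (trans (sym (proj₁ l≃c))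
            (trans (proj₁ l≃b) (PWL.Pointwise-length b-names)))) z₀
    in trans (Embedding.cong (nameₑ (suc s)) {x = h $ x} {y = arr s $ v}
          (trans (Embedding.cong h {x = x} {y = u} (zip-pointwise c≈c₁ z₁)) (sym (h-merges (zip-sym z₂)))))
        (trans (name-arr s v) (names⇒≡ y (At⇒Names (zip-pointwise b-names (zip-sym z₃)))))
    where
    found = listed-complete O! (proj₂ AB-ce) (codeEmb F) ab
    q : ℕ
    q = proj₁ found
    d : ∃ AB
    d = codeEmb F , proj₁ (proj₂ found)
    l≡ : l ≡ codomᵈ d
    l≡ = codeEmb-codom F (embᵈ d) (codeᵈ d)
    rest s : ℕ
    rest = ⟨ m , ⟪ m , c ⟫ ⟩
    s = ⟨ q , ⟨ ⌜_⌝ Mω b , rest ⟩ ⟩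
    eq₂ : π₂ s ≡ ⟨ ⌜_⌝ Mω b , rest ⟩
    eq₂ = π₂-⟨⟩ q ⟨ ⌜_⌝ Mω b , rest ⟩
    eq₃ : π₂ (π₂ s) ≡ rest
    eq₃ = trans (cong π₂ eq₂) (π₂-⟨⟩ (⌜_⌝ Mω b) rest)
    b-eq : listOf (π₁ (π₂ s)) ≡ raw Mω b
    b-eq = trans (cong (listOf ∘ π₁) eq₂)
      (trans (cong listOf (π₁-⟨⟩ (⌜_⌝ Mω b) rest)) (listOf-codeList (raw Mω b)))
    c-eq : listOf (π₂ (π₂ (π₂ s))) ≡ raw (𝒜ω m) c
    c-eq = trans (cong (listOf ∘ π₂) eq₃)
      (trans (cong listOf (π₂-⟨⟩ m ⟪ m , c ⟫)) (listOf-codeList (raw (𝒜ω m) c)))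
    b-pulled = pull b (≤-trans (x≤⟨x,y⟩ (⌜_⌝ Mω b) rest) (y≤⟨x,y⟩ q ⟨ ⌜_⌝ Mω b , rest ⟩))
    b₁ : Tuple (𝒜 (𝕜 s))
    b₁ = proj₁ b-pulled
    b-names : PointwiseL (λ c x → At s (proj₁ c) x) b b₁
    b-names = proj₂ (proj₂ b-pulled)
    -- Decoding yields the numbers of `c` with possibly different proofs of membership in the
    -- domain, so `c₁` agrees with `c` only up to `_≈_`. The tuple `b₁` is related to `b` through
    -- names in the same spirit.
    c-validated = traverse-map {R = λ x y → proj₁ x ≡ proj₁ y} {f = validate m} proj₁
      (λ x → let y , eq , e = validate-complete m x in y , eq , sym e) c
    c₁ : Tuple (𝒜 m)
    c₁ = proj₁ c-validated
    c≈c₁ : PointwiseL (λ x y → proj₁ x ≡ proj₁ y) c c₁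
    c≈c₁ = proj₂ (proj₂ c-validated)
    l≃b₁ : [ 𝒜 l , 𝒜 (𝕜 s) ] gens l ≃ b₁
    l≃b₁ = ≃-trans (gens l) b b₁ l≃b (≃-sym b₁ b (named-≃ b-names))
    l≃c₁ : [ 𝒜 l , 𝒜 m ] gens l ≃ c₁
    l≃c₁ = ≃-trans (gens l) c c₁ l≃c (pointwise-≃ c≈c₁)
    merged : Σ[ h ∈ m ⟶ 𝕜 (suc s) ] (∀ {x y} → Zip b₁ c₁ x y → proj₁ (arr s $ x) ≡ proj₁ (h $ y))
    merged = level-amalgamates s (π₁-⟨⟩ q ⟨ ⌜_⌝ Mω b , rest ⟩) b-eq
      (trans (cong π₁ eq₃) (π₁-⟨⟩ m ⟪ m , c ⟫)) c-eq
      (proj₂ (proj₂ found)) (proj₁ (proj₂ b-pulled)) (proj₁ (proj₂ c-validated))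
      (subst (λ l → [ 𝒜 l , 𝒜 (𝕜 s) ] gens l ≃ b₁) l≡ l≃b₁) (subst (λ l → [ 𝒜 l , 𝒜 m ] gens l ≃ c₁) l≡ l≃c₁)
    h : m ⟶ 𝕜 (suc s)
    h = proj₁ merged
    h-merges : ∀ {x y} → Zip b₁ c₁ x y → proj₁ (arr s $ x) ≡ proj₁ (h $ y)
    h-merges = proj₂ merged

  -- The cofinal collection

  E : Pred ℕ 0ℓ
  E n = ∃[ a ] n ≡ ⌜_⌝ Mω a × ∃[ l ] Distinguished l × ([ 𝒜 l , M ] gens l ≃ a)

  E-base : ∀ a → E (⌜_⌝ Mω a) → ∃[ l ] Distinguished l × ([ 𝒜 l , M ] gens l ≃ a)
  E-base a (b , eq , l , dist , l≃b) = l , dist , ≃-trans (gens l) b a l≃b (⌜⌝-≃ Mω (sym eq))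

  levelGens-E : ∀ T → E (⌜_⌝ Mω (levelGens (suc T)))
  levelGens-E T = levelGens (suc T) , refl , 𝕜 (suc T) , level-distinguished T , levelGens-≃ (suc T)

  E-closed : ∀ a b → E (⌜_⌝ Mω a) → [ M , M ] a ≃ b → E (⌜_⌝ Mω b)
  E-closed a b Ea a≃b = let l , dist , l≃a = E-base a Ea in
    b , refl , l , dist , ≃-trans (gens l) a b l≃a a≃b

  hereditary : ∀ a → ∃[ l ] ([ 𝒜 l , M ] gens l ≃ a)
  hereditary a =
    let b , _ , ps = pull a ≤-refl
        l , _ , l≃b = proj₂ chp (𝕜 (⌜_⌝ Mω a)) b
    in l , ≃-trans (gens l) b a l≃b (named-≃ ps)

  -- By (cHP) some `𝒜 l′` is generated by a copy `u ++ v` of `a ++ b`. As `a` lies in the closure of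
  -- `b`, the part `v` alone generates, so sending the generators of `𝒜 l` to `v` is an isomorphism,
  -- and composing the distinguished extension with it gives one into `𝒜 l′`.
  E-extension : ∀ a b → E (⌜_⌝ Mω b) → (∀ c → c ∈ a → Cl M b c) → E (⌜_⌝ Mω (a ++ b))
  E-extension a b Eb a⊆cl =
    let l , (i , F , ab) , l≃b = E-base b Eb
        l′ , l′≃ab = hereditary (a ++ b)
        u , v , gens≡ , u-len , v-len = split a b (gens l′) (proj₁ l′≃ab)
        p = partialIso-⊆ (λ {x} {y} → subst (λ w → Zip w (a ++ b) x y) (sym gens≡))
              (≃⇒partialIso (gens l′) (a ++ b) l′≃ab)
        v≃b = partialIso⇒≃ v b v-len (partialIso-⊆ (zip-++ʳ u a u-len) p)
        l≃v = ≃-trans (gens l) b v l≃b (≃-sym v b v≃b)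
        v-gen : Generates (𝒜 l′) v
        v-gen x = cl-trans (𝒜 l′) {gens l′} {v}
          (λ y y∈gens → in-cl u v u-len v-len p y (subst (y ∈_) gens≡ y∈gens)) (generates l′ x)
    in a ++ b , refl , l′ ,
       (i , _ , postcomp F (potEmb v) (l≃v , extendₑ-onto {a = gens l} {v} (generates l) l≃v v-gen) ab) ,
       l′≃ab
    where
    in-cl : ∀ {l′} (u v : Tuple (𝒜 l′)) → length u ≡ length a → length v ≡ length b →
            PartialIso (𝒜 l′) M (Zip (u ++ v) (a ++ b)) → ∀ y → y ∈ u ++ v → Cl (𝒜 l′) v y
    in-cl {l′} u v u-len v-len p y y∈ with ∈ₚ.∈-++⁻ u y∈
    ... | inj₂ y∈v = ∈-cl (𝒜 l′) y∈v
    ... | inj₁ y∈u = let c , z = ∈-zip u-len y∈u in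
      partialIso-cl (partialIso-sym p) b v (sym v-len) (zip-++ʳ u a u-len ∘ zip-sym)
        (zip-++ˡ z) (a⊆cl c (zip-∈ˡ (zip-sym z)))

  E-cofinal : CofinalCollection Mω E
  E-cofinal = record
    { tuples    = λ n (a , eq , _) → a , eq
    -- A successor stage is taken because stage 0 does not arise from a distinguished extension.
    ; cofinal   = λ a → let T = ⌜_⌝ Mω a in levelGens (suc T) , levelGens-E T ,
        All.tabulate λ {c} c∈a → levelGens-cl (suc T) c (m≤n⇒m≤1+n (bounded a ≤-refl c∈a))
    ; extension = λ a b Eb a⊆b → E-extension a b Eb λ c → All.lookup a⊆b
    ; ≃-closed  = E-closed
    }

  ⌜_⌝ᴹ : Tuple M → ℕ
  ⌜_⌝ᴹ = ⌜_⌝ Mω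

  pulled : ∀ T (a : Tuple M) → ⌜ a ⌝ᴹ ≤ T → Tuple (𝒜 (𝕜 T))
  pulled T a le = proj₁ (pull a le)

  pulled-≃ : ∀ T a (le : ⌜ a ⌝ᴹ ≤ T) → [ 𝒜 (𝕜 T) , M ] pulled T a le ≃ a
  pulled-≃ T a le = named-≃ (proj₂ (proj₂ (pull a le)))

  pulled⊢ : {T : Γ → ℕ} (a : Γ → Tuple M) (le : ∀ γ → ⌜ a γ ⌝ᴹ ≤ T γ) → ε ⊢ T → ε ⊢ (λ γ → ⌜ a γ ⌝ᴹ) →
            ε ⊢ (λ γ → ⟪ 𝕜 (T γ) , pulled (T γ) (a γ) (le γ) ⟫)
  pulled⊢ {T = T} a le p q = pred⊢ (conv (λ γ → cong (codeMaybe _) (proj₁ (proj₂ (pull (a γ) (le γ)))))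
    (traverse⊢ {α = proj₂} {β = proj₁ ∘ proj₂} (λ γ → at (stage (T γ))) (λ γ → raw Mω (a γ)) (map-id⊢ q)
      (at⊢ (weaken p) (snd⊢ id⊢))))

  opaque
    -- The tuple is pulled back to the stage numbered by its own code, where all its entries have
    -- images and the embedding information decides the question. For two tuples of M, `≃ᴹ?` uses a
    -- stage that bounds both codes.
    gens-≃? : ∀ l a → Dec ([ 𝒜 l , M ] gens l ≃ a)
    gens-≃? l a = map′
      (λ p → ≃-trans (gens l) (pulled ⌜ a ⌝ᴹ a ≤-refl) a p (pulled-≃ ⌜ a ⌝ᴹ a ≤-refl))
      (λ p → ≃-trans (gens l) a (pulled ⌜ a ⌝ᴹ a ≤-refl) p
               (≃-sym (pulled ⌜ a ⌝ᴹ a ≤-refl) a (pulled-≃ ⌜ a ⌝ᴹ a ≤-refl)))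
      (≃? l (gens l) (𝕜 ⌜ a ⌝ᴹ) (pulled ⌜ a ⌝ᴹ a ≤-refl))

    gens-≃?⊢ : {l : Γ → ℕ} (a : Γ → Tuple M) → ε ⊢ l → ε ⊢ (λ γ → ⌜ a γ ⌝ᴹ) →
               ε ⊢ (λ γ → bit (gens-≃? (l γ) (a γ)))
    gens-≃?⊢ {l = l} a p q = conv
      (λ γ → bit-map′ (≃? (l γ) (gens (l γ)) (𝕜 ⌜ a γ ⌝ᴹ) (pulled ⌜ a γ ⌝ᴹ (a γ) ≤-refl)))
      (≃?⊢ (λ γ → gens (l γ)) (λ γ → pulled ⌜ a γ ⌝ᴹ (a γ) ≤-refl)
        p (gens⊢ p) (level⊢ q) (pulled⊢ a (λ _ → ≤-refl) q q))

  module _ (a b : Tuple M) where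
    common : ℕ
    common = ⟨ ⌜ a ⌝ᴹ , ⌜ b ⌝ᴹ ⟩

    commonˡ : Tuple (𝒜 (𝕜 common))
    commonˡ = pulled common a (x≤⟨x,y⟩ ⌜ a ⌝ᴹ ⌜ b ⌝ᴹ)

    commonʳ : Tuple (𝒜 (𝕜 common))
    commonʳ = pulled common b (y≤⟨x,y⟩ ⌜ a ⌝ᴹ ⌜ b ⌝ᴹ)

    commonˡ-≃ : [ 𝒜 (𝕜 common) , M ] commonˡ ≃ a
    commonˡ-≃ = pulled-≃ common a (x≤⟨x,y⟩ ⌜ a ⌝ᴹ ⌜ b ⌝ᴹ)

    commonʳ-≃ : [ 𝒜 (𝕜 common) , M ] commonʳ ≃ b
    commonʳ-≃ = pulled-≃ common b (y≤⟨x,y⟩ ⌜ a ⌝ᴹ ⌜ b ⌝ᴹ)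

  opaque
    ≃ᴹ? : ∀ a b → Dec ([ M , M ] a ≃ b)
    ≃ᴹ? a b = map′
      (λ p → ≃-trans a (commonˡ a b) b (≃-sym (commonˡ a b) a (commonˡ-≃ a b))
               (≃-trans (commonˡ a b) (commonʳ a b) b p (commonʳ-≃ a b)))
      (λ p → ≃-trans (commonˡ a b) a (commonʳ a b) (commonˡ-≃ a b)
               (≃-trans a b (commonʳ a b) p (≃-sym (commonʳ a b) b (commonʳ-≃ a b))))
      (≃? (𝕜 (common a b)) (commonˡ a b) (𝕜 (common a b)) (commonʳ a b))

    ≃ᴹ?⊢ : (a b : Γ → Tuple M) → ε ⊢ (λ γ → ⌜ a γ ⌝ᴹ) → ε ⊢ (λ γ → ⌜ b γ ⌝ᴹ) →
           ε ⊢ (λ γ → bit (≃ᴹ? (a γ) (b γ)))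
    ≃ᴹ?⊢ {ε = ε} a b p q = conv
      (λ γ → bit-map′ (≃? (𝕜 (common (a γ) (b γ))) (commonˡ (a γ) (b γ)) _ (commonʳ (a γ) (b γ))))
      (≃?⊢ (λ γ → commonˡ (a γ) (b γ)) (λ γ → commonʳ (a γ) (b γ))
        (level⊢ T⊢) (pulled⊢ a _ T⊢ p) (level⊢ T⊢) (pulled⊢ b _ T⊢ q))
      where
      T⊢ : ε ⊢ (λ γ → common (a γ) (b γ))
      T⊢ = ⟨⟩⊢ p q

  validateM : ℕ → Maybe ∣M∣
  validateM n = certify (domM? n)

  validateM-just : ∀ n {c} → validateM n ≡ just c → proj₁ c ≡ n
  validateM-just n = certify-just (domM? n)

  validateM-complete : ∀ (c : ∣M∣) → ∃[ d ] validateM (proj₁ c) ≡ just d × proj₁ d ≡ proj₁ c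
  validateM-complete (n , p) = certify-complete (domM? n) p

  validateM⊢ : {n : Γ → ℕ} → ε ⊢ n → ε ⊢ (λ γ → codeMaybe proj₁ (validateM (n γ)))
  validateM⊢ {n = n} p = certify⊢ {P = λ _ → DomM} (λ γ → domM? (n γ)) p (domM?⊢ p)

  tupleM : ℕ → Maybe (Tuple M)
  tupleM n = traverse validateM (listOf n)

  tupleM-just : ∀ n {a} → tupleM n ≡ just a → ⌜ a ⌝ᴹ ≡ n
  tupleM-just n eq = trans (cong codeList (go (just-traverse (listOf n) eq))) (proj₂ (decodeList n))
    where
    go : ∀ {l a} → PointwiseL (λ x y → validateM x ≡ just y) l a → raw Mω a ≡ l
    go []       = refl
    go (e ∷ es) = cong₂ _∷_ (validateM-just _ e) (go es)

  tupleM-complete : ∀ a → ∃[ b ] tupleM ⌜ a ⌝ᴹ ≡ just b × ⌜ b ⌝ᴹ ≡ ⌜ a ⌝ᴹ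
  tupleM-complete a =
    let b , eq , es = traverse-map {R = λ c d → proj₁ d ≡ proj₁ c} {f = validateM} proj₁ validateM-complete a
        eq′ = trans (cong (traverse validateM) (listOf-codeList (raw Mω a))) eq
    in b , eq′ , tupleM-just ⌜ a ⌝ᴹ eq′

  tupleM⊢ : {n : Γ → ℕ} → ε ⊢ n → ε ⊢ (λ γ → codeMaybe ⌜_⌝ᴹ (tupleM (n γ)))
  tupleM⊢ {n = n} p = traverse⊢ {α = proj₂} {β = proj₁ ∘ proj₂} (λ _ → validateM) (λ γ → listOf (n γ))
    (listOf⊢ p) (validateM⊢ (snd⊢ id⊢))

  admit : ∀ d a → Dec ([ 𝒜 (codomᵈ d) , M ] gens (codomᵈ d) ≃ a) → Maybe (∃ E)
  admit d a (yes p) = just (⌜ a ⌝ᴹ , a , refl , codomᵈ d , (domᵈ d , embᵈ d , isABᵈ d) , p)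
  admit d a (no _)  = nothing

  memberE : Maybe (∃ AB) → Maybe (Tuple M) → Maybe (∃ E)
  memberE (just d) (just a) = admit d a (gens-≃? (codomᵈ d) a)
  memberE (just d) nothing  = nothing
  memberE nothing  _        = nothing

  enumerateE : ℕ → Maybe (∃ E)
  enumerateE s = memberE (listAB (π₁ s)) (tupleM (π₂ s))

  admit-complete : ∀ d a (t : Dec _) → [ 𝒜 (codomᵈ d) , M ] gens (codomᵈ d) ≃ a →
                    ∃[ p ] admit d a t ≡ just (⌜ a ⌝ᴹ , p)
  admit-complete d a (yes _) t = _ , refl
  admit-complete d a (no ¬t) t = contradiction t ¬t

  enumerateE-complete : ∀ n → E n → ∃[ s ] ∃[ p ] enumerateE s ≡ just (n , p)
  enumerateE-complete n (a , refl , l , (i , F , ab) , l≃a) =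
    s , subst (λ m → ∃[ p ] enumerateE s ≡ just (m , p)) b≡a
      (go {s} (trans (cong listAB (π₁-⟨⟩ q ⌜ a ⌝ᴹ)) q-lists) (trans (cong tupleM (π₂-⟨⟩ q ⌜ a ⌝ᴹ)) b-eq)
          (≃-trans (gens (codomᵈ d)) a b
            (subst (λ l → [ 𝒜 l , M ] gens l ≃ a) (codeEmb-codom F (embᵈ d) (codeᵈ d)) l≃a)
            (⌜⌝-≃ Mω (sym b≡a))))
    where
    found = listed-complete O! (proj₂ (IsComputableCAPWitness.AB-ce (proj₂ (proj₂ ccap)))) (codeEmb F) ab
    q : ℕ
    q = proj₁ found
    d : ∃ AB
    d = codeEmb F , proj₁ (proj₂ found)
    q-lists : listAB q ≡ just d
    q-lists = proj₂ (proj₂ found)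
    b : Tuple M
    b = proj₁ (tupleM-complete a)
    b-eq : tupleM ⌜ a ⌝ᴹ ≡ just b
    b-eq = proj₁ (proj₂ (tupleM-complete a))
    b≡a : ⌜ b ⌝ᴹ ≡ ⌜ a ⌝ᴹ
    b≡a = proj₂ (proj₂ (tupleM-complete a))
    s : ℕ
    s = ⟨ q , ⌜ a ⌝ᴹ ⟩
    go : ∀ {s d b} → listAB (π₁ s) ≡ just d → tupleM (π₂ s) ≡ just b →
         [ 𝒜 (codomᵈ d) , M ] gens (codomᵈ d) ≃ b → ∃[ p ] enumerateE s ≡ just (⌜ b ⌝ᴹ , p)
    go {s} {d} {b} e e′ t = let p , eq = admit-complete d b (gens-≃? (codomᵈ d) b) t in
      p , trans (cong₂ memberE e e′) eq

  enumerateE⊢ : {s : Γ → ℕ} → ε ⊢ s → ε ⊢ (λ γ → codeMaybe proj₁ (enumerateE (s γ)))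
  enumerateE⊢ {s = s} p =
    elim⊢ {α = λ (_ , d) → proj₁ d} (λ γ o → codeMaybe proj₁ (memberE o (tupleM (π₂ (s γ)))))
      (λ γ → listAB (π₁ (s γ))) (listAB⊢ (π₁⊢ p)) (const⊢ 0)
      (elim⊢ {α = λ (_ , a) → ⌜ a ⌝ᴹ} (λ (γ , d) o → codeMaybe proj₁ (memberE (just d) o))
        (λ (γ , _) → tupleM (π₂ (s γ))) (tupleM⊢ (weaken (π₂⊢ p))) (const⊢ 0)
        (dec⊢ (λ ((γ , d) , a) t → codeMaybe proj₁ (admit d a t)) (λ ((γ , d) , a) → gens-≃? (codomᵈ d) a)
          (gens-≃?⊢ proj₂ (codom⊢ (λ ((γ , d) , _) → embᵈ d)
            (embᵈ⊢ (λ ((γ , d) , _) → d) (snd⊢ (fst⊢ id⊢)))) (snd⊢ id⊢))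
          (suc⊢ (snd⊢ id⊢)) (const⊢ 0)))

  E-ce : CE (χ X) E
  E-ce = enumerates O! enumerateE (enumerateE⊢ id⊢) enumerateE-complete

  -- Enumerating the diagrams of the limit

  module Diagram (P : (N : ωStructure L) → ℕ → Set)
    (lists : ∀ i → ∃[ e ] Enumerates (χ X) e (P (𝒜ω i)))
    (lists⊢ : (λ (i : ℕ) → i) ⊢ (λ i → proj₁ (lists i)))
    (image : ℕ → ℕ → ℕ)
    (image⊢ : (λ (x : Σ ℕ λ T → ∃ (P (𝒜ω (𝕜 T)))) → proj₁ x ∙ proj₁ (proj₂ x)) ⊢ (λ (T , n , _) → image T n))
    (sound : ∀ T n → P (𝒜ω (𝕜 T)) n → P Mω (image T n))
    (complete : ∀ n → P Mω n → ∃[ T ] ∃[ m ] P (𝒜ω (𝕜 T)) m × image T m ≡ n) where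

    levelList : ∀ T → ℕ → Maybe (∃ (P (𝒜ω (𝕜 T))))
    levelList T = listed (proj₂ (lists (𝕜 T)))

    transport : ∀ {T} → Maybe (∃ (P (𝒜ω (𝕜 T)))) → Maybe (∃ (P Mω))
    transport {T} = Maybe.map λ (n , p) → image T n , sound T n p

    enumeration : ℕ → Maybe (∃ (P Mω))
    enumeration s = transport {π₁ s} (levelList (π₁ s) (π₂ s))

    -- Each diagram of M is the union of the images of the diagrams of the stages. The number `s` is
    -- read as a stage together with a step of the enumeration at that stage.
    diagram-ce : CE (χ X) (P Mω)
    diagram-ce = enumerates O! enumeration
      (elim⊢ {α = λ (_ , x) → proj₁ x} (λ s o → codeMaybe proj₁ (transport {π₁ s} o))
        (λ s → levelList (π₁ s) (π₂ s))
        (listed⊢ {e = λ s → proj₁ (lists (𝕜 (π₁ s)))} {P = λ s → P (𝒜ω (𝕜 (π₁ s)))}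
          (λ s → proj₂ (lists (𝕜 (π₁ s))))
          (via (λ s → 𝕜 (π₁ s)) lists⊢ (level⊢ (π₁⊢ id⊢))) (π₂⊢ id⊢))
        (const⊢ 0)
        (suc⊢ (via (λ (s , x) → π₁ s , x) image⊢ (π₁⊢ (fst⊢ id⊢) ,⊢ snd⊢ id⊢))))
      λ n Pn → let T , m , Pm , eq = complete n Pn
                   t , p , eq′ = listed-complete O! (proj₂ (lists (𝕜 T))) m Pm
               in ⟨ T , t ⟩ , find n {⟨ T , t ⟩} (π₁-⟨⟩ T t) (π₂-⟨⟩ T t) eq′ eq
      where
      find : ∀ n {s T t m p} → π₁ s ≡ T → π₂ s ≡ t → levelList T t ≡ just (m , p) → image T m ≡ n →
             ∃[ q ] enumeration s ≡ just (n , q)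
      find n {s} refl refl eq refl with levelList (π₁ s) (π₂ s)
      find n {s} refl refl refl refl | _ = _ , refl

  nameList : ℕ → ℕ → ℕ
  nameList T n = codeList (List.map (λ x → rep ⟨ T , x ⟩) (listOf n))

  nameList⊢ : {T n : Γ → ℕ} → ε ⊢ T → ε ⊢ n → ε ⊢ (λ γ → nameList (T γ) (n γ))
  nameList⊢ {n = n} p q = map⊢ {α = proj₂} (λ γ → listOf (n γ)) (listOf⊢ q)
    (rep⊢ (⟨⟩⊢ (weaken p) (snd⊢ id⊢)))

  nameList-code : ∀ T {k} (w : Vec (Elt (𝕜 T)) k) →
                  nameList T (⟪ 𝕜 T , toList w ⟫) ≡ ⌜ toList (Vec.map (name T) w) ⌝ᴹ
  nameList-code T w = cong codeList (trans (cong (List.map _) (listOf-codeList (raw (𝒜ω (𝕜 T)) (toList w))))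
    (trans (sym (Listₚ.map-∘ (toList w)))
      (trans (Listₚ.map-cong (λ x → sym (name-rep T x)) (toList w))
        (trans (Listₚ.map-∘ (toList w)) (cong (raw Mω) (sym (Vecₚ.toList-map (name T) w)))))))

  namesV-raw : ∀ {k T} {v : Vec ∣M∣ k} {w} → NamesV T v w →
               raw Mω (toList (Vec.map (name T) w)) ≡ raw Mω (toList v)
  namesV-raw []                   = refl
  namesV-raw {v = c ∷ _} (p ∷ ps) = cong₂ _∷_ (names⇒≡ c p) (namesV-raw ps)

  -- Instantiated both with the relations and with their negations. The negative facts pass between
  -- stages and M in both directions because embeddings preserve and reflect relations.
  module Relational (Q : (N : ωStructure L) (r : RelSym) → Vec (ωStructure.Carrier N) (arityᴿ r) → Set)
    (push : ∀ T r w → Q (𝒜ω (𝕜 T)) r w → Q Mω r (Vec.map (name T) w))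
    (pop : ∀ T r v w → NamesV T v w → Q Mω r v → Q (𝒜ω (𝕜 T)) r w)
    (lists : ∀ i → ∃[ e ] Enumerates (χ X) e
      (λ k → ∃[ r ] ∃[ v ] k ≡ ⟨ proj₁ r , ⌜_⌝ (𝒜ω i) (toList v) ⟩ × Q (𝒜ω i) r v))
    (lists⊢ : (λ (i : ℕ) → i) ⊢ (λ i → proj₁ (lists i))) where

    P : (N : ωStructure L) → ℕ → Set
    P N k = ∃[ r ] ∃[ v ] k ≡ ⟨ proj₁ r , ⌜_⌝ N (toList v) ⟩ × Q N r v

    image : ℕ → ℕ → ℕ
    image T n = ⟨ π₁ n , nameList T (π₂ n) ⟩

    image-code : ∀ T r (w : Vec (Elt (𝕜 T)) (arityᴿ r)) →
      image T ⟨ proj₁ r , ⟪ 𝕜 T , toList w ⟫ ⟩ ≡ ⟨ proj₁ r , ⌜ toList (Vec.map (name T) w) ⌝ᴹ ⟩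
    image-code T r w = cong₂ ⟨_,_⟩ (π₁-⟨⟩ (proj₁ r) ⟪ 𝕜 T , toList w ⟫)
      (trans (cong (nameList T) (π₂-⟨⟩ (proj₁ r) ⟪ 𝕜 T , toList w ⟫)) (nameList-code T w))

    sound : ∀ T n → P (𝒜ω (𝕜 T)) n → P Mω (image T n)
    sound T _ (r , w , refl , q) = r , Vec.map (name T) w , image-code T r w , push T r w q

    complete : ∀ n → P Mω n → ∃[ T ] ∃[ m ] P (𝒜ω (𝕜 T)) m × image T m ≡ n
    complete _ (r , v , refl , q) = let T , w , ps = pullV v in
      T , ⟨ proj₁ r , ⟪ 𝕜 T , toList w ⟫ ⟩ , (r , w , refl , pop T r v w ps q) ,
      trans (image-code T r w) (cong (λ l → ⟨ proj₁ r , codeList l ⟩) (namesV-raw ps))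

    open Diagram P lists lists⊢ image
      (⟨⟩⊢ (π₁⊢ (snd⊢ id⊢)) (nameList⊢ (fst⊢ id⊢) (π₂⊢ (snd⊢ id⊢)))) sound complete public

  module Positive = Relational (λ N r v → ωStructure.Rel N r v)
    (λ T r w → Equivalence.to (Embedding.preservesRel (nameₑ T) r w))
    (λ T r v w ps Rv → RelM⇒ r (PW.refl refl) Rv ps)
    (λ i → _ , IsIndexOf.enumeratesTrue (isIndex i)) (posIndex⊢ id⊢)

  module Negative = Relational (λ N r v → ¬ ωStructure.Rel N r v)
    (λ T r w ¬Rw → ¬Rw ∘ Equivalence.from (Embedding.preservesRel (nameₑ T) r w))
    (λ T r v w ps ¬Rv Rw → ¬Rv (T , w , ps , Rw))
    (λ i → _ , IsIndexOf.enumeratesFalse (isIndex i)) (negIndex⊢ id⊢)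

  graphImage : ℕ → ℕ → ℕ
  graphImage T n = ⟨ π₁ n , ⟨ nameList T (π₁ (π₂ n)) , rep ⟨ T , π₂ (π₂ n) ⟩ ⟩ ⟩

  graph-code : ∀ T f (w : Vec (Elt (𝕜 T)) (arityᶠ f)) y →
    graphImage T ⟨ proj₁ f , ⟨ ⟪ 𝕜 T , toList w ⟫ , proj₁ y ⟩ ⟩ ≡
    ⟨ proj₁ f , ⟨ ⌜ toList (Vec.map (name T) w) ⌝ᴹ , proj₁ (name T y) ⟩ ⟩
  graph-code T f w y = cong₂ ⟨_,_⟩ (π₁-⟨⟩ (proj₁ f) m) (cong₂ ⟨_,_⟩
    (trans (cong (nameList T ∘ π₁) eq)
      (trans (cong (nameList T) (π₁-⟨⟩ ⟪ 𝕜 T , toList w ⟫ (proj₁ y))) (nameList-code T w)))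
    (trans (cong (λ x → rep ⟨ T , π₂ x ⟩) eq)
      (trans (cong (λ x → rep ⟨ T , x ⟩) (π₂-⟨⟩ ⟪ 𝕜 T , toList w ⟫ (proj₁ y))) (sym (name-rep T y)))))
    where
    m = ⟨ ⟪ 𝕜 T , toList w ⟫ , proj₁ y ⟩
    eq : π₂ ⟨ proj₁ f , m ⟩ ≡ m
    eq = π₂-⟨⟩ (proj₁ f) m

  graph-sound : ∀ T n → Graph (𝒜ω (𝕜 T)) n → Graph Mω (graphImage T n)
  graph-sound T _ (f , w , refl) = f , Vec.map (name T) w ,
    trans (graph-code T f w (𝒜.fun T f w))
      (cong (λ y → ⟨ proj₁ f , ⟨ ⌜ toList (Vec.map (name T) w) ⌝ᴹ , y ⟩ ⟩)
        (Embedding.preservesFun (nameₑ T) f w))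

  graph-complete : ∀ n → Graph Mω n → ∃[ T ] ∃[ m ] Graph (𝒜ω (𝕜 T)) m × graphImage T m ≡ n
  graph-complete _ (f , v , refl) = let T , w , ps = pullV v in
    T , _ , (f , w , refl) ,
    trans (graph-code T f w (𝒜.fun T f w))
      (cong₂ (λ l y → ⟨ proj₁ f , ⟨ codeList l , y ⟩ ⟩) (namesV-raw ps)
        (names⇒≡ (funM f v) (funM-Names f v (PW.refl refl) ps)))

  module GraphM = Diagram (λ N → Graph N) (λ i → _ , IsIndexOf.enumeratesGraph (isIndex i)) (graphIndex⊢ id⊢)
    graphImage
    (⟨⟩⊢ (π₁⊢ (snd⊢ id⊢)) (⟨⟩⊢ (nameList⊢ (fst⊢ id⊢) (π₁⊢ (π₂⊢ (snd⊢ id⊢))))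
      (rep⊢ (⟨⟩⊢ (fst⊢ id⊢) (π₂⊢ (π₂⊢ (snd⊢ id⊢)))))))
    graph-sound graph-complete

  M-computable : ComputableStructure Mω (χ X)
  M-computable = _ , record
    { components      = refl
    ; decidesDom      = proj₂ (decides domM? (domM?⊢ id⊢))
    ; enumeratesTrue  = proj₂ Positive.diagram-ce
    ; enumeratesFalse = proj₂ Negative.diagram-ce
    ; enumeratesGraph = proj₂ GraphM.diagram-ce
    }

  M-represents : Represents X 𝕂 (AgeOf M)
  M-represents = record
    { triples-ce = triples-ce
    ; isIndex    = isIndex
    ; member     = λ i →
        let e = nameₑ (suc i) ∘ₑ level-embeds i
            a = List.map (Embedding.to e) (gens i)
        in a , ≃⇒≅ (clTuple M a) (generates i) (clTuple-generates M a)
                 (≃-trans (gens i) a (clTuple M a) (map-≃ e (gens i)) (≃-sym (clTuple M a) a (clTuple-≃ M a)))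
    ; covers     = λ B (a , B≅cl) →
        let l , l≃a = hereditary a in
        l , ≅-trans B≅cl (≃⇒≅ (gens l) (clTuple-generates M a) (generates l)
              (≃-trans (clTuple M a) a (gens l) (clTuple-≃ M a) (≃-sym (gens l) a l≃a)))
    }

  -- Back and forth

  opaque
    -- Pull `a` and `e` back to a common stage. The extension property embeds that whole stage into
    -- M so that the copy of `a` goes to `b`; the entries of `e` are carried along, and `d` consists
    -- of their images.
    extend-pairing : ∀ a b → E ⌜ a ⌝ᴹ → [ M , M ] a ≃ b → ∀ e → ∃[ d ] ([ M , M ] a ++ e ≃ b ++ d)
    extend-pairing a b Ea a≃b e = d , ≃-trans {A = M} {𝒜 (𝕜 T)} {M} (a ++ e) (c ++ e₀) (b ++ d)
      (≃-sym {A = 𝒜 (𝕜 T)} {M} (c ++ e₀) (a ++ e) ce₀≃ae) ce₀≃bd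
      where
      T : ℕ
      T = ⟨ ⌜ a ⌝ᴹ , ⌜ e ⌝ᴹ ⟩
      c e₀ : Tuple (𝒜 (𝕜 T))
      c  = proj₁ (pull a (x≤⟨x,y⟩ ⌜ a ⌝ᴹ ⌜ e ⌝ᴹ))
      e₀ = proj₁ (pull e (y≤⟨x,y⟩ ⌜ a ⌝ᴹ ⌜ e ⌝ᴹ))
      c-names : PointwiseL (λ c x → At T (proj₁ c) x) a c
      c-names = proj₂ (proj₂ (pull a (x≤⟨x,y⟩ ⌜ a ⌝ᴹ ⌜ e ⌝ᴹ)))
      e-names : PointwiseL (λ c x → At T (proj₁ c) x) e e₀
      e-names = proj₂ (proj₂ (pull e (y≤⟨x,y⟩ ⌜ a ⌝ᴹ ⌜ e ⌝ᴹ)))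
      l : ℕ
      l = proj₁ (E-base a Ea)
      l≃a : [ 𝒜 l , M ] gens l ≃ a
      l≃a = proj₂ (proj₂ (E-base a Ea))
      c≃a : [ 𝒜 (𝕜 T) , M ] c ≃ a
      c≃a = named-≃ c-names
      c≃b : [ 𝒜 (𝕜 T) , M ] c ≃ b
      c≃b = ≃-trans c a b c≃a a≃b
      extension : Σ[ h ∈ Embedding (𝒜 (𝕜 T)) M ] (∀ {x y} → Zip c b x y → proj₁ (Embedding.to h x) ≡ proj₁ y)
      extension = extension-property (proj₁ (proj₂ (E-base a Ea))) b c (≃-trans (gens l) a b l≃a a≃b)
        (≃-trans (gens l) a c l≃a (≃-sym c a c≃a))
      h : Embedding (𝒜 (𝕜 T)) M
      h = proj₁ extension
      d : Tuple M
      d = List.map (Embedding.to h) e₀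
      lengths : length (c ++ e₀) ≡ length (b ++ d)
      lengths = trans (Listₚ.length-++ c) (trans
        (cong₂ _+_ (proj₁ c≃b) (sym (Listₚ.length-map (Embedding.to h) e₀))) (sym (Listₚ.length-++ b)))
      sends : ∀ {x y} → Zip c b x y ⊎ Zip e₀ d x y → proj₁ (Embedding.to h x) ≡ proj₁ y
      sends (inj₁ z) = proj₂ extension z
      sends (inj₂ z) = sym (cong proj₁ (zip-map (Embedding.to h) e₀ z))
      ce₀≃ae : [ 𝒜 (𝕜 T) , M ] c ++ e₀ ≃ a ++ e
      ce₀≃ae = named-≃ {T} {a ++ e} {c ++ e₀} (PWL.++⁺ c-names e-names)
      ce₀≃bd : [ 𝒜 (𝕜 T) , M ] c ++ e₀ ≃ b ++ d
      ce₀≃bd = partialIso⇒≃ (c ++ e₀) (b ++ d) lengths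
        (partialIso-⊆ {A = 𝒜 (𝕜 T)} {M} {Zip (c ++ e₀) (b ++ d)} {λ x y → proj₁ (Embedding.to h x) ≡ proj₁ y}
          (λ {x} {y} z → sends {x} {y} (zip-++⁻ c b {e₀} {d} {x} {y} (proj₁ c≃b) z)) (embedding-partialIso h))

  record Pairing : Set where
    constructor pairing
    field
      source target : Tuple M
      similar       : [ M , M ] source ≃ target
      good          : E ⌜ source ⌝ᴹ
  open Pairing

  codeP : Pairing → ℕ
  codeP s = ⌜ source s ⌝ᴹ ∙ ⌜ target s ⌝ᴹ

  Pairs : Pairing → ∣M∣ → ∣M∣ → Set
  Pairs s = Zip (source s) (target s)

  flip : Pairing → Pairing
  flip (pairing a b a≃b Ea) = pairing b a (≃-sym a b a≃b) (E-closed a b Ea a≃b)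

  flip⊢ : (s : Γ → Pairing) → ε ⊢ (λ γ → codeP (s γ)) → ε ⊢ (λ γ → codeP (flip (s γ)))
  flip⊢ s p = snd⊢ p ,⊢ fst⊢ p

  singleton : Maybe ∣M∣ → Tuple M
  singleton (just c) = c ∷ []
  singleton nothing  = []

  module Demand (n : ℕ) (a : Tuple M) where
    bound : ℕ
    bound = ⟨ n , ⌜ a ⌝ᴹ ⟩

    -- Appending the element `n` alone need not lead to a member of E. The generators of a successor
    -- stage beyond all names involved form a member of E whose closure contains both `n`, if it is
    -- in the domain, and `a`; prefixing tuples from the closure stays in E.
    demand : Tuple M
    demand = singleton (validateM n) ++ levelGens (suc bound)

    demand-E : E ⌜ a ++ demand ⌝ᴹ
    demand-E = E-extension a demand
      (E-extension (singleton (validateM n)) (levelGens (suc bound)) (levelGens-E bound)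
        λ c c∈ → levelGens-cl (suc bound) c (m≤n⇒m≤1+n
          (≤-trans (≤-reflexive (is-n (validateM n) refl c∈)) (x≤⟨x,y⟩ n ⌜ a ⌝ᴹ))))
      λ c c∈a → cl-trans M (λ d d∈ → ∈-cl M (∈ₚ.∈-++⁺ʳ (singleton (validateM n)) d∈))
        (levelGens-cl (suc bound) c (m≤n⇒m≤1+n (≤-trans (bounded a ≤-refl c∈a) (y≤⟨x,y⟩ n ⌜ a ⌝ᴹ))))
      where
      is-n : ∀ o {c} → validateM n ≡ o → c ∈ singleton o → proj₁ c ≡ n
      is-n (just c) eq (here refl) = validateM-just n eq

    demand-∋ : ∀ (c : ∣M∣) → proj₁ c ≡ n → ∃[ d ] d ∈ demand × proj₁ d ≡ proj₁ c
    demand-∋ c refl = let d , eq , e = validateM-complete c in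
      d , ∈ₚ.∈-++⁺ˡ (subst (λ o → d ∈ singleton o) (sym eq) (here refl)) , e

  open Demand using (demand; demand-E; demand-∋)

  demand⊢ : {n : Γ → ℕ} (a : Γ → Tuple M) → ε ⊢ n → ε ⊢ (λ γ → ⌜ a γ ⌝ᴹ) →
            ε ⊢ (λ γ → ⌜ demand (n γ) (a γ) ⌝ᴹ)
  demand⊢ {Γ} {ε} {n} a p q = conv
    (λ γ → cong codeList (sym (Listₚ.map-++ proj₁ (singleton (validateM (n γ))) _)))
    (++⊢ {k = λ γ → raw Mω (singleton (validateM (n γ)))} {λ γ → raw Mω (levelGens (suc ⟨ n γ , ⌜ a γ ⌝ᴹ ⟩))}
      (elim⊢ {α = λ (_ , c) → proj₁ c} (λ _ o → ⌜ singleton o ⌝ᴹ) (λ γ → validateM (n γ)) (validateM⊢ p)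
        (const⊢ 0) (∷⊢ {l = λ _ → []} (snd⊢ id⊢) (const⊢ 0)))
      (conv (λ γ → nameGens (suc ⟨ n γ , ⌜ a γ ⌝ᴹ ⟩)) (nameList⊢ T⊢ (gens⊢ (level⊢ T⊢)))))
    where
    T⊢ : ε ⊢ (λ γ → suc ⟨ n γ , ⌜ a γ ⌝ᴹ ⟩)
    T⊢ = suc⊢ (⟨⟩⊢ p q)
    nameGens : ∀ T → nameList T ⟪ 𝕜 T , gens (𝕜 T) ⟫ ≡ ⌜ levelGens T ⌝ᴹ
    nameGens T = cong codeList (trans (cong (List.map _) (listOf-codeList (raw (𝒜ω (𝕜 T)) (gens (𝕜 T)))))
      (trans (sym (Listₚ.map-∘ (gens (𝕜 T))))
        (trans (Listₚ.map-cong (λ x → sym (name-rep T x)) (gens (𝕜 T))) (Listₚ.map-∘ (gens (𝕜 T))))))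

  append⊢ : (a b : Γ → Tuple M) → ε ⊢ (λ γ → ⌜ a γ ⌝ᴹ) → ε ⊢ (λ γ → ⌜ b γ ⌝ᴹ) → ε ⊢ (λ γ → ⌜ a γ ++ b γ ⌝ᴹ)
  append⊢ a b p q = conv (λ γ → cong codeList (sym (Listₚ.map-++ proj₁ (a γ) (b γ))))
    (++⊢ {k = λ γ → raw Mω (a γ)} {λ γ → raw Mω (b γ)} p q)

  -- Computable choice of a witness: numbers are searched until one decodes to an `A` satisfying
  -- `P`. The witness found need not be the one exhibited by `total`, so only `P` is known about it.
  module Decode {A : Set} (codeA : A → ℕ) (decode : ℕ → Maybe A)
    (decode-code : ∀ n {a} → decode n ≡ just a → codeA a ≡ n)
    (decode⊢ : id ⊢ (λ n → codeMaybe codeA (decode n)))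
    {Δ : Set} (P : Δ → A → Set) (P? : ∀ δ a → Dec (P δ a))
    (total : ∀ δ → ∃[ n ] ∃[ a ] decode n ≡ just a × P δ a) where

    Good : Δ × ℕ → Set
    Good (δ , n) = ∃[ a ] decode n ≡ just a × P δ a

    good? : ∀ x → Dec (Good x)
    good? (δ , n) = go (decode n) refl
      where
      go : ∀ o → decode n ≡ o → Dec (Good (δ , n))
      go nothing  eq = no λ (_ , eq′ , _) → nothing≢just (trans (sym eq) eq′)
      go (just a) eq with P? δ a
      ... | yes p = yes (a , eq , p)
      ... | no ¬p = no λ (b , eq′ , p) → ¬p (subst (P δ) (just-injective (trans (sym eq′) eq)) p)

    opaque
      solution : ∀ δ → Σ[ a ∈ A ] P δ a
      solution δ = let a , _ , p = μ-holds (λ n → good? (δ , n)) (total δ) in a , p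

      solution⊢ : {δ : Δ → ℕ} → (λ ((x , a) : Δ × A) → δ x ∙ codeA a) ⊢ (λ (x , a) → bit (P? x a)) →
                  δ ⊢ (λ x → codeA (proj₁ (solution x)))
      solution⊢ p = conv
        (λ x → sym (decode-code _ (proj₁ (proj₂ (μ-holds (λ n → good? (x , n)) (total x))))))
        (μ⊢ good? total (maybe⊢ {α = λ (_ , a) → codeA a} (λ (_ , n) → decode n)
          (snd⊢ id⊢ ⨾ reindex proj₂ decode⊢)
          (conv (λ ((x , n) , eq) → sym (bit-no {a? = good? (x , n)}
              λ (_ , eq′ , _) → nothing≢just (trans (sym eq) eq′)))
            (const⊢ 1))
          (conv (λ ((x , n) , a , eq) → bit-cong {a? = P? x a} {good? (x , n)}
              (λ q → a , eq , q) (λ (b , eq′ , q) → subst (P x) (just-injective (trans (sym eq′) eq)) q))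
            (via (λ ((x , n) , a , eq) → x , a) p (fst⊢ (fst⊢ id⊢) ,⊢ snd⊢ id⊢)))))

  total-forth : ∀ ((n , s) : ℕ × Pairing) →
    ∃[ m ] ∃[ d ] tupleM m ≡ just d × ([ M , M ] source s ++ demand n (source s) ≃ target s ++ d)
  total-forth (n , s) =
    let e = demand n (source s)
        d , p = extend-pairing (source s) (target s) (good s) (similar s) e
        d′ , eq , d′≡d = tupleM-complete d
    in ⌜ d ⌝ᴹ , d′ , eq , ≃-trans (source s ++ e) (target s ++ d) (target s ++ d′) p
         (pointwise-≃ {A = M} {target s ++ d} {target s ++ d′} (PWL.++⁺
           (raw-pointwise Mω {target s} refl) (raw-pointwise Mω {d} (codeList-injective (sym d′≡d)))))

  module Forth = Decode ⌜_⌝ᴹ tupleM tupleM-just (tupleM⊢ id⊢) {ℕ × Pairing}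
    (λ (n , s) d → [ M , M ] source s ++ demand n (source s) ≃ target s ++ d)
    (λ (n , s) d → ≃ᴹ? (source s ++ demand n (source s)) (target s ++ d))
    total-forth

  opaque
    forth : ℕ → Pairing → Pairing
    forth n s = pairing (source s ++ demand n (source s)) (target s ++ proj₁ (Forth.solution (n , s)))
      (proj₂ (Forth.solution (n , s))) (demand-E n (source s))

    forth⊢ : {n : Γ → ℕ} (s : Γ → Pairing) → ε ⊢ n → ε ⊢ (λ γ → codeP (s γ)) →
             ε ⊢ (λ γ → codeP (forth (n γ) (s γ)))
    forth⊢ {n = n} s p q = via (λ γ → n γ , s γ) go (p ,⊢ q)
      where
      δ : ℕ × Pairing → ℕ
      δ (n , s) = n ∙ codeP s
      source⊢ : δ ⊢ (λ (n , s) → ⌜ source s ++ demand n (source s) ⌝ᴹ)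
      source⊢ = append⊢ (λ (n , s) → source s) (λ (n , s) → demand n (source s)) (fst⊢ (snd⊢ id⊢))
        (demand⊢ (λ (n , s) → source s) (fst⊢ id⊢) (fst⊢ (snd⊢ id⊢)))
      go : δ ⊢ (λ (n , s) → codeP (forth n s))
      go = source⊢ ,⊢ append⊢ (λ (n , s) → target s) (λ x → proj₁ (Forth.solution x)) (snd⊢ (snd⊢ id⊢))
        (Forth.solution⊢ {δ = δ} (≃ᴹ?⊢
          (λ ((n , s) , d) → source s ++ demand n (source s)) (λ ((n , s) , d) → target s ++ d)
          (weaken source⊢)
          (append⊢ (λ ((n , s) , d) → target s) proj₂ (snd⊢ (snd⊢ (fst⊢ id⊢))) (snd⊢ id⊢))))

    forth-∋ : ∀ s (c : ∣M∣) → ∃[ x ] ∃[ y ] proj₁ x ≡ proj₁ c × Pairs (forth (proj₁ c) s) x y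
    forth-∋ s c =
      let x , x∈ , e = demand-∋ (proj₁ c) (source s) c refl
          y , z = ∈-zip (proj₁ (similar (forth (proj₁ c) s))) (∈ₚ.∈-++⁺ʳ (source s) x∈)
      in x , y , e , z

    forth-mono : ∀ n s {x y} → Pairs s x y → Pairs (forth n s) x y
    forth-mono n s z = zip-++ˡ z

  round : ℕ → Pairing → Pairing
  round n s = flip (forth n (flip (forth n s)))

  run : Pairing → ℕ → Pairing
  run s zero    = s
  run s (suc n) = round n (run s n)

  run⊢ : {n : Γ → ℕ} (s : Γ → Pairing) → ε ⊢ (λ γ → codeP (s γ)) → ε ⊢ n →
         ε ⊢ (λ γ → codeP (run (s γ) (n γ)))
  run⊢ {n = n} s p q = via (λ γ → s γ , n γ)
    (rec⊢ {ε = codeP} {f = λ (s , n) → codeP (run s n)} id⊢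
      (flip⊢ (λ (s , n) → forth n (flip (forth n (run s n))))
        (forth⊢ (λ (s , n) → flip (forth n (run s n))) (fst⊢ (snd⊢ id⊢))
          (flip⊢ (λ (s , n) → forth n (run s n))
            (forth⊢ (λ (s , n) → run s n) (fst⊢ (snd⊢ id⊢)) (snd⊢ (snd⊢ id⊢)))))))
    (p ,⊢ q)

  back-mono : ∀ n s {x y} → Pairs s x y → Pairs (flip (forth n (flip s))) x y
  back-mono n s z = zip-sym (forth-mono n (flip s) (zip-sym z))

  run-mono : ∀ s {m n} → m ≤′ n → ∀ {x y} → Pairs (run s m) x y → Pairs (run s n) x y
  run-mono s ≤′-refl           z = z
  run-mono s (≤′-step {n} m≤n) z = back-mono n (forth n (run s n)) (forth-mono n (run s n) (run-mono s m≤n z))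

  -- The union of all rounds, closed under equality of elements of M, which ignores proofs of
  -- membership in the domain.
  record Graphᴾ (s : Pairing) (x y : ∣M∣) : Set where
    constructor atRound
    field
      time    : ℕ
      {x′ y′} : ∣M∣
      x≡      : proj₁ x ≡ proj₁ x′
      y≡      : proj₁ y ≡ proj₁ y′
      paired  : Pairs (run s time) x′ y′

  graph-onto : ∀ s (c : ∣M∣) → ∃[ x ] Graphᴾ s x c
  graph-onto s c = let n = proj₁ c ; y , x , e , z = forth-∋ (flip (forth n (run s n))) c in
    x , atRound (suc n) refl (sym e) (zip-sym z)

  -- Finitely many pairs are involved in an atomic formula, and since rounds only grow, all of them
  -- are present in a common later round, whose two tuples are similar.
  graph-partialIso : ∀ s → PartialIso M M (Graphᴾ s)
  graph-partialIso s = partialIso λ n ρ σ g →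
    let b , le = finite-bound n (λ i → Graphᴾ.time (g i)) in
    PartialIso.same (partialIso-resp {A = M} {M}
        (≃⇒partialIso (source (run s b)) (target (run s b)) (similar (run s b)))) n ρ σ
      λ i → Graphᴾ.x′ (g i) , Graphᴾ.y′ (g i) , Graphᴾ.x≡ (g i) , Graphᴾ.y≡ (g i) ,
            run-mono s (≤⇒≤′ (le i)) (Graphᴾ.paired (g i))

  after : Pairing × ∣M∣ → Pairing
  after (s , x) = run s (suc (proj₁ x))

  -- After the round numbered by `x` the source contains `x`, so its partner is the only element
  -- that keeps the two tuples similar when `x` and it are put in front. Testing similarity thus
  -- replaces a lookup in the tuples.
  total-image : ∀ (p : Pairing × ∣M∣) → ∃[ n ] ∃[ y ] validateM n ≡ just y ×
                ([ M , M ] proj₂ p ∷ source (after p) ≃ y ∷ target (after p))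
  total-image (s , x) =
    let n = proj₁ x
        x′ , y′ , e , z = forth-∋ (run s n) x
        y , eq , y≡y′ = validateM-complete y′
        t = run s (suc n)
        z′ = back-mono n (forth n (run s n)) z
    in proj₁ y′ , y , eq , partialIso⇒≃ (x ∷ source t) (y ∷ target t) (cong suc (proj₁ (similar t)))
         (partialIso-⊆ {A = M} {M} (λ { here      → x′ , y′ , sym e , y≡y′ , z′
                                        ; (there w) → _ , _ , refl , refl , w })
           (partialIso-resp (≃⇒partialIso (source t) (target t) (similar t))))

  module Image = Decode proj₁ validateM validateM-just (validateM⊢ id⊢) {Pairing × ∣M∣}
    (λ p y → [ M , M ] proj₂ p ∷ source (after p) ≃ y ∷ target (after p))
    (λ p y → ≃ᴹ? (proj₂ p ∷ source (after p)) (y ∷ target (after p)))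
    total-image

  image : Pairing → ∣M∣ → ∣M∣
  image s x = proj₁ (Image.solution (s , x))

  image⊢ : (λ ((s , x) : Pairing × ∣M∣) → codeP s ∙ proj₁ x) ⊢ (λ (s , x) → proj₁ (image s x))
  image⊢ = Image.solution⊢ (≃ᴹ?⊢
    (λ ((s , x) , y) → x ∷ source (after (s , x))) (λ ((s , x) , y) → y ∷ target (after (s , x)))
    (∷⊢ {l = λ (p , _) → raw Mω (source (after p))} (snd⊢ (fst⊢ id⊢)) (fst⊢ after⊢))
    (∷⊢ {l = λ (p , _) → raw Mω (target (after p))} (snd⊢ id⊢) (snd⊢ after⊢)))
    where
    after⊢ : (λ (((s , x) , y) : (Pairing × ∣M∣) × ∣M∣) → (codeP s ∙ proj₁ x) ∙ proj₁ y)
               ⊢ (λ (p , _) → codeP (after p))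
    after⊢ = run⊢ (λ ((s , _) , _) → s) (fst⊢ (fst⊢ id⊢)) (suc⊢ (snd⊢ (fst⊢ id⊢)))

  image-graph : ∀ s x → Graphᴾ s x (image s x)
  image-graph s x =
    let n = proj₁ x
        x′ , y′ , e , z = forth-∋ (run s n) x
        t = run s (suc n)
        z′ = back-mono n (forth n (run s n)) z
    in atRound (suc n) (sym e) (partialIso-functional {A = M} {M}
         (≃⇒partialIso (x ∷ source t) (image s x ∷ target t) (proj₂ (Image.solution (s , x))))
         here (there z′) (sym e)) z′

  matching : ∀ (s : Pairing) {e} → (∀ x → φ (χ X) e (proj₁ x) (proj₁ (image s x))) →
             IsIndexOfMatching Mω (χ X) e (source s) (target s)
  matching s image-φ = record
    { π = record
      { to        = image s
      ; cong      = λ {x} {y} e → functional (image-graph s x) (image-graph s y) e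
      ; bijective = (λ {x} {y} e → injective (image-graph s x) (image-graph s y) e)
                  , λ y → let x , g = graph-onto s y in x , λ {z} e → functional (image-graph s z) g e
      }
    ; computes     = image-φ
    ; sends        = map-zip-≡ (proj₁ ∘ image s) proj₁ (source s) (target s) (proj₁ (similar s))
        λ {x} {y} z → functional {x} {x} {image s x} {y} (image-graph s x) (atRound 0 refl refl z) refl
    ; automorphism = λ _ → partialIso-preserves
        (partialIso-⊆ (λ {x} e → subst (Graphᴾ s x) (sym e) (image-graph s x)) (graph-partialIso s))
    }
    where
    functional : ∀ {x x′ y y′} → Graphᴾ s x y → Graphᴾ s x′ y′ → proj₁ x ≡ proj₁ x′ → proj₁ y ≡ proj₁ y′
    functional {x} {x′} {y} {y′} g g′ e =
      partialIso-functional {A = M} {M} (graph-partialIso s) {x} {x′} {y} {y′} g g′ e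
    injective : ∀ {x x′ y y′} → Graphᴾ s x y → Graphᴾ s x′ y′ → proj₁ y ≡ proj₁ y′ → proj₁ x ≡ proj₁ x′
    injective {x} {x′} {y} {y′} g g′ e =
      partialIso-functional {A = M} {M} (partialIso-sym (graph-partialIso s)) {y} {y′} {x} {x′} g g′ e

  -- Computing permutations and recognising tuples with the same equalities

  swap⊢ : {u v x : Γ → ℕ} → ε ⊢ u → ε ⊢ v → ε ⊢ x → ε ⊢ (λ γ → swap (u γ) (v γ) (x γ))
  swap⊢ {u = u} {v} {x} p q r =
    dec⊢ (λ γ d → select d (v γ) (select (x γ ≟ v γ) (u γ) (x γ))) (λ γ → x γ ≟ u γ)
      (≟⊢ r p) (reindex proj₁ q)
      (reindex proj₁ (dec⊢ (λ γ d → select d (u γ) (x γ)) (λ γ → x γ ≟ v γ) (≟⊢ r q)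
        (reindex proj₁ p) (reindex proj₁ r)))

  Arg : Set
  Arg = List ℕ × List ℕ × ℕ

  codeArg value : Arg → ℕ
  codeArg (a , b , x) = codeList a ∙ codeList b ∙ x
  value (a , b , x) = permutation a b x

  value⊢ : codeArg ⊢ value
  value⊢ = fix⊢ (length ∘ proj₁) (case⊢ (fst⊢ (snd⊢ id⊢))
    (conv (λ { (mkCall ([] , _ , _) _ _ , _) → refl }) (snd⊢ (snd⊢ (snd⊢ id⊢))))
    (case⊢ (fst⊢ (snd⊢ (snd⊢ (fst⊢ id⊢))))
      (conv (λ { ((mkCall (_ ∷ _ , [] , _) _ _ , _) , _) → refl }) (snd⊢ (snd⊢ (snd⊢ (fst⊢ id⊢)))))
      (conv (λ { ((mkCall (u ∷ a , v ∷ b , x) _ _ , _) , _) → refl })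
        (swap⊢ {u = head-value} {x = arg-value}
          (call tail₁ tail₂ (fst⊢ parts₁)
            λ { ((mkCall (u ∷ a , v ∷ b , x) _ calls , _) , _) → calls (a , b , u) ≤-refl })
          (fst⊢ parts₂)
          (call tail₁ tail₂ x⊢
            λ { ((mkCall (u ∷ a , v ∷ b , x) _ calls , _) , _) → calls (a , b , x) ≤-refl })))))
    where
    C : Set
    C = Call (length ∘ proj₁) codeArg value
    B : Set
    B = Σ (Σ C λ c → ∃[ m ] codeList (proj₁ (Call.arg c)) ≡ suc m) λ (c , _) →
        ∃[ m ] codeList (proj₁ (proj₂ (Call.arg c))) ≡ suc m
    β : B → ℕ
    β ((c , m , _) , n , _) = ((Call.self c ∙ codeArg (Call.arg c)) ∙ m) ∙ n
    hd : List ℕ → ℕ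
    hd []      = 0
    hd (x ∷ _) = x
    tl : List ℕ → List ℕ
    tl []      = []
    tl (_ ∷ a) = a
    head-value arg-value : B → ℕ
    head-value ((mkCall (a , b , x) _ _ , _) , _) = permutation (tl a) (tl b) (hd a)
    arg-value ((mkCall (a , b , x) _ _ , _) , _)  = permutation (tl a) (tl b) x
    uncons : ∀ a {m} → codeList a ≡ suc m → m ≡ hd a ∙ codeList (tl a)
    uncons (x ∷ a) eq = trans (suc-injective (sym eq)) (sym (∙≡⟨⟩ x (codeList a)))
    parts₁ : β ⊢ (λ ((c , _) , _) → hd (proj₁ (Call.arg c)) ∙ codeList (tl (proj₁ (Call.arg c))))
    parts₁ = conv (λ ((c , m , eq) , _) → uncons (proj₁ (Call.arg c)) eq) (snd⊢ (fst⊢ id⊢))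
    parts₂ : β ⊢ (λ ((c , _) , _) → hd (proj₁ (proj₂ (Call.arg c))) ∙
                                codeList (tl (proj₁ (proj₂ (Call.arg c)))))
    parts₂ = conv (λ ((c , _) , m , eq) → uncons (proj₁ (proj₂ (Call.arg c))) eq) (snd⊢ id⊢)
    tail₁ = snd⊢ parts₁
    tail₂ = snd⊢ parts₂
    x⊢ : β ⊢ (λ ((c , _) , _) → proj₂ (proj₂ (Call.arg c)))
    x⊢ = snd⊢ (snd⊢ (snd⊢ (fst⊢ (fst⊢ id⊢))))
    call : ∀ {f g h k} → β ⊢ f → β ⊢ g → β ⊢ h →
           (∀ b → φ (χ X) (Call.self (proj₁ (proj₁ b))) (f b ∙ g b ∙ h b) (k b)) → β ⊢ k
    call p q r = φ⊢ (fst⊢ (fst⊢ (fst⊢ id⊢))) (p ,⊢ q ,⊢ r)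

  permutation⊢ : {a b : Γ → List ℕ} {x : Γ → ℕ} → ε ⊢ (λ γ → codeList (a γ)) → ε ⊢ (λ γ → codeList (b γ)) →
                 ε ⊢ x → ε ⊢ (λ γ → permutation (a γ) (b γ) (x γ))
  permutation⊢ {a = a} {b} {x} p q r = via (λ γ → a γ , b γ , x γ) value⊢ (p ,⊢ q ,⊢ r)

  infix 4 _∼ᴹ_
  _∼ᴹ_ : Tuple M → Tuple M → Set
  a ∼ᴹ b = [ M , M ] a ∼ b

  zip-raw : ∀ {a b : Tuple M} {n m} → Zip (raw Mω a) (raw Mω b) n m →
            ∃[ x ] ∃[ y ] Zip a b x y × proj₁ x ≡ n × proj₁ y ≡ m
  zip-raw {x ∷ a} {y ∷ b} here      = x , y , here , refl , refl
  zip-raw {x ∷ a} {y ∷ b} (there z) = let x , y , z′ , e = zip-raw {a} {b} z in x , y , there z′ , e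

  ∼⇒sameEqualities : ∀ a b → a ∼ᴹ b → SameEqualities (raw Mω a) (raw Mω b)
  ∼⇒sameEqualities a b (eq , same) z z′ with zip-raw {a} {b} z | zip-raw {a} {b} z′
  ... | x , y , w , refl , refl | x′ , y′ , w′ , refl , refl with zip-position eq w | zip-position eq w′
  ...   | i , refl , refl | j , refl , refl = same i j

  ∼⇒sent : ∀ a b → a ∼ᴹ b → List.map (permutation (raw Mω a) (raw Mω b)) (raw Mω a) ≡ raw Mω b
  ∼⇒sent a b a∼b = trans (map-zip-≡ _ id (raw Mω a) (raw Mω b)
      (trans (Listₚ.length-map proj₁ a) (trans (proj₁ a∼b) (sym (Listₚ.length-map proj₁ b))))
      (permutation-sends (raw Mω a) (raw Mω b) (∼⇒sameEqualities a b a∼b)))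
    (Listₚ.map-id (raw Mω b))

  -- A permutation is injective, so sending `a` to `b` forces the same equalities between
  -- coordinates. Together with `∼⇒sent` this reduces `∼` to an equation between lists of numbers.
  sent⇒∼ : ∀ a b → List.map (permutation (raw Mω a) (raw Mω b)) (raw Mω a) ≡ raw Mω b → a ∼ᴹ b
  sent⇒∼ a b eq = lengths , λ i j → mk⇔
    (λ e → trans (sym (sends (zip-lookup a b lengths i)))
             (trans (cong p e) (sends (zip-lookup a b lengths j))))
    (λ e → permutation-injective (raw Mω a) (raw Mω b)
      (trans (sends (zip-lookup a b lengths i)) (trans e (sym (sends (zip-lookup a b lengths j))))))
    where
    p : ℕ → ℕ
    p = permutation (raw Mω a) (raw Mω b)
    lengths : length a ≡ length b
    lengths = trans (sym (trans (Listₚ.length-map p (raw Mω a)) (Listₚ.length-map proj₁ a)))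
      (trans (cong length eq) (Listₚ.length-map proj₁ b))
    go : ∀ a b → List.map p (raw Mω a) ≡ raw Mω b → ∀ {x y} → Zip a b x y → p (proj₁ x) ≡ proj₁ y
    go (x ∷ a) (y ∷ b) eq here      = Listₚ.∷-injectiveˡ eq
    go (x ∷ a) (y ∷ b) eq (there z) = go a b (Listₚ.∷-injectiveʳ eq) z
    sends : ∀ {x y} → Zip a b x y → p (proj₁ x) ≡ proj₁ y
    sends = go a b eq

  raw-DomM : ∀ (a : Tuple M) {n} → n ∈ raw Mω a → DomM n
  raw-DomM a n∈ with ∈ₚ.∈-map⁻ proj₁ n∈
  ... | (_ , d) , _ , refl = d

  permuting : ∀ a b → a ∼ᴹ b → ¬ ([ M , M ] a ≃ b) → ∀ {e} →
    (∀ (x : ∣M∣) → φ (χ X) e (proj₁ x) (permutation (raw Mω a) (raw Mω b) (proj₁ x))) →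
    IsIndexOfMatching Mω (χ X) e a b
  permuting a b a∼b a≄b p-φ = record
    { π = record
      { to        = λ (n , d) → p n ,
          permutation-preserves DomM (raw Mω a) (raw Mω b) (raw-DomM a) (raw-DomM b) d
      ; cong      = cong p
      ; bijective = permutation-injective (raw Mω a) (raw Mω b) , λ (n , d) →
          let m , d′ , e = permutation-surjective DomM (raw Mω a) (raw Mω b) (raw-DomM a) (raw-DomM b) d
          in (m , d′) , λ { refl → e }
      }
    ; computes     = p-φ
    ; sends        = trans (Listₚ.map-∘ a) (∼⇒sent a b a∼b)
    ; automorphism = λ a≃b → contradiction a≃b a≄b
    }
    where
    p : ℕ → ℕ
    p = permutation (raw Mω a) (raw Mω b)

  -- The function returning indices of bijections

  Domain : ℕ → Set
  Domain n = ∃[ a ] ∃[ b ] n ≡ ⟨ ⌜ a ⌝ᴹ , ⌜ b ⌝ᴹ ⟩ × E ⌜ a ⌝ᴹ × a ∼ᴹ b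

  -- A single equation packs three conditions on `n`: step `s` lists its first component in E, its
  -- second component codes a tuple of M, and the permutation sends the first to the second. The
  -- successors in `expected` stem from `codeMaybe`, which reserves 0 for `nothing`.
  tests expected : ℕ × ℕ → ℕ
  tests (n , s) = codeMaybe proj₁ (enumerateE s) ∙ codeMaybe ⌜_⌝ᴹ (tupleM (π₂ n)) ∙
    codeList (List.map (permutation (listOf (π₁ n)) (listOf (π₂ n))) (listOf (π₁ n)))
  expected (n , s) = suc (π₁ n) ∙ suc (π₂ n) ∙ π₂ n

  ∙-injective : ∀ {x y x′ y′} → x ∙ y ≡ x′ ∙ y′ → x ≡ x′ × y ≡ y′
  ∙-injective {x} {y} {x′} {y′} eq =
    ⟨⟩-injective {x} {y} {x′} {y′} (trans (sym (∙≡⟨⟩ x y)) (trans eq (∙≡⟨⟩ x′ y′)))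

  accepted⇒domain : ∀ n s → tests (n , s) ≡ expected (n , s) → Domain n
  accepted⇒domain n s eq =
    let e₁ , eq′ = ∙-injective eq ; e₂ , e₃ = ∙-injective eq′ in
    go (enumerateE s) (tupleM (π₂ n)) refl e₁ e₂ e₃
    where
    go : ∀ (o : Maybe (∃ E)) (o′ : Maybe (Tuple M)) → tupleM (π₂ n) ≡ o′ →
         codeMaybe proj₁ o ≡ suc (π₁ n) → codeMaybe ⌜_⌝ᴹ o′ ≡ suc (π₂ n) →
         codeList (List.map (permutation (listOf (π₁ n)) (listOf (π₂ n))) (listOf (π₁ n))) ≡ π₂ n → Domain n
    go (just (_ , a , refl , Ea)) (just b) _ a≡ b≡ sent =
      a , b , sym (trans (cong₂ ⟨_,_⟩ (suc-injective a≡) (suc-injective b≡)) (⟨π₁,π₂⟩ n)) , (a , refl , Ea) ,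
      sent⇒∼ a b (trans (cong₂ (λ k l → List.map (permutation k l) k) (list a a≡) (list b b≡))
        (codeList-injective (trans sent (sym (suc-injective b≡)))))
      where
      list : ∀ c {m} → suc ⌜ c ⌝ᴹ ≡ suc m → raw Mω c ≡ listOf m
      list c e = trans (sym (listOf-codeList (raw Mω c))) (cong listOf (suc-injective e))

  domain⇒accepted : ∀ n → Domain n → ∃[ s ] tests (n , s) ≡ expected (n , s)
  domain⇒accepted n (a , b , n≡ , Ea , a∼b) =
    let s , _ , eq = enumerateE-complete ⌜ a ⌝ᴹ Ea
        _ , eq′ , b≡ = tupleM-complete b
    in s , cong₂ _∙_ (trans (cong (codeMaybe proj₁) eq) (cong suc (sym a≡)))
             (cong₂ _∙_ (trans (cong (codeMaybe ⌜_⌝ᴹ ∘ tupleM) b-eq)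
                          (trans (cong (codeMaybe ⌜_⌝ᴹ) eq′) (cong suc (trans b≡ (sym b-eq)))))
               (trans (cong₂ (λ k l → codeList (List.map (permutation k l) k)) (list a a≡) (list b b-eq))
                 (trans (cong codeList (∼⇒sent a b a∼b)) (sym b-eq))))
    where
    a≡ : π₁ n ≡ ⌜ a ⌝ᴹ
    a≡ = trans (cong π₁ n≡) (π₁-⟨⟩ ⌜ a ⌝ᴹ ⌜ b ⌝ᴹ)
    b-eq : π₂ n ≡ ⌜ b ⌝ᴹ
    b-eq = trans (cong π₂ n≡) (π₂-⟨⟩ ⌜ a ⌝ᴹ ⌜ b ⌝ᴹ)
    list : ∀ c {m} → m ≡ ⌜ c ⌝ᴹ → listOf m ≡ raw Mω c
    list c e = trans (cong listOf e) (listOf-codeList (raw Mω c))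

  accepted? : ∀ x → Dec (tests x ≡ expected x)
  accepted? x = tests x ≟ expected x

  accepted?⊢ : (λ ((n , s) : ℕ × ℕ) → n ∙ s) ⊢ (λ x → bit (accepted? x))
  accepted?⊢ = ≟⊢
    (enumerateE⊢ (snd⊢ id⊢) ,⊢ tupleM⊢ (π₂⊢ n⊢) ,⊢
      map⊢ {α = proj₂} (λ (n , _) → listOf (π₁ n)) (listOf⊢ (π₁⊢ n⊢))
        (permutation⊢ {a = λ ((n , _) , _) → listOf (π₁ n)} {λ ((n , _) , _) → listOf (π₂ n)}
          (list⊢ (weaken (π₁⊢ n⊢))) (list⊢ (weaken (π₂⊢ n⊢))) (snd⊢ id⊢)))
    (suc⊢ (π₁⊢ n⊢) ,⊢ suc⊢ (π₂⊢ n⊢) ,⊢ π₂⊢ n⊢)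
    where
    n⊢ : (λ ((n , s) : ℕ × ℕ) → n ∙ s) ⊢ proj₁
    n⊢ = fst⊢ id⊢
    list⊢ : {n : Γ → ℕ} → ε ⊢ n → ε ⊢ (λ γ → codeList (listOf (n γ)))
    list⊢ {n = n} = conv (λ γ → sym (proj₂ (decodeList (n γ))))

  Instance : Set
  Instance = Σ ℕ Domain

  left right : Instance → Tuple M
  left  (_ , a , _) = a
  right (_ , _ , b , _) = b

  Similar : Instance → Set
  Similar γ = [ M , M ] left γ ≃ right γ

  start : Σ Instance Similar → Pairing
  start ((_ , a , b , _ , Ea , _) , a≃b) = pairing a b a≃b Ea

  instance⊢ : proj₁ ⊢ (λ (γ : Instance) → ⌜ left γ ⌝ᴹ ∙ ⌜ right γ ⌝ᴹ)
  instance⊢ = unpair⊢ {f = λ γ → ⌜ left γ ⌝ᴹ} {λ γ → ⌜ right γ ⌝ᴹ} (conv (λ (_ , _ , _ , eq , _) → eq) id⊢)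

  opaque
    imageIndex : Σ[ s ∈ (Σ Instance Similar → ℕ) ] ((proj₁ ∘ proj₁) ⊢ s) ×
      (∀ γ (x : ∣M∣) → φ (χ X) (s γ) (proj₁ x) (proj₁ (image (start γ) x)))
    imageIndex = curry⊢ {α = λ (_ , x) → proj₁ x} (via (λ (γ , x) → start γ , x) image⊢
      ((fst⊢ id⊢ ⨾ reindex (proj₁ ∘ proj₁) instance⊢) ,⊢ snd⊢ id⊢))

    permutationIndex : Σ[ s ∈ (Instance → ℕ) ] (proj₁ ⊢ s) ×
      (∀ γ (x : ∣M∣) → φ (χ X) (s γ) (proj₁ x)
        (permutation (raw Mω (left γ)) (raw Mω (right γ)) (proj₁ x)))
    permutationIndex = curry⊢ {α = λ (_ , x) → proj₁ x}
      (permutation⊢ {a = λ (γ , _) → raw Mω (left γ)} {λ (γ , _) → raw Mω (right γ)}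
        (fst⊢ (weaken instance⊢)) (snd⊢ (weaken instance⊢)) (snd⊢ id⊢))

  -- Similarity is decided before an index is returned, so each index is committed to one of the two
  -- constructions.
  choose : ∀ γ → Dec (Similar γ) → ℕ
  choose γ (yes p) = proj₁ imageIndex (γ , p)
  choose γ (no _)  = proj₁ permutationIndex γ

  choice : Instance → ℕ
  choice γ = choose γ (≃ᴹ? (left γ) (right γ))

  choice⊢ : proj₁ ⊢ choice
  choice⊢ = dec⊢ choose (λ γ → ≃ᴹ? (left γ) (right γ))
    (≃ᴹ?⊢ left right (fst⊢ instance⊢) (snd⊢ instance⊢))
    (proj₁ (proj₂ imageIndex)) (reindex proj₁ (proj₁ (proj₂ permutationIndex)))

  choice-matching : ∀ γ → IsIndexOfMatching Mω (χ X) (choice γ) (left γ) (right γ)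
  choice-matching γ@(_ , _ , _ , _ , _ , a∼b) = go (≃ᴹ? (left γ) (right γ))
    where
    go : ∀ d → IsIndexOfMatching Mω (χ X) (choose γ d) (left γ) (right γ)
    go (yes p) = matching (start (γ , p)) (proj₂ (proj₂ imageIndex) (γ , p))
    go (no ¬p) = permuting (left γ) (right γ) a∼b ¬p (proj₂ (proj₂ permutationIndex) γ)

  opaque
    matcher : ∃[ e ] (∀ n y → φ (χ X) e n y → ∃[ s ] tests (n , s) ≡ expected (n , s)) ×
                     (∀ n (d : Domain n) → φ (χ X) e n (choice (n , d)))
    matcher = semidecide⊢ O! accepted? accepted?⊢ choice⊢ domain⇒accepted

  ultrahomogeneous : ComputablyCofinallyUltrahomogeneous Mω X
  ultrahomogeneous = record
    { E          = E
    ; isCofinal  = E-cofinal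
    ; E-ce       = E-ce
    ; g          = proj₁ matcher
    ; g-domain   = λ n → mk⇔
        (λ (y , r) → let s , eq = proj₁ (proj₂ matcher) n y r in accepted⇒domain n s eq)
        (λ d → _ , proj₂ (proj₂ matcher) n d)
    ; g-matching = λ a b y Ea a∼b r →
        let γ = _ , a , b , refl , Ea , a∼b in
        subst (λ e → IsIndexOfMatching Mω (χ X) e a b)
          (φ-functional O! (proj₂ (proj₂ matcher) _ (a , b , refl , Ea , a∼b)) r) (choice-matching γ)
    }

  limit : IsComputableCofinalFraïsséLimit Mω X 𝕂
  limit = record
    { computable       = M-computable
    ; ultrahomogeneous = ultrahomogeneous
    ; represents       = M-represents
    }

theorem6p19 : (L : Language) (X : Pred ℕ 0ℓ)
    (𝒦 : Pred (Structure L) 0ℓ) (𝕂 : Presentation L) →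
    IsAge 𝒦 → Represents X 𝕂 𝒦 →
    Presentation.EI 𝕂 ≤ᵀ X →
    cHP X 𝕂 → cJEP X 𝕂 → cCAP X 𝕂 𝒦 →
    Σ[ M ∈ ωStructure L ] IsComputableCofinalFraïsséLimit M X 𝕂
theorem6p19 L X 𝒦 𝕂 _ represents ei chp cjep ccap =
  Mω , limit
  where open Construction X 𝒦 𝕂 represents ei chp cjep ccap
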